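{- Let $k \geq 0$ be an integer. Then the sequence $(G(n,k))_{n=k}^{\infty}$ is (weakly) increasing and eventually constant. Moreover, denoting by $n(k)$ the first value of $n$ after which the sequence is constant, we have $$3 \cdot 2^{k-1} - 2 \leq n(k) \leq 4.394 \cdot 2^k .$$
   Context: $Q_n$ is the $n$-dimensional Boolean hypercube with vertex set $\{ -1,1\}^n$, two vertices being adjacent iff they differ in exactly one coordinate; $\Gamma(x)$ denotes the neighbourhood of $x$. A Boolean function on $Q_n$ is a function $f:\{ -1,1\}^n\to\{ -1,1\}$. A $k$-function is a Boolean function $f$ on $Q_n$ such that for every vertex $v$, $|\{w\in\Gamma(v): f(v)\neq f(w)\}|=k$. Two real-valued functions $f,g$ on $Q_n$ are isomorphic if there is a graph automorphism $\phi$ of $Q_n$ and a sign $\epsilon\in\{ -1,1\}$ with $f=\epsilon\, g\circ\phi$. $G(n,k)$ denotes the number of isomorphism classes of $k$-functions on $Q_n$. -}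

module Defs where

open import Data.Bool using (Bool; true; false; not; if_then_else_)
open import Data.Nat using (ℕ; zero; suc; _+_)
open import Data.Fin using (Fin)
open import Data.Vec using (Vec; []; _∷_; _[_]%=_)
open import Data.List using (List; length; filter; map; allFin)
open import Data.Product using (Σ; _×_; ∃)
open import Relation.Binary.PropositionalEquality using (_≡_; _≢_)
open import Relation.Nullary using (¬_)
open import Relation.Nullary.Decidable using (¬?)
open import Data.Bool.Properties using () renaming (_≟_ to _≟B_)
open import Function.Definitions using (Bijective)
open import Function.Bundles using (_⇔_)

-- Vertices of Q_n : {-1,1}^n, encoded as Bool^n (false ↦ 1, true ↦ -1).
Vertex : ℕ → Set
Vertex n = Vec Bool n

-- Boolean functions {-1,1}^n → {-1,1} (same encoding of ±1 as Bool).
BoolFn : ℕ → Set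
BoolFn n = Vertex n → Bool

hamming : ∀ {n} → Vertex n → Vertex n → ℕ
hamming [] [] = 0
hamming (a ∷ x) (b ∷ y) = (if a Data.Bool.xor b then 1 else 0) + hamming x y
  where import Data.Bool

Adjacent : ∀ {n} → Vertex n → Vertex n → Set
Adjacent x y = hamming x y ≡ 1

flipAt : ∀ {n} → Fin n → Vertex n → Vertex n
flipAt i v = v [ i ]%= not

Γ : ∀ {n} → Vertex n → List (Vertex n)
Γ {n} v = map (λ i → flipAt i v) (allFin n)

disagree : ∀ {n} → BoolFn n → Vertex n → ℕ
disagree f v = length (filter (λ w → ¬? (f v ≟B f w)) (Γ v))

IsKFunction : ∀ {n} → ℕ → BoolFn n → Set
IsKFunction {n} k f = ∀ (v : Vertex n) → disagree f v ≡ k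

IsAutomorphism : ∀ {n} → (Vertex n → Vertex n) → Set
IsAutomorphism {n} φ =
  Bijective _≡_ _≡_ φ × (∀ (x y : Vertex n) → Adjacent x y ⇔ Adjacent (φ x) (φ y))

-- multiplication by a sign ε ∈ {-1,1} (true ↦ -1 flips the value)
applySign : Bool → Bool → Bool
applySign ε b = if ε then not b else b

Isomorphic : ∀ {n} → BoolFn n → BoolFn n → Set
Isomorphic {n} f g =
  Σ (Vertex n → Vertex n) λ φ → IsAutomorphism φ ×
  Σ Bool λ ε → ∀ (x : Vertex n) → f x ≡ applySign ε (g (φ x))

-- "G(n,k) = m": there are exactly m isomorphism classes of k-functions on Q_n,
-- witnessed by m pairwise non-isomorphic k-functions such that every
-- k-function is isomorphic to one of them.
IsG : ℕ → ℕ → ℕ → Set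
IsG n k m =
  Σ (Fin m → BoolFn n) λ rep →
    (∀ i → IsKFunction k (rep i)) ×
    (∀ i j → Isomorphic (rep i) (rep j) → i ≡ j) ×
    (∀ (f : BoolFn n) → IsKFunction k f → ∃ λ i → Isomorphic f (rep i))

{-# OPTIONS --safe #-}
-- A k-function is an eigenfunction of the Laplacian, hence a polynomial of degree k. For a Boolean
-- function of degree d let W be the sum of 2 ^ (- deg ∂ᵢ f) / 2 over its relevant variables i, so that
-- a k-function with n relevant variables has W ≥ n / 2 ^ k. Parseval gives W ≤ d / 2. Fixing the
-- variables of a monomial of top degree d to suitable values costs at most d / 2 ^ d of W, and it
-- destroys a sensitive block at every point. The number of disjoint sensitive blocks is bounded in terms of
-- the degree: symmetrization turns b blocks into a polynomial of degree ≤ d with values in [0, 1]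
-- at 0, …, b that jumps from 0 to 1 between 0 and 1, and a linear functional that annihilates
-- polynomials of degree ≤ d excludes it. For 8 ≤ d ≤ 20 these functionals are optimal, which
-- gives about 0.6 d² blocks; for larger d the bound 4 d² suffices. Summing over the degrees, W ≤ 4.394.
--
-- The number of classes increases because an automorphism of the cube permutes the directions, so
-- that functions on a facet that are isomorphic on the cube are isomorphic on the facet. Once every
-- k-function has an irrelevant variable the number is constant, and it jumps where a k-function
-- depending on all variables appears; (x + y) / 2 · f(z) + (x - y) / 2 · f(w) gives such functions
-- on 3 · 2 ^ (k - 1) - 2 variables.
module Submission where

-- The obstacle is that one top monomial may survive after another, so the loss d / 2 ^ d can recur.
-- Every round destroys a block for good, and blocks lost at degree d are missing at all smaller
-- degrees. If B d bounds the number of blocks in degree d, the worst case has B d - B (d - 1)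
-- rounds at degree d, and the series of d (B d - B (d - 1)) / 2 ^ d has to be summed. To make this
-- an induction on d, the number b of blocks stays a variable: `Linear` asserts W ≤ (d b + κ) / 2 ^
-- d, and passing to d + 1 turns κ into 2 κ + (d - 1) B d. The constant 4.394 is the numerical
-- outcome of this recursion: up to degree 8 it is combined with W ≤ d / 2, degrees 8 to 20 carry
-- most of what remains and need the optimal functionals, and beyond them the factor 2 ^ (- d) makes
-- 4 d² harmless. Counting classes by a number also requires isomorphism to be decidable, so an
-- arbitrary automorphism of the cube has to be recognised as one of finitely many signed
-- permutations.

-- Integer polynomials and linear functionals that refute steep ones

module Polynomials where

  open import Data.Nat as ℕ using (ℕ; zero; suc; z≤n)
  open import Data.Integer hiding (suc)
  open import Data.Integer.Properties
  open import Data.Integer.Tactic.RingSolver using (solve-∀)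
  open import Data.Product using (Σ; _×_; _,_; proj₁; proj₂)
  open import Data.List using (List; []; _∷_; map)
  open import Data.Unit using (⊤; tt)
  open import Data.Empty using (⊥)
  import Data.Nat.Properties as ℕₚ
  open import Relation.Binary.PropositionalEquality
  open import Relation.Nullary using (Dec; yes; no; ¬_)
  open import Relation.Nullary.Decidable using (_×-dec_)

  -- Polynomials of degree < d, in Horner form with respect to the falling factorials.
  Poly< : ℕ → (ℕ → ℤ) → Set
  Poly< zero    u = ∀ j → u j ≡ 0ℤ
  Poly< (suc d) u = Σ (ℕ → ℤ) λ v → Poly< d v × (∀ j → u (suc j) ≡ u 0 + + suc j * v j)

  Poly<-ext : ∀ d {u v} → (∀ j → u j ≡ v j) → Poly< d u → Poly< d v
  Poly<-ext zero    e p j = trans (sym (e j)) (p j)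
  Poly<-ext (suc d) e (w , p , q) =
    w , p , λ j → trans (sym (e (suc j))) (trans (q j) (cong (_+ + suc j * w j) (e 0)))

  Poly<-+ : ∀ d {u v} → Poly< d u → Poly< d v → Poly< d (λ j → u j + v j)
  Poly<-+ zero    p q j = cong₂ _+_ (p j) (q j)
  Poly<-+ (suc d) {u} {v} (u′ , p , e) (v′ , q , e′) =
    (λ j → u′ j + v′ j) , Poly<-+ d p q ,
    λ j → trans (cong₂ _+_ (e j) (e′ j)) (lem (u 0) (v 0) (+ suc j) (u′ j) (v′ j))
    where
    lem : ∀ a b c x y → (a + c * x) + (b + c * y) ≡ (a + b) + c * (x + y)
    lem = solve-∀

  up : (ℕ → ℤ) → ℕ → ℤ
  up u zero    = 0ℤ
  up u (suc j) = + suc j * u j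

  Poly<-up : ∀ d {u} → Poly< d u → Poly< (suc d) (up u)
  Poly<-up d {u} p = u , p , λ j → sym (+-identityˡ _)

  -- The sum is `c * u j` minus `j` times the backward difference of `u`: the difference loses the
  -- degree that the factor `j` adds.
  Poly<-mix : ∀ d c {u} → Poly< d u → Poly< d (λ j → (c - + j) * u j + up u j)
  Poly<-mix zero c {u} p j = begin
    (c - + j) * u j + up u j  ≡⟨ cong₂ _+_ (trans (cong ((c - + j) *_) (p j)) (*-zeroʳ (c - + j))) (up0 j) ⟩
    0ℤ                        ∎
    where
    open ≡-Reasoning
    up0 : ∀ j → up u j ≡ 0ℤ
    up0 zero    = refl
    up0 (suc j) = trans (cong (+ suc j *_) (p j)) (*-zeroʳ (+ suc j))
  Poly<-mix (suc d) c {u} (v , p , e) = _ , Poly<-mix d (c - 1ℤ) p , eq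
    where
    lem₀ : ∀ c a x → (c - 1ℤ) * (a + 1ℤ * x) + 1ℤ * a
         ≡ (c - 0ℤ) * a + 0ℤ + 1ℤ * ((c - 1ℤ - 0ℤ) * x + 0ℤ)
    lem₀ = solve-∀
    lem : ∀ c a j x y → (c - (1ℤ + j)) * (a + (1ℤ + j) * x) + (1ℤ + j) * (a + j * y)
        ≡ (c - 0ℤ) * a + 0ℤ + (1ℤ + j) * ((c - 1ℤ - j) * x + j * y)
    lem = solve-∀
    eq : ∀ j → (c - + suc j) * u (suc j) + + suc j * u j
       ≡ (c - 0ℤ) * u 0 + 0ℤ + + suc j * ((c - 1ℤ - + j) * v j + up v j)
    eq zero    rewrite e 0 = lem₀ c (u 0) (v 0)
    eq (suc j) rewrite e (suc j) | e j = lem c (u 0) (+ suc j) (v (suc j)) (v j)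

  -- Linear functionals on functions ℕ → ℤ, given by weighted nodes.
  Functional : Set
  Functional = List (ℕ × ℤ)

  apply : Functional → (ℕ → ℤ) → ℤ
  apply []            u = 0ℤ
  apply ((t , w) ∷ L) u = w * u t + apply L u

  total : Functional → ℤ
  total []            = 0ℤ
  total ((_ , w) ∷ L) = w + total L

  -- The transpose of a Horner step: a functional applied to `x * v (x - 1)` is its shift applied to
  -- `v`. A node at 0 disappears because of the factor `x`.
  shift : Functional → Functional
  shift []                = []
  shift ((zero  , w) ∷ L) = shift L
  shift ((suc t , w) ∷ L) = (t , w * + suc t) ∷ shift L

  Annihilates : ℕ → Functional → Set
  Annihilates zero    L = ⊤
  Annihilates (suc d) L = total L ≡ 0ℤ × Annihilates d (shift L)

  annihilates? : ∀ d L → Dec (Annihilates d L)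
  annihilates? zero    L = yes tt
  annihilates? (suc d) L = (total L ≟ 0ℤ) ×-dec annihilates? d (shift L)

  apply-zero : ∀ L {u} → (∀ j → u j ≡ 0ℤ) → apply L u ≡ 0ℤ
  apply-zero []            p = refl
  apply-zero ((t , w) ∷ L) p =
    cong₂ _+_ (trans (cong (w *_) (p t)) (*-zeroʳ w)) (apply-zero L p)

  apply-horner : ∀ L {u v} → (∀ j → u (suc j) ≡ u 0 + + suc j * v j) →
                 apply L u ≡ total L * u 0 + apply (shift L) v
  apply-horner [] {u} e = sym (trans (+-identityʳ _) (*-zeroˡ (u 0)))
  apply-horner ((zero , w) ∷ L) {u} {v} e rewrite apply-horner L {u} {v} e =
    lem w (u 0) (total L) (apply (shift L) v)
    where
    lem : ∀ w a t s → w * a + (t * a + s) ≡ (w + t) * a + s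
    lem = solve-∀
  apply-horner ((suc t , w) ∷ L) {u} {v} e rewrite apply-horner L {u} {v} e | e t =
    lem w (u 0) (+ suc t) (v t) (total L) (apply (shift L) v)
    where
    lem : ∀ w a c x t s → w * (a + c * x) + (t * a + s) ≡ (w + t) * a + (w * c * x + s)
    lem = solve-∀

  annihilates-sound : ∀ d L {u} → Annihilates d L → Poly< d u → apply L u ≡ 0ℤ
  annihilates-sound zero    L _ p = apply-zero L p
  annihilates-sound (suc d) L {u} (z , A) (v , p , e) = begin
    apply L u                            ≡⟨ apply-horner L e ⟩
    total L * u 0 + apply (shift L) v    ≡⟨ cong₂ _+_ (cong (_* u 0) z) (annihilates-sound d (shift L) A p) ⟩
    0ℤ * u 0 + 0ℤ                        ≡⟨ cong (_+ 0ℤ) (*-zeroˡ (u 0)) ⟩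
    0ℤ                                   ∎
    where open ≡-Reasoning

  negPart : ℤ → ℕ
  negPart (+ _)      = 0
  negPart -[1+ n ]   = suc n

  negTotal : Functional → ℕ
  negTotal []            = 0
  negTotal ((_ , w) ∷ L) = negPart w ℕ.+ negTotal L

  NodesBelow : ℕ → Functional → Set
  NodesBelow r []            = ⊤
  NodesBelow r ((t , _) ∷ L) = t ℕ.≤ r × NodesBelow r L

  nodesBelow? : ∀ r L → Dec (NodesBelow r L)
  nodesBelow? r []            = yes tt
  nodesBelow? r ((t , _) ∷ L) = (t ℕ.≤? r) ×-dec nodesBelow? r L

  -- Integer form of a function with values in [0, 1] that jumps from 0 to 1; the scale `suc m`
  -- absorbs the factorial that symmetrization introduces.
  Steep : ℕ → (ℕ → ℤ) → Set
  Steep r u = Σ ℕ λ m → (u 0 ≡ 0ℤ) × (u 1 ≡ + suc m) × (∀ j → j ℕ.≤ r → 0ℤ ≤ u j × u j ≤ + suc m)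

  negPart-bound : ∀ w x m → 0ℤ ≤ x → x ≤ + m → - (+ (negPart w ℕ.* m)) ≤ w * x
  negPart-bound (+ n) (+ x) m _ _ rewrite sym (pos-* n x) = +≤+ z≤n
  negPart-bound -[1+ n ] (+ x) m _ (+≤+ x≤m) = begin
    - (+ (suc n ℕ.* m))     ≡⟨ cong -_ (pos-* (suc n) m) ⟩
    - (+ suc n * + m)       ≤⟨ neg-mono-≤ (*-monoˡ-≤-nonNeg (+ suc n) (+≤+ x≤m)) ⟩
    - (+ suc n * + x)       ≡⟨ neg-distribˡ-* (+ suc n) (+ x) ⟩
    -[1+ n ] * + x          ∎
    where open ≤-Reasoning

  apply-lower : ∀ L {r m u} → NodesBelow r L → (∀ j → j ℕ.≤ r → 0ℤ ≤ u j × u j ≤ + m) →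
                - (+ (negTotal L ℕ.* m)) ≤ apply L u
  apply-lower [] _ _ = ≤-refl
  apply-lower ((t , w) ∷ L) {r} {m} {u} (t≤r , N) B = begin
    - (+ ((negPart w ℕ.+ negTotal L) ℕ.* m))  ≡⟨ cong (λ z → - (+ z)) (*-distribʳ-+ℕ m (negPart w) (negTotal L)) ⟩
    - (+ (negPart w ℕ.* m ℕ.+ negTotal L ℕ.* m))  ≡⟨ neg-distrib-+ (+ (negPart w ℕ.* m)) (+ (negTotal L ℕ.* m)) ⟩
    - (+ (negPart w ℕ.* m)) + - (+ (negTotal L ℕ.* m))
      ≤⟨ +-mono-≤ (negPart-bound w (u t) m (proj₁ (B t t≤r)) (proj₂ (B t t≤r))) (apply-lower L N B) ⟩
    w * u t + apply L u ∎
    where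
    open ≤-Reasoning
    open import Data.Nat.Properties using () renaming (*-distribʳ-+ to *-distribʳ-+ℕ)

  prodℤ : List ℤ → ℤ
  prodℤ []       = 1ℤ
  prodℤ (x ∷ xs) = x * prodℤ xs

  picks : ∀ {A : Set} → List A → List (A × List A)
  picks []       = []
  picks (x ∷ xs) = (x , xs) ∷ map (λ (y , ys) → y , x ∷ ys) (picks xs)

  -- The Lagrange weight of a node t is 1 / ∏ (t - s) over the other nodes s;
  -- all weights are multiplied by the product of these denominators.
  lagrange : List ℕ → Functional
  lagrange ts = map (λ ((t , _) , others) → t , prodℤ (map proj₂ others))
    (picks (map (λ (t , ss) → t , prodℤ (map (λ s → + t - + s) ss)) (picks ts)))

  -- A dual solution. On a steep function the node 0 contributes nothing, the node 1 contributes
  -- `w₁` times the maximum, and the other nodes at least `- negTotal L` times the maximum, so the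
  -- value is positive although the functional annihilates polynomials of degree < `d`.
  data Certificate (d r : ℕ) : Functional → Set where
    certificate : ∀ {w₀ w₁ L} → Annihilates d ((0 , w₀) ∷ (1 , + w₁) ∷ L) → NodesBelow r L →
                  negTotal L ℕ.< w₁ → Certificate d r ((0 , w₀) ∷ (1 , + w₁) ∷ L)

  scale : ℤ → Functional → Functional
  scale c = map (λ (t , w) → t , c * w)

  secondSign : Functional → ℤ
  secondSign (_ ∷ (_ , w) ∷ _) = sign w ◃ 1
  secondSign _                 = 1ℤ

  -- Up to scaling, the divided difference over the nodes 0, 1 and `ts`; the sign is chosen so that
  -- the node 1 does not receive a negative weight.
  certify : List ℕ → Functional
  certify ts = let L = lagrange (0 ∷ 1 ∷ ts) in scale (secondSign L) L

  certificate? : ∀ d r L → Dec (Certificate d r L)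
  certificate? d r ((0 , w₀) ∷ (1 , + w₁) ∷ L)
    with annihilates? d ((0 , w₀) ∷ (1 , + w₁) ∷ L) | nodesBelow? r L | negTotal L ℕ.<? w₁
  ... | yes a | yes b | yes c = yes (certificate a b c)
  ... | no ¬a | _ | _ = no λ { (certificate a _ _) → ¬a a }
  ... | _ | no ¬b | _ = no λ { (certificate _ b _) → ¬b b }
  ... | _ | _ | no ¬c = no λ { (certificate _ _ c) → ¬c c }
  certificate? d r []  = no λ ()
  certificate? d r (_ ∷ []) = no λ ()
  certificate? d r ((suc _ , _) ∷ _ ∷ _)  = no λ ()
  certificate? d r ((0 , _) ∷ (0 , _) ∷ _)  = no λ ()
  certificate? d r ((0 , _) ∷ (suc (suc _) , _) ∷ _)  = no λ ()
  certificate? d r ((0 , _) ∷ (1 , -[1+ _ ]) ∷ _)  = no λ ()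


  certificate-refutes : ∀ {d r L u} → Certificate d r L → Poly< d u → Steep r u → ⊥
  certificate-refutes {d} {r} {L} {u} (certificate {w₀} {w₁} {L′} A N neg<w₁) p (m , u0 , u1 , B) =
    ℕₚ.<⇒≱ neg<w₁ (ℕₚ.*-cancelʳ-≤ w₁ (negTotal L′) (suc m) (drop‿+≤+ (neg-cancel-≤ bound)))
    where
    tail≡ : apply L′ u ≡ - (+ (w₁ ℕ.* suc m))
    tail≡ = begin
      apply L′ u                                       ≡⟨ lem w₀ (+ w₁ * + suc m) (apply L′ u) ⟩
      w₀ * 0ℤ + (+ w₁ * + suc m + apply L′ u) - + w₁ * + suc m
        ≡⟨ cong₂ (λ a b → w₀ * a + (+ w₁ * b + apply L′ u) - + w₁ * + suc m) u0 u1 ⟨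
      apply ((0 , w₀) ∷ (1 , + w₁) ∷ L′) u - + w₁ * + suc m
        ≡⟨ cong (_- + w₁ * + suc m) (annihilates-sound d ((0 , w₀) ∷ (1 , + w₁) ∷ L′) A p) ⟩
      0ℤ - + w₁ * + suc m                              ≡⟨ +-identityˡ _ ⟩
      - (+ w₁ * + suc m)                               ≡⟨ cong -_ (pos-* w₁ (suc m)) ⟨
      - (+ (w₁ ℕ.* suc m))                             ∎
      where
      open ≡-Reasoning
      lem : ∀ w a b → b ≡ w * 0ℤ + (a + b) - a
      lem = solve-∀
    bound : - (+ (negTotal L′ ℕ.* suc m)) ≤ - (+ (w₁ ℕ.* suc m))
    bound = subst (- (+ (negTotal L′ ℕ.* suc m)) ≤_) tail≡ (apply-lower L′ N B)


-- Polynomials of degree D are not steep on 0, ..., 4 D²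

module SteepPolynomials where

  open Polynomials
  open import Data.Nat as ℕ using (ℕ; zero; suc; z≤n; s≤s)
  import Data.Nat.Properties as ℕₚ
  import Data.Nat.Tactic.RingSolver as ℕ-Ring
  open import Data.Integer hiding (suc)
  open import Data.Integer.Properties
  open import Data.Integer.Tactic.RingSolver using (solve-∀)
  open import Data.Product using (Σ; _×_; _,_; proj₁; proj₂)
  open import Data.Empty using (⊥)
  open import Relation.Binary.PropositionalEquality
  open import Data.Sum using (inj₁; inj₂)

  Δ : (ℕ → ℤ) → ℕ → ℤ
  Δ v j = v (suc j) - v j

  -- Polynomials of degree < m, in the sense that the m-th difference vanishes.
  data Diff< : ℕ → (ℕ → ℤ) → Set where
    vanishes   : ∀ {v} → (∀ j → v j ≡ 0ℤ) → Diff< 0 v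
    difference : ∀ {m v} → Diff< m (Δ v) → Diff< (suc m) v

  Diff<-ext : ∀ {m u v} → (∀ j → u j ≡ v j) → Diff< m u → Diff< m v
  Diff<-ext e (vanishes p)   = vanishes λ j → trans (sym (e j)) (p j)
  Diff<-ext e (difference p) = difference (Diff<-ext (λ j → cong₂ _-_ (e (suc j)) (e j)) p)

  Diff<-+ : ∀ {m u v} → Diff< m u → Diff< m v → Diff< m (λ j → u j + v j)
  Diff<-+ (vanishes p) (vanishes q) = vanishes λ j → cong₂ _+_ (p j) (q j)
  Diff<-+ {u = u} {v} (difference p) (difference q) =
    difference (Diff<-ext (λ j → lem (u (suc j)) (u j) (v (suc j)) (v j)) (Diff<-+ p q))
    where
    lem : ∀ a b c d → (a - b) + (c - d) ≡ (a + c) - (b + d)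
    lem = solve-∀

  Diff<-scale : ∀ {m} c {u} → Diff< m u → Diff< m (λ j → c * u j)
  Diff<-scale c (vanishes p) = vanishes λ j → trans (cong (c *_) (p j)) (*-zeroʳ c)
  Diff<-scale c {u} (difference p) =
    difference (Diff<-ext (λ j → lem c (u (suc j)) (u j)) (Diff<-scale c p))
    where
    lem : ∀ c a b → c * (a - b) ≡ c * a - c * b
    lem = solve-∀

  Diff<-shift : ∀ {m u} → Diff< m u → Diff< m (λ j → u (suc j))
  Diff<-shift (vanishes p)   = vanishes λ j → p (suc j)
  Diff<-shift (difference p) = difference (Diff<-shift p)

  Diff<-suc : ∀ {m u} → Diff< m u → Diff< (suc m) u
  Diff<-suc (vanishes p)   = difference (vanishes λ j → cong₂ _-_ (p (suc j)) (p j))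
  Diff<-suc (difference p) = difference (Diff<-suc p)

  Diff<-const : ∀ m c → Diff< (suc m) (λ _ → c)
  Diff<-const zero    c = difference (vanishes λ _ → +-inverseʳ c)
  Diff<-const (suc m) c = Diff<-suc (Diff<-const m c)

  Diff<-linear : ∀ {m} c {u} → Diff< m u → Diff< (suc m) (λ j → (+ j - c) * u j)
  Diff<-linear c {u} (vanishes p) = Diff<-suc (vanishes zero-at)
    where
    zero-at : ∀ j → (+ j - c) * u j ≡ 0ℤ
    zero-at j = trans (cong ((+ j - c) *_) (p j)) (*-zeroʳ (+ j - c))
  Diff<-linear c {u} (difference p) = difference
    (Diff<-ext (λ j → lem (+ j) c (u (suc j)) (u j))
      (Diff<-+ (Diff<-linear c p) (Diff<-shift {u = u} (difference p))))
    where
    lem : ∀ j c a b → (j - c) * (a - b) + a ≡ (1ℤ + j - c) * a - (j - c) * b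
    lem = solve-∀

  -- The i-th of the points (2 z)² for z = - D, …, D.
  node : ℕ → ℕ → ℤ
  node D i = + 4 * ((+ i - + D) * (+ i - + D))

  -- Each Horner step multiplies by a quadratic in the index, hence the doubled degree, and
  -- evaluates the quotient one unit lower, hence the offset `s`. The extension `U` to ℤ is there
  -- because `node D i - s` can be negative.
  Poly<-at-nodes : ∀ D d {u} → Poly< d u → Σ (ℤ → ℤ) λ U →
                   (∀ j → U (+ j) ≡ u j) × (∀ s → Diff< (d ℕ.+ d) (λ i → U (node D i - s)))
  Poly<-at-nodes D zero    p = (λ _ → 0ℤ) , (λ j → sym (p j)) , λ _ → vanishes λ _ → refl
  Poly<-at-nodes D (suc d) {u} (v , p , e) = U , U≡ , diff
    where
    rec = Poly<-at-nodes D d p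
    V   = proj₁ rec
    U : ℤ → ℤ
    U y = u 0 + y * V (y - 1ℤ)
    U≡ : ∀ j → U (+ j) ≡ u j
    U≡ zero    = trans (cong (λ z → u 0 + z) (*-zeroˡ (V (0ℤ - 1ℤ)))) (+-identityʳ _)
    U≡ (suc j) = trans (cong (λ z → u 0 + + suc j * z) (proj₁ (proj₂ rec) j)) (sym (e j))
    lem : ∀ a z s x → a + (+ 4 * (z * (z * x)) + - s * x) ≡ a + (+ 4 * (z * z) - s) * x
    lem = solve-∀
    lem′ : ∀ n s → n - (s + 1ℤ) ≡ n - s - 1ℤ
    lem′ = solve-∀
    module _ (s : ℤ) where
      g : ℕ → ℤ
      g i = V (node D i - (s + 1ℤ))
      pg : Diff< (d ℕ.+ d) g
      pg = proj₂ (proj₂ rec) (s + 1ℤ)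
      diff : Diff< (suc d ℕ.+ suc d) (λ i → U (node D i - s))
      diff = subst (λ k → Diff< (suc k) (λ i → U (node D i - s))) (sym (ℕₚ.+-suc d d))
        (Diff<-ext
          (λ i → trans (lem (u 0) (+ i - + D) s (g i))
                       (cong (λ y → u 0 + (node D i - s) * V y) (lem′ (node D i) s)))
          (Diff<-+ (Diff<-const (1 ℕ.+ (d ℕ.+ d)) (u 0))
            (Diff<-+ (Diff<-scale (+ 4) (Diff<-linear (+ D) (Diff<-linear (+ D) pg)))
                     (Diff<-scale (- s) (Diff<-suc (Diff<-suc pg))))))

  -- binom i j is the binomial coefficient (i + j choose i).
  binom : ℕ → ℕ → ℕ
  binom zero    j       = 1
  binom (suc i) zero    = 1
  binom (suc i) (suc j) = binom i (suc j) ℕ.+ binom (suc i) j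

  binom-comm : ∀ i j → binom i j ≡ binom j i
  binom-comm zero    zero    = refl
  binom-comm zero    (suc j) = refl
  binom-comm (suc i) zero    = refl
  binom-comm (suc i) (suc j) =
    trans (cong₂ ℕ._+_ (binom-comm i (suc j)) (binom-comm (suc i) j)) (ℕₚ.+-comm (binom (suc j) i) _)

  binom-pos : ∀ i j → 1 ℕ.≤ binom i j
  binom-pos zero    j       = s≤s z≤n
  binom-pos (suc i) zero    = s≤s z≤n
  binom-pos (suc i) (suc j) = ℕₚ.≤-trans (binom-pos i (suc j)) (ℕₚ.m≤m+n _ _)

  -- Rows of Pascal's triangle increase towards the middle. For `j < i` Pascal's rule reduces this
  -- to two instances in the preceding row; on the diagonal it is the symmetry.
  binom-balance : ∀ i j → j ℕ.≤ i → binom (suc i) j ℕ.≤ binom i (suc j)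
  binom-balance i zero _ = binom-pos i 1
  binom-balance (suc i) (suc j) (s≤s j≤i) with ℕₚ.m≤n⇒m<n∨m≡n j≤i
  ... | inj₂ refl = ℕₚ.≤-reflexive (binom-comm (suc (suc i)) (suc i))
  ... | inj₁ j<i  = begin
    binom (suc i) (suc j) ℕ.+ binom (suc (suc i)) j
      ≤⟨ ℕₚ.+-monoʳ-≤ (binom (suc i) (suc j))
           (ℕₚ.≤-trans (binom-balance (suc i) j (ℕₚ.m≤n⇒m≤1+n j≤i)) (binom-balance i (suc j) j<i)) ⟩
    binom (suc i) (suc j) ℕ.+ binom i (suc (suc j))
      ≡⟨ ℕₚ.+-comm (binom (suc i) (suc j)) _ ⟩
    binom i (suc (suc j)) ℕ.+ binom (suc i) (suc j) ∎
    where open ℕₚ.≤-Reasoning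

  binom-central : ∀ t i → binom (t ℕ.+ (t ℕ.+ i)) i ℕ.≤ binom (t ℕ.+ i) (t ℕ.+ i)
  binom-central zero    i = ℕₚ.≤-refl
  binom-central (suc t) i = begin
    binom (suc t ℕ.+ (suc t ℕ.+ i)) i      ≤⟨ binom-balance (t ℕ.+ (suc t ℕ.+ i)) i (ℕₚ.≤-trans (ℕₚ.m≤n+m i (suc t)) (ℕₚ.m≤n+m _ t)) ⟩
    binom (t ℕ.+ suc (t ℕ.+ i)) (suc i)    ≡⟨ cong (λ z → binom (t ℕ.+ z) (suc i)) (ℕₚ.+-suc t i) ⟨
    binom (t ℕ.+ (t ℕ.+ suc i)) (suc i)    ≤⟨ binom-central t (suc i) ⟩
    binom (t ℕ.+ suc i) (t ℕ.+ suc i)      ≡⟨ cong (λ z → binom z z) (ℕₚ.+-suc t i) ⟩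
    binom (suc t ℕ.+ i) (suc t ℕ.+ i)      ∎
    where open ℕₚ.≤-Reasoning

  parity : ℕ → ℤ
  parity zero    = 1ℤ
  parity (suc j) = - parity j

  -- The part of the (i + j)-th difference that involves the arguments i, …, i + j.
  alternating : ℕ → ℕ → (ℕ → ℤ) → ℤ
  alternating i zero    v = + binom i 0 * v i
  alternating i (suc j) v = parity (suc j) * + binom i (suc j) * v i + alternating (suc i) j v

  alternating-- : ∀ i j u v → alternating i j (λ x → u x - v x) ≡ alternating i j u - alternating i j v
  alternating-- i zero    u v = lem (+ binom i 0) (u i) (v i)
    where
    lem : ∀ c a b → c * (a - b) ≡ c * a - c * b
    lem = solve-∀
  alternating-- i (suc j) u v rewrite alternating-- (suc i) j u v =
    lem (parity (suc j) * + binom i (suc j)) (u i) (v i) (alternating (suc i) j u) (alternating (suc i) j v)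
    where
    lem : ∀ c a b x y → c * (a - b) + (x - y) ≡ (c * a + x) - (c * b + y)
    lem = solve-∀

  -- Pascal's rule for a tail of the sum. Tails are the right generality because `alternating` peels
  -- its terms off at the front.
  alternating-pascal : ∀ i j v → alternating (suc i) (suc j) v
                     ≡ alternating i (suc j) (λ x → v (suc x)) - alternating (suc i) j v
  alternating-pascal i zero v =
    lem (+ binom i 1) (v (suc i)) (v (suc (suc i)))
    where
    lem : ∀ b x y → - 1ℤ * (b + 1ℤ) * x + 1ℤ * y ≡ - 1ℤ * b * x + 1ℤ * y - 1ℤ * x
    lem = solve-∀
  alternating-pascal i (suc j) v rewrite alternating-pascal (suc i) j v =
    lem (parity j) (+ binom i (suc (suc j))) (+ binom (suc i) (suc j)) (v (suc i))
        (alternating (suc i) (suc j) (λ x → v (suc x))) (alternating (suc (suc i)) j v)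
    where
    lem : ∀ p b c x y z → - - p * (b + c) * x + (y - z) ≡ - - p * b * x + y - (- p * c * x + z)
    lem = solve-∀

  alternating-Δ : ∀ m v → alternating 0 (suc m) v ≡ alternating 0 m (Δ v)
  alternating-Δ zero v = lem (v 0) (v 1)
    where
    lem : ∀ x y → - 1ℤ * 1ℤ * x + 1ℤ * y ≡ 1ℤ * (y - x)
    lem = solve-∀
  alternating-Δ (suc m) v
    rewrite alternating-- 0 (suc m) (λ j → v (suc j)) v | alternating-pascal 0 m v =
    lem (parity m) (v 0) (alternating 0 (suc m) (λ x → v (suc x))) (alternating 1 m v)
    where
    lem : ∀ p x y z → - - p * 1ℤ * x + (y - z) ≡ y - (- p * 1ℤ * x + z)
    lem = solve-∀

  alternating-vanishes : ∀ {m v} → Diff< m v → alternating 0 m v ≡ 0ℤ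
  alternating-vanishes {v = v} (vanishes p)           = trans (*-identityˡ (v 0)) (p 0)
  alternating-vanishes {suc m} {v} (difference p) = trans (alternating-Δ m v) (alternating-vanishes p)

  ∣parity∣ : ∀ j → ∣ parity j ∣ ≡ 1
  ∣parity∣ zero    = refl
  ∣parity∣ (suc j) = trans (∣-i∣≡∣i∣ (parity j)) (∣parity∣ j)

  ∣term∣ : ∀ j b x → ∣ parity j * + b * x ∣ ≡ b ℕ.* ∣ x ∣
  ∣term∣ j b x = begin
    ∣ parity j * + b * x ∣           ≡⟨ abs-* (parity j * + b) x ⟩
    ∣ parity j * + b ∣ ℕ.* ∣ x ∣     ≡⟨ cong (ℕ._* ∣ x ∣) (abs-* (parity j) (+ b)) ⟩
    ∣ parity j ∣ ℕ.* b ℕ.* ∣ x ∣     ≡⟨ cong (λ z → z ℕ.* b ℕ.* ∣ x ∣) (∣parity∣ j) ⟩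
    1 ℕ.* b ℕ.* ∣ x ∣                ≡⟨ cong (ℕ._* ∣ x ∣) (ℕₚ.*-identityˡ b) ⟩
    b ℕ.* ∣ x ∣                      ∎
    where open ≡-Reasoning

  sum₁ : (ℕ → ℕ) → ℕ → ℕ
  sum₁ X zero    = 0
  sum₁ X (suc t) = sum₁ X t ℕ.+ X (suc t)

  ∣a∣≤∣b+a∣+∣b∣ : ∀ a b → ∣ a ∣ ℕ.≤ ∣ b + a ∣ ℕ.+ ∣ b ∣
  ∣a∣≤∣b+a∣+∣b∣ a b = subst (λ z → ∣ z ∣ ℕ.≤ ∣ b + a ∣ ℕ.+ ∣ b ∣) (lem a b) (∣i-j∣≤∣i∣+∣j∣ (b + a) b)
    where
    lem : ∀ a b → b + a - b ≡ a
    lem = solve-∀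

  module _ (D : ℕ) (v : ℕ → ℤ) (X : ℕ → ℕ)
           (below : ∀ i t → i ℕ.+ t ≡ D → ∣ v i ∣ ≡ X t)
           (above : ∀ t → ∣ v (D ℕ.+ t) ∣ ≡ X t) where

    private
      C = binom D D

    binom-below : ∀ i t → i ℕ.+ t ≡ D → binom i (t ℕ.+ D) ℕ.≤ C
    binom-below i t refl = subst (ℕ._≤ C)
      (trans (binom-comm (t ℕ.+ (t ℕ.+ i)) i) (cong (λ z → binom i (t ℕ.+ z)) (ℕₚ.+-comm t i)))
      (subst (λ z → binom (t ℕ.+ (t ℕ.+ i)) i ℕ.≤ binom z z) (ℕₚ.+-comm t i) (binom-central t i))

    -- Removes the `t` terms below the centre one at a time; the coefficient of each is at most the
    -- central one, `C`. `alternating-after` does the same above the centre.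
    alternating-before : ∀ t i → i ℕ.+ t ≡ D →
      ∣ alternating D D v ∣ ℕ.≤ ∣ alternating i (t ℕ.+ D) v ∣ ℕ.+ C ℕ.* sum₁ X t
    alternating-before zero i e =
      ℕₚ.≤-trans (ℕₚ.≤-reflexive (cong (λ z → ∣ alternating z D v ∣) (trans (sym e) (ℕₚ.+-identityʳ i))))
                 (ℕₚ.m≤m+n _ _)
    alternating-before (suc t) i e = begin
      ∣ alternating D D v ∣
        ≤⟨ alternating-before t (suc i) (trans (sym (ℕₚ.+-suc i t)) e) ⟩
      ∣ a ∣ ℕ.+ C ℕ.* sum₁ X t
        ≤⟨ ℕₚ.+-monoˡ-≤ _ (∣a∣≤∣b+a∣+∣b∣ a b) ⟩
      ∣ b + a ∣ ℕ.+ ∣ b ∣ ℕ.+ C ℕ.* sum₁ X t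
        ≤⟨ ℕₚ.+-monoˡ-≤ _ (ℕₚ.+-monoʳ-≤ ∣ b + a ∣ ∣b∣≤) ⟩
      ∣ b + a ∣ ℕ.+ C ℕ.* X (suc t) ℕ.+ C ℕ.* sum₁ X t
        ≡⟨ lem ∣ b + a ∣ C (X (suc t)) (sum₁ X t) ⟩
      ∣ b + a ∣ ℕ.+ C ℕ.* sum₁ X (suc t) ∎
      where
      open ℕₚ.≤-Reasoning
      a = alternating (suc i) (t ℕ.+ D) v
      b = parity (suc (t ℕ.+ D)) * + binom i (suc (t ℕ.+ D)) * v i
      ∣b∣≤ : ∣ b ∣ ℕ.≤ C ℕ.* X (suc t)
      ∣b∣≤ = begin
        ∣ b ∣                                   ≡⟨ ∣term∣ (suc (t ℕ.+ D)) (binom i (suc (t ℕ.+ D))) (v i) ⟩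
        binom i (suc (t ℕ.+ D)) ℕ.* ∣ v i ∣     ≤⟨ ℕₚ.*-mono-≤ (binom-below i (suc t) e) (ℕₚ.≤-reflexive (below i (suc t) e)) ⟩
        C ℕ.* X (suc t)                         ∎
      lem : ∀ a c x s → a ℕ.+ c ℕ.* x ℕ.+ c ℕ.* s ≡ a ℕ.+ c ℕ.* (s ℕ.+ x)
      lem = ℕ-Ring.solve-∀

    binom-above : ∀ s j → s ℕ.+ j ≡ D → binom (D ℕ.+ s) j ℕ.≤ C
    binom-above s j refl = subst (ℕ._≤ C) (cong (λ z → binom z j) (ℕₚ.+-comm s (s ℕ.+ j))) (binom-central s j)

    alternating-after : ∀ j s → s ℕ.+ suc j ≡ D →
      ∣ alternating (suc (D ℕ.+ s)) j v ∣ ℕ.+ C ℕ.* sum₁ X s ℕ.≤ C ℕ.* sum₁ X D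
    alternating-after zero s e = begin
      ∣ + binom (suc (D ℕ.+ s)) 0 * v (suc (D ℕ.+ s)) ∣ ℕ.+ C ℕ.* sum₁ X s
        ≡⟨ cong (λ z → ∣ z ∣ ℕ.+ C ℕ.* sum₁ X s) (*-identityˡ (v (suc (D ℕ.+ s)))) ⟩
      ∣ v (suc (D ℕ.+ s)) ∣ ℕ.+ C ℕ.* sum₁ X s
        ≡⟨ cong (λ z → ∣ v z ∣ ℕ.+ C ℕ.* sum₁ X s) (ℕₚ.+-suc D s) ⟨
      ∣ v (D ℕ.+ suc s) ∣ ℕ.+ C ℕ.* sum₁ X s
        ≡⟨ cong (ℕ._+ C ℕ.* sum₁ X s) (above (suc s)) ⟩
      X (suc s) ℕ.+ C ℕ.* sum₁ X s
        ≤⟨ ℕₚ.+-monoˡ-≤ _ (ℕₚ.m≤n*m (X (suc s)) C ⦃ ℕ.>-nonZero (binom-pos D D) ⦄) ⟩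
      C ℕ.* X (suc s) ℕ.+ C ℕ.* sum₁ X s
        ≡⟨ lem C (X (suc s)) (sum₁ X s) ⟩
      C ℕ.* sum₁ X (suc s)
        ≡⟨ cong (λ z → C ℕ.* sum₁ X z) (trans (ℕₚ.+-comm 1 s) e) ⟩
      C ℕ.* sum₁ X D ∎
      where
      open ℕₚ.≤-Reasoning
      lem : ∀ c x s → c ℕ.* x ℕ.+ c ℕ.* s ≡ c ℕ.* (s ℕ.+ x)
      lem = ℕ-Ring.solve-∀
    alternating-after (suc j) s e = begin
      ∣ b + a ∣ ℕ.+ C ℕ.* sum₁ X s
        ≤⟨ ℕₚ.+-monoˡ-≤ _ (∣i+j∣≤∣i∣+∣j∣ b a) ⟩
      ∣ b ∣ ℕ.+ ∣ a ∣ ℕ.+ C ℕ.* sum₁ X s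
        ≤⟨ ℕₚ.+-monoˡ-≤ _ (ℕₚ.+-monoˡ-≤ ∣ a ∣ ∣b∣≤) ⟩
      C ℕ.* X (suc s) ℕ.+ ∣ a ∣ ℕ.+ C ℕ.* sum₁ X s
        ≡⟨ lem C (X (suc s)) ∣ a ∣ (sum₁ X s) ⟩
      ∣ a ∣ ℕ.+ C ℕ.* sum₁ X (suc s)
        ≡⟨ cong (λ z → ∣ alternating (suc z) j v ∣ ℕ.+ C ℕ.* sum₁ X (suc s)) (ℕₚ.+-suc D s) ⟨
      ∣ alternating (suc (D ℕ.+ suc s)) j v ∣ ℕ.+ C ℕ.* sum₁ X (suc s)
        ≤⟨ alternating-after j (suc s) (trans (sym (ℕₚ.+-suc s (suc j))) e) ⟩
      C ℕ.* sum₁ X D ∎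
      where
      open ℕₚ.≤-Reasoning
      i = suc (D ℕ.+ s)
      a = alternating (suc i) j v
      b = parity (suc j) * + binom i (suc j) * v i
      ∣b∣≤ : ∣ b ∣ ℕ.≤ C ℕ.* X (suc s)
      ∣b∣≤ = begin
        ∣ b ∣                         ≡⟨ ∣term∣ (suc j) (binom i (suc j)) (v i) ⟩
        binom i (suc j) ℕ.* ∣ v i ∣   ≡⟨ cong (λ z → binom z (suc j) ℕ.* ∣ v z ∣) (ℕₚ.+-suc D s) ⟨
        binom (D ℕ.+ suc s) (suc j) ℕ.* ∣ v (D ℕ.+ suc s) ∣
          ≤⟨ ℕₚ.*-mono-≤ (binom-above (suc s) (suc j) (trans (sym (ℕₚ.+-suc s (suc j))) e))
                         (ℕₚ.≤-reflexive (above (suc s))) ⟩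
        C ℕ.* X (suc s)               ∎
      lem : ∀ c x a s → c ℕ.* x ℕ.+ a ℕ.+ c ℕ.* s ≡ a ℕ.+ c ℕ.* (s ℕ.+ x)
      lem = ℕ-Ring.solve-∀

    -- Isolate the central term, whose coefficient is the largest one.
    central-bound : alternating 0 (D ℕ.+ D) v ≡ 0ℤ → 1 ℕ.≤ D → X 0 ℕ.≤ sum₁ X D ℕ.+ sum₁ X D
    central-bound a≡0 (s≤s {n = D′} _) =
      ℕₚ.*-cancelˡ-≤ C ⦃ ℕ.>-nonZero (binom-pos D D) ⦄ (begin
        C ℕ.* X 0                                 ≡⟨ cong (C ℕ.*_) v≡X0 ⟨
        C ℕ.* ∣ v D ∣                             ≡⟨ ∣term∣ D C (v D) ⟨
        ∣ b ∣                                     ≤⟨ ∣a∣≤∣b+a∣+∣b∣ b a ⟩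
        ∣ a + b ∣ ℕ.+ ∣ a ∣                       ≡⟨ cong (λ z → ∣ z ∣ ℕ.+ ∣ a ∣) (+-comm a b) ⟩
        ∣ alternating D D v ∣ ℕ.+ ∣ a ∣           ≤⟨ ℕₚ.+-mono-≤ (alternating-before D 0 refl) a≤ ⟩
        ∣ alternating 0 (D ℕ.+ D) v ∣ ℕ.+ C ℕ.* sum₁ X D ℕ.+ C ℕ.* sum₁ X D
          ≡⟨ cong (λ z → ∣ z ∣ ℕ.+ C ℕ.* sum₁ X D ℕ.+ C ℕ.* sum₁ X D) a≡0 ⟩
        C ℕ.* sum₁ X D ℕ.+ C ℕ.* sum₁ X D         ≡⟨ ℕₚ.*-distribˡ-+ C (sum₁ X D) (sum₁ X D) ⟨
        C ℕ.* (sum₁ X D ℕ.+ sum₁ X D)             ∎)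
      where
      open ℕₚ.≤-Reasoning
      b = parity D * + C * v D
      a = alternating (suc D) D′ v
      v≡X0 : ∣ v D ∣ ≡ X 0
      v≡X0 = below D 0 (ℕₚ.+-identityʳ D)
      a≤ : ∣ a ∣ ℕ.≤ C ℕ.* sum₁ X D
      a≤ = begin
        ∣ a ∣                                     ≡⟨ cong (λ z → ∣ alternating (suc z) D′ v ∣) (ℕₚ.+-identityʳ D) ⟨
        ∣ alternating (suc (D ℕ.+ 0)) D′ v ∣      ≤⟨ ℕₚ.m≤m+n _ _ ⟩
        _                                         ≤⟨ alternating-after D′ 0 refl ⟩
        C ℕ.* sum₁ X D                            ∎

  -- ∑ 2 / (4 t² - 1) over t = 1, …, D telescopes to 2 D / (2 D + 1).
  telescope : ∀ X M D → (∀ t → suc t ℕ.≤ D → (1 ℕ.+ 2 ℕ.* t) ℕ.* (3 ℕ.+ 2 ℕ.* t) ℕ.* X (suc t) ℕ.≤ M) →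
              (1 ℕ.+ 2 ℕ.* D) ℕ.* (2 ℕ.* sum₁ X D) ℕ.≤ 2 ℕ.* D ℕ.* M
  telescope X M zero    h = z≤n
  telescope X M (suc t) h = ℕₚ.*-cancelˡ-≤ (1 ℕ.+ 2 ℕ.* t) (begin
    (1 ℕ.+ 2 ℕ.* t) ℕ.* ((1 ℕ.+ 2 ℕ.* suc t) ℕ.* (2 ℕ.* (s ℕ.+ x)))
      ≡⟨ lem t s x ⟩
    (3 ℕ.+ 2 ℕ.* t) ℕ.* ((1 ℕ.+ 2 ℕ.* t) ℕ.* (2 ℕ.* s)) ℕ.+ 2 ℕ.* ((1 ℕ.+ 2 ℕ.* t) ℕ.* (3 ℕ.+ 2 ℕ.* t) ℕ.* x)
      ≤⟨ ℕₚ.+-mono-≤ (ℕₚ.*-monoʳ-≤ (3 ℕ.+ 2 ℕ.* t) (telescope X M t (λ t′ l → h t′ (ℕₚ.m≤n⇒m≤1+n l))))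
                     (ℕₚ.*-monoʳ-≤ 2 (h t ℕₚ.≤-refl)) ⟩
    (3 ℕ.+ 2 ℕ.* t) ℕ.* (2 ℕ.* t ℕ.* M) ℕ.+ 2 ℕ.* M
      ≡⟨ lem′ t M ⟩
    (1 ℕ.+ 2 ℕ.* t) ℕ.* (2 ℕ.* suc t ℕ.* M) ∎)
    where
    open ℕₚ.≤-Reasoning
    s = sum₁ X t
    x = X (suc t)
    lem : ∀ t s x → (1 ℕ.+ 2 ℕ.* t) ℕ.* ((1 ℕ.+ 2 ℕ.* (1 ℕ.+ t)) ℕ.* (2 ℕ.* (s ℕ.+ x)))
        ≡ (3 ℕ.+ 2 ℕ.* t) ℕ.* ((1 ℕ.+ 2 ℕ.* t) ℕ.* (2 ℕ.* s)) ℕ.+ 2 ℕ.* ((1 ℕ.+ 2 ℕ.* t) ℕ.* (3 ℕ.+ 2 ℕ.* t) ℕ.* x)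
    lem = ℕ-Ring.solve-∀
    lem′ : ∀ t M → (3 ℕ.+ 2 ℕ.* t) ℕ.* (2 ℕ.* t ℕ.* M) ℕ.+ 2 ℕ.* M ≡ (1 ℕ.+ 2 ℕ.* t) ℕ.* (2 ℕ.* (1 ℕ.+ t) ℕ.* M)
    lem′ = ℕ-Ring.solve-∀

  -- For a polynomial u of degree ≤ D, the quotient q x = (u x - u 1) / (x - 1) is a polynomial
  -- of degree < D, so the 2 D-th difference of z ↦ q (4 z²) vanishes.
  no-steep : ∀ D {u} → 1 ℕ.≤ D → Poly< (suc D) u → Steep (4 ℕ.* (D ℕ.* D)) u → ⊥
  no-steep (suc D) {u} 1≤D (v , (v′ , p , e′) , e) (m , u0 , u1 , B) =
    ℕₚ.<⇒≱ strict (ℕₚ.≤-trans (ℕₚ.*-monoʳ-≤ (1 ℕ.+ 2 ℕ.* suc D) X0≤) (telescope X (suc m) (suc D) X-bound))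
    where
    ext = Poly<-at-nodes (suc D) D p
    V   = proj₁ ext
    -- Two Horner steps give `u x - u 1 = (x - 1) * (v 0 + x * v′ (x - 2))`, so the quotient has
    -- integer values, and its value at 0 is `u 1 - u 0`.
    q : ℤ → ℤ
    q y = v 0 + y * V (y - + 2)
    -- Squaring puts the argument 0 of `q` in the middle of a symmetric range. The factor 4 keeps
    -- the other nodes away from 1 and makes the sum of 2 / (4 t² - 1) stay below 1.
    f : ℤ → ℤ
    f z = q (+ 4 * (z * z))
    X : ℕ → ℕ
    X t = ∣ f (+ t) ∣
    w : ℕ → ℤ
    w i = f (+ i - + suc D)

    lem : ∀ a z x → a + + 4 * (z * (z * x)) ≡ a + + 4 * (z * z) * x
    lem = solve-∀
    q-diff : Diff< (suc D ℕ.+ suc D) w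
    q-diff = subst (λ k → Diff< (suc k) w) (sym (ℕₚ.+-suc D D))
      (Diff<-ext (λ i → lem (v 0) (+ i - + suc D) (V (node (suc D) i - + 2)))
        (Diff<-+ (Diff<-const (1 ℕ.+ (D ℕ.+ D)) (v 0))
          (Diff<-scale (+ 4) (Diff<-linear (+ suc D) (Diff<-linear (+ suc D) (proj₂ (proj₂ ext) (+ 2)))))))

    f-even : ∀ z → f (- z) ≡ f z
    f-even z = cong (λ y → q (+ 4 * y)) (lem₂ z)
      where
      lem₂ : ∀ z → - z * - z ≡ z * z
      lem₂ = solve-∀
    below : ∀ i t → i ℕ.+ t ≡ suc D → ∣ w i ∣ ≡ X t
    below i t e₁ = cong ∣_∣ (trans (cong f (trans (cong (λ z → + i - + z) (sym e₁)) (lem₂ (+ i) (+ t)))) (f-even (+ t)))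
      where
      lem₂ : ∀ a b → a - (a + b) ≡ - b
      lem₂ = solve-∀
    above : ∀ t → ∣ w (suc D ℕ.+ t) ∣ ≡ X t
    above t = cong (λ z → ∣ f z ∣) (lem₂ (+ suc D) (+ t))
      where
      lem₂ : ∀ a b → a + b - a ≡ b
      lem₂ = solve-∀
    X0≤2sum : X 0 ℕ.≤ sum₁ X (suc D) ℕ.+ sum₁ X (suc D)
    X0≤2sum = central-bound (suc D) w X below above (alternating-vanishes q-diff) 1≤D

    v0≡ : v 0 ≡ + suc m
    v0≡ = trans (sym (trans (cong₂ _+_ u0 (*-identityˡ (v 0))) (+-identityˡ (v 0)))) (trans (sym (e 0)) u1)
    X0≡ : X 0 ≡ suc m
    X0≡ = cong ∣_∣ (trans (cong (λ z → v 0 + z) (*-zeroˡ (V (0ℤ - + 2)))) (trans (+-identityʳ (v 0)) v0≡))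
    X0≤ : suc m ℕ.≤ 2 ℕ.* sum₁ X (suc D)
    X0≤ = subst₂ ℕ._≤_ X0≡ (cong (sum₁ X (suc D) ℕ.+_) (sym (ℕₚ.+-identityʳ _))) X0≤2sum

    quotient : ∀ n → u (suc (suc n)) - u 1 ≡ + suc n * q (+ suc (suc n))
    quotient n = begin
      u (suc (suc n)) - u 1
        ≡⟨ cong₂ _-_ (trans (e (suc n)) (cong (λ z → u 0 + + suc (suc n) * z) (e′ n))) (e 0) ⟩
      u 0 + + suc (suc n) * (v 0 + + suc n * v′ n) - (u 0 + 1ℤ * v 0)
        ≡⟨ lem₂ (+ suc n) (u 0) (v 0) (v′ n) ⟩
      + suc n * (v 0 + + suc (suc n) * v′ n)
        ≡⟨ cong (λ z → + suc n * (v 0 + + suc (suc n) * z)) (proj₁ (proj₂ ext) n) ⟨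
      + suc n * q (+ suc (suc n)) ∎
      where
      open ≡-Reasoning
      lem₂ : ∀ n a b x → a + (1ℤ + n) * (b + n * x) - (a + 1ℤ * b) ≡ n * (b + (1ℤ + n) * x)
      lem₂ = solve-∀

    difference-bound : ∀ n → suc (suc n) ℕ.≤ 4 ℕ.* (suc D ℕ.* suc D) → ∣ u (suc (suc n)) - u 1 ∣ ℕ.≤ suc m
    difference-bound n l with u (suc (suc n)) | B (suc (suc n)) l
    ... | + x | _ , +≤+ x≤ = begin
      ∣ + x - u 1 ∣        ≡⟨ cong (λ z → ∣ + x - z ∣) u1 ⟩
      ∣ + x - + suc m ∣    ≡⟨ ∣i-j∣≡∣j-i∣ (+ x) (+ suc m) ⟩
      ∣ + suc m - + x ∣    ≡⟨ cong ∣_∣ (trans (m-n≡m⊖n (suc m) x) (⊖-≥ x≤)) ⟩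
      suc m ℕ.∸ x          ≤⟨ ℕₚ.m∸n≤m (suc m) x ⟩
      suc m                ∎
      where open ℕₚ.≤-Reasoning

    -- At the node 4 (t + 1)² the denominator x - 1 factors as (2 t + 1) (2 t + 3), the form that
    -- `telescope` sums.
    X-bound : ∀ t → suc t ℕ.≤ suc D → (1 ℕ.+ 2 ℕ.* t) ℕ.* (3 ℕ.+ 2 ℕ.* t) ℕ.* X (suc t) ℕ.≤ suc m
    X-bound t l = begin
      (1 ℕ.+ 2 ℕ.* t) ℕ.* (3 ℕ.+ 2 ℕ.* t) ℕ.* X (suc t)   ≡⟨ cong (ℕ._* X (suc t)) (n≡ t) ⟩
      suc n ℕ.* X (suc t)                                 ≡⟨ cong (λ z → suc n ℕ.* ∣ q z ∣) (trans (sym (pos-* 4 (suc t ℕ.* suc t))) (cong +_ (sq≡ t))) ⟩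
      suc n ℕ.* ∣ q (+ suc (suc n)) ∣                     ≡⟨ abs-* (+ suc n) (q (+ suc (suc n))) ⟨
      ∣ + suc n * q (+ suc (suc n)) ∣                     ≡⟨ cong ∣_∣ (quotient n) ⟨
      ∣ u (suc (suc n)) - u 1 ∣                           ≤⟨ difference-bound n in-range ⟩
      suc m                                               ∎
      where
      open ℕₚ.≤-Reasoning
      n = 2 ℕ.+ 8 ℕ.* t ℕ.+ 4 ℕ.* (t ℕ.* t)
      n≡ : ∀ t → (1 ℕ.+ 2 ℕ.* t) ℕ.* (3 ℕ.+ 2 ℕ.* t) ≡ 3 ℕ.+ 8 ℕ.* t ℕ.+ 4 ℕ.* (t ℕ.* t)
      n≡ = ℕ-Ring.solve-∀
      sq≡ : ∀ t → 4 ℕ.* ((1 ℕ.+ t) ℕ.* (1 ℕ.+ t)) ≡ 4 ℕ.+ 8 ℕ.* t ℕ.+ 4 ℕ.* (t ℕ.* t)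
      sq≡ = ℕ-Ring.solve-∀
      in-range : suc (suc n) ℕ.≤ 4 ℕ.* (suc D ℕ.* suc D)
      in-range = subst (ℕ._≤ 4 ℕ.* (suc D ℕ.* suc D)) (sq≡ t) (ℕₚ.*-monoʳ-≤ 4 (ℕₚ.*-mono-≤ l l))

    strict : 2 ℕ.* suc D ℕ.* suc m ℕ.< (1 ℕ.+ 2 ℕ.* suc D) ℕ.* suc m
    strict = s≤s (ℕₚ.m≤n+m _ m)


-- Multilinear degree, substitution of literals, top coefficients

module MultilinearDegree where

  open import Defs using (Vertex)
  open import Data.Bool using (Bool; true; false; _xor_; if_then_else_)
  open import Data.Nat as ℕ using (ℕ; zero; suc; s≤s)
  import Data.Nat.Properties as ℕₚ
  open import Data.Integer hiding (suc)
  open import Data.Integer.Properties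
  open import Data.Integer.Tactic.RingSolver using (solve-∀)
  open import Data.Fin using (Fin; zero; suc)
  open import Data.Vec using ([]; _∷_; Vec; lookup; _[_]≔_)
  open import Data.Product using (Σ; _×_; _,_)
  open import Data.Sum using (_⊎_; inj₁; inj₂)
  open import Relation.Binary.PropositionalEquality
  open import Relation.Nullary using (Dec; yes; no; ¬_)
  open import Relation.Nullary.Decidable using (_×-dec_; map′)

  Fn : ℕ → Set
  Fn n = Vertex n → ℤ

  all? : ∀ {n} {P : Vertex n → Set} → (∀ x → Dec (P x)) → Dec (∀ x → P x)
  all? {zero}  P? = map′ (λ { p [] → p }) (λ p → p []) (P? [])
  all? {suc n} P? = map′ (λ { (p , q) (false ∷ x) → p x ; (p , q) (true ∷ x) → q x })
                         (λ p → (λ x → p (false ∷ x)) , (λ x → p (true ∷ x)))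
                         (all? (λ x → P? (false ∷ x)) ×-dec all? (λ x → P? (true ∷ x)))

  ¬∀⇒∃¬ : ∀ {n} {P : Vertex n → Set} → (∀ x → Dec (P x)) → ¬ (∀ x → P x) → Σ (Vertex n) λ x → ¬ P x
  ¬∀⇒∃¬ {zero} P? ¬p = [] , λ p → ¬p λ { [] → p }
  ¬∀⇒∃¬ {suc n} P? ¬p with all? (λ x → P? (false ∷ x))
  ... | no ¬q = let x , r = ¬∀⇒∃¬ (λ x → P? (false ∷ x)) ¬q in false ∷ x , r
  ... | yes q = let x , r = ¬∀⇒∃¬ (λ x → P? (true ∷ x)) (λ q′ → ¬p λ { (false ∷ x) → q x ; (true ∷ x) → q′ x })
                in true ∷ x , r

  ∂ : ∀ {n} → Fn (suc n) → Fn n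
  ∂ f x = f (true ∷ x) - f (false ∷ x)

  -- Functions whose multilinear polynomial in 0/1-valued variables has degree < d.
  data Deg< : ℕ → ∀ {n} → Fn n → Set where
    null  : ∀ {n} {f : Fn n} → (∀ x → f x ≡ 0ℤ) → Deg< 0 f
    point : ∀ {d} {f : Fn 0} → Deg< (suc d) f
    split : ∀ {d n} {f : Fn (suc n)} → Deg< (suc d) (λ x → f (false ∷ x)) → Deg< d (∂ f) → Deg< (suc d) f

  Deg<-ext : ∀ {d n} {f g : Fn n} → (∀ x → f x ≡ g x) → Deg< d f → Deg< d g
  Deg<-ext e (null p)    = null λ x → trans (sym (e x)) (p x)
  Deg<-ext e point       = point
  Deg<-ext e (split a b) = split (Deg<-ext (λ x → e (false ∷ x)) a)
                                 (Deg<-ext (λ x → cong₂ _-_ (e (true ∷ x)) (e (false ∷ x))) b)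

  Deg<-+ : ∀ {d n} {f g : Fn n} → Deg< d f → Deg< d g → Deg< d (λ x → f x + g x)
  Deg<-+ (null p) (null q) = null λ x → cong₂ _+_ (p x) (q x)
  Deg<-+ point _ = point
  Deg<-+ {f = f} {g} (split a b) (split a′ b′) = split (Deg<-+ a a′)
    (Deg<-ext (λ x → lem (f (true ∷ x)) (f (false ∷ x)) (g (true ∷ x)) (g (false ∷ x))) (Deg<-+ b b′))
    where
    lem : ∀ a b c d → (a - b) + (c - d) ≡ (a + c) - (b + d)
    lem = solve-∀

  Deg<-scale : ∀ {d n} c {f : Fn n} → Deg< d f → Deg< d (λ x → c * f x)
  Deg<-scale c (null p) = null λ x → trans (cong (c *_) (p x)) (*-zeroʳ c)
  Deg<-scale c point = point
  Deg<-scale c {f} (split a b) = split (Deg<-scale c a)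
    (Deg<-ext (λ x → lem c (f (true ∷ x)) (f (false ∷ x))) (Deg<-scale c b))
    where
    lem : ∀ c a b → c * (a - b) ≡ c * a - c * b
    lem = solve-∀

  Deg<-cancel : ∀ {d n} c .⦃ _ : NonZero c ⦄ {f : Fn n} → Deg< d (λ x → c * f x) → Deg< d f
  Deg<-cancel c {f} (null p) = null λ x → *-cancelˡ-≡ c (f x) 0ℤ (trans (p x) (sym (*-zeroʳ c)))
  Deg<-cancel c point = point
  Deg<-cancel c {f} (split a b) = split (Deg<-cancel c a)
    (Deg<-cancel c (Deg<-ext (λ x → lem c (f (true ∷ x)) (f (false ∷ x))) b))
    where
    lem : ∀ c a b → c * a - c * b ≡ c * (a - b)
    lem = solve-∀

  Deg<-zero : ∀ d {n} {f : Fn n} → (∀ x → f x ≡ 0ℤ) → Deg< d f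
  Deg<-zero zero            p = null p
  Deg<-zero (suc d) {zero}  p = point
  Deg<-zero (suc d) {suc n} p =
    split (Deg<-zero (suc d) (λ x → p (false ∷ x))) (Deg<-zero d (λ x → cong₂ _-_ (p (true ∷ x)) (p (false ∷ x))))

  Deg<-const : ∀ d {n} c → Deg< (suc d) {n} (λ _ → c)
  Deg<-const d {zero}  c = point
  Deg<-const d {suc n} c = split (Deg<-const d c) (Deg<-zero d (λ _ → +-inverseʳ c))

  Deg<-suc : ∀ {d n} {f : Fn n} → Deg< d f → Deg< (suc d) f
  Deg<-suc (null p)    = Deg<-zero 1 p
  Deg<-suc point       = point
  Deg<-suc (split a b) = split (Deg<-suc a) (Deg<-suc b)

  Deg<-true : ∀ {d n} {f : Fn (suc n)} → Deg< d f → Deg< d (λ x → f (true ∷ x))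
  Deg<-true (null p) = null λ x → p (true ∷ x)
  Deg<-true {f = f} (split a b) =
    Deg<-ext (λ x → lem (f (false ∷ x)) (f (true ∷ x))) (Deg<-+ a (Deg<-suc b))
    where
    lem : ∀ a b → a + (b - a) ≡ b
    lem = solve-∀

  Deg<-false : ∀ {d n} {f : Fn (suc n)} → Deg< d f → Deg< d (λ x → f (false ∷ x))
  Deg<-false (null p)    = null λ x → p (false ∷ x)
  Deg<-false (split a b) = a

  Deg<-full : ∀ n {f : Fn n} → Deg< (suc n) f
  Deg<-full zero    = point
  Deg<-full (suc n) = split (Deg<-suc (Deg<-full n)) (Deg<-full n)

  deg<? : ∀ d {n} (f : Fn n) → Dec (Deg< d f)
  deg<? zero            f = map′ null (λ { (null p) → p }) (all? (λ x → f x ≟ 0ℤ))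
  deg<? (suc d) {zero}  f = yes point
  deg<? (suc d) {suc n} f = map′ (λ (a , b) → split a b) (λ { (split a b) → a , b })
                                 (deg<? (suc d) (λ x → f (false ∷ x)) ×-dec deg<? d (∂ f))

  val : Bool → ℤ
  val b = if b then 1ℤ else 0ℤ

  -- The exponent of the variable does not grow, since `t * t = t` on 0/1 values: multiplied by its
  -- first variable, `g` vanishes on the false half and has the true half of `g` as derivative.
  Deg<-var* : ∀ {d n} (j : Fin n) {g : Fn n} → Deg< d g → Deg< (suc d) (λ t → val (lookup t j) * g t)
  Deg<-var* j {g} (null p) =
    Deg<-zero 1 (λ t → trans (cong (val (lookup t j) *_) (p t)) (*-zeroʳ (val (lookup t j))))
  Deg<-var* zero {g} (split a b) =
    split (Deg<-zero _ (λ x → *-zeroˡ (g (false ∷ x))))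
          (Deg<-ext (λ x → lem (g (true ∷ x)) (g (false ∷ x))) (Deg<-true {f = g} (split a b)))
    where
    lem : ∀ a b → a ≡ 1ℤ * a - 0ℤ * b
    lem = solve-∀
  Deg<-var* (suc j) {g} (split a b) =
    split (Deg<-var* j a)
          (Deg<-ext (λ x → lem (val (lookup x j)) (g (true ∷ x)) (g (false ∷ x))) (Deg<-var* j b))
    where
    lem : ∀ c a b → c * (a - b) ≡ c * a - c * b
    lem = solve-∀

  data Literal (r : ℕ) : Set where
    const : Bool → Literal r
    var   : Fin r → Bool → Literal r

  evalLit : ∀ {r} → Vertex r → Literal r → Bool
  evalLit t (const b) = b
  evalLit t (var j s) = lookup t j xor s

  eval : ∀ {r n} → Vec (Literal r) n → Vertex r → Vertex n
  eval []       t = []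
  eval (ℓ ∷ ℓs) t = evalLit t ℓ ∷ eval ℓs t

  -- A literal `c xor s` is `s` plus or minus `c`. Expanding `f` around its half `s`, the derivative
  -- has lost one degree and the factor `c` restores at most that one.
  Deg<-eval : ∀ {d r n} (ℓs : Vec (Literal r) n) {f : Fn n} → Deg< d f → Deg< d (λ t → f (eval ℓs t))
  Deg<-eval ℓs (null p) = null λ t → p (eval ℓs t)
  Deg<-eval [] {f} (point {d}) = Deg<-const d (f [])
  Deg<-eval (const false ∷ ℓs) (split a b) = Deg<-eval ℓs a
  Deg<-eval (const true ∷ ℓs) {f} (split a b) = Deg<-eval ℓs (Deg<-true {f = f} (split a b))
  Deg<-eval (var j s ∷ ℓs) {f} (split a b) =
    Deg<-ext (λ t → lem (lookup t j) s (eval ℓs t))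
      (Deg<-+ (Deg<-eval ℓs (anchor s)) (Deg<-scale (direction s) (Deg<-var* j (Deg<-eval ℓs b))))
    where
    direction : Bool → ℤ
    direction false = 1ℤ
    direction true  = - 1ℤ
    anchor : ∀ s → Deg< _ (λ x → f (s ∷ x))
    anchor false = a
    anchor true  = Deg<-true {f = f} (split a b)
    lem₀ : ∀ x y → y + 1ℤ * (0ℤ * (x - y)) ≡ y
    lem₀ = solve-∀
    lem₁ : ∀ x y → y + 1ℤ * (1ℤ * (x - y)) ≡ x
    lem₁ = solve-∀
    lem₂ : ∀ x y → x + - 1ℤ * (0ℤ * (x - y)) ≡ x
    lem₂ = solve-∀
    lem₃ : ∀ x y → x + - 1ℤ * (1ℤ * (x - y)) ≡ y
    lem₃ = solve-∀
    lem : ∀ c s x → f (s ∷ x) + direction s * (val c * ∂ f x) ≡ f ((c xor s) ∷ x)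
    lem false false x = lem₀ (f (true ∷ x)) (f (false ∷ x))
    lem true  false x = lem₁ (f (true ∷ x)) (f (false ∷ x))
    lem false true  x = lem₂ (f (true ∷ x)) (f (false ∷ x))
    lem true  true  x = lem₃ (f (true ∷ x)) (f (false ∷ x))

  -- Unlike `∂`, this derivative stays on the same cube, so that the derivatives in all directions
  -- can be summed and restricted together.
  D : ∀ {n} → Fin n → Fn n → Fn n
  D i f x = f (x [ i ]≔ true) - f (x [ i ]≔ false)

  Deg<-D : ∀ {d n} (i : Fin n) {f : Fn n} → Deg< (suc d) f → Deg< d (D i f)
  Deg<-D zero (split a (null p)) = null λ { (_ ∷ x) → p x }
  Deg<-D {suc d} zero {f} (split a b) = split b (Deg<-zero d (λ x → +-inverseʳ (∂ f x)))
  Deg<-D {zero} (suc i) {f} (split a (null p)) with Deg<-D i a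
  ... | null q = null λ
    { (false ∷ x) → q x
    ; (true ∷ x)  → trans (cong₂ _-_ (constant (x [ i ]≔ true)) (constant (x [ i ]≔ false))) (q x) }
    where
    constant : ∀ x → f (true ∷ x) ≡ f (false ∷ x)
    constant x = i-j≡0⇒i≡j _ _ (p x)
  Deg<-D {suc d} (suc i) {f} (split a b) = split (Deg<-D i a)
    (Deg<-ext (λ x → lem (f (true ∷ (x [ i ]≔ true))) (f (false ∷ (x [ i ]≔ true)))
                         (f (true ∷ (x [ i ]≔ false))) (f (false ∷ (x [ i ]≔ false)))) (Deg<-D i b))
    where
    lem : ∀ a b c d → (a - b) - (c - d) ≡ (a - c) - (b - d)
    lem = solve-∀

  -- Coefficients of the multilinear polynomial; monomials are given by indicator vectors.
  coef : ∀ {n} → Vertex n → Fn n → ℤ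
  coef []          f = f []
  coef (false ∷ S) f = coef S (λ x → f (false ∷ x))
  coef (true ∷ S)  f = coef S (∂ f)

  size : ∀ {n} → Vertex n → ℕ
  size []          = 0
  size (false ∷ S) = size S
  size (true ∷ S)  = suc (size S)

  coef-ext : ∀ {n} (S : Vertex n) {f g : Fn n} → (∀ x → f x ≡ g x) → coef S f ≡ coef S g
  coef-ext []          e = e []
  coef-ext (false ∷ S) e = coef-ext S (λ x → e (false ∷ x))
  coef-ext (true ∷ S)  e = coef-ext S (λ x → cong₂ _-_ (e (true ∷ x)) (e (false ∷ x)))

  coef-zero : ∀ {n} (S : Vertex n) {f : Fn n} → (∀ x → f x ≡ 0ℤ) → coef S f ≡ 0ℤ
  coef-zero []          p = p []
  coef-zero (false ∷ S) p = coef-zero S (λ x → p (false ∷ x))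
  coef-zero (true ∷ S)  p = coef-zero S (λ x → cong₂ _-_ (p (true ∷ x)) (p (false ∷ x)))

  coef-+ : ∀ {n} (S : Vertex n) (f g : Fn n) → coef S (λ x → f x + g x) ≡ coef S f + coef S g
  coef-+ []          f g = refl
  coef-+ (false ∷ S) f g = coef-+ S _ _
  coef-+ (true ∷ S)  f g = trans
    (coef-ext S (λ x → lem (f (true ∷ x)) (f (false ∷ x)) (g (true ∷ x)) (g (false ∷ x))))
    (coef-+ S (∂ f) (∂ g))
    where
    lem : ∀ a b c d → (a + c) - (b + d) ≡ (a - b) + (c - d)
    lem = solve-∀

  coef-vanishes : ∀ {d n} (S : Vertex n) {f : Fn n} → Deg< d f → d ℕ.≤ size S → coef S f ≡ 0ℤ
  coef-vanishes S (null p) _ = coef-zero S p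
  coef-vanishes [] point ()
  coef-vanishes (false ∷ S) (split a b) l       = coef-vanishes S a l
  coef-vanishes (true ∷ S)  (split a b) (s≤s l) = coef-vanishes S b l

  top-monomial : ∀ {d n} {f : Fn n} → Deg< (suc d) f →
                 Deg< d f ⊎ Σ (Vertex n) λ S → size S ≡ d × coef S f ≢ 0ℤ
  top-monomial {zero} {f = f} point with f [] ≟ 0ℤ
  ... | yes e = inj₁ (null λ { [] → e })
  ... | no ¬e = inj₂ ([] , refl , ¬e)
  top-monomial {suc d} point = inj₁ point
  top-monomial {zero} (split a (null p)) with top-monomial a
  ... | inj₁ (null q) = inj₁ (null λ { (false ∷ x) → q x ; (true ∷ x) → trans (i-j≡0⇒i≡j _ _ (p x)) (q x) })
  ... | inj₂ (S , s , c) = inj₂ (false ∷ S , s , c)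
  top-monomial {suc d} (split a b) with top-monomial a | top-monomial b
  ... | inj₁ a′ | inj₁ b′ = inj₁ (split a′ b′)
  ... | inj₂ (S , s , c) | _ = inj₂ (false ∷ S , s , c)
  ... | _ | inj₂ (S , s , c) = inj₂ (true ∷ S , cong suc s , c)

  mux : ∀ {n} → Vertex n → Vertex n → Vertex n → Vertex n
  mux []          _       _       = []
  mux (true ∷ M)  (a ∷ α) (_ ∷ x) = a ∷ mux M α x
  mux (false ∷ M) (_ ∷ α) (b ∷ x) = b ∷ mux M α x

  -- Fixing the variables outside M does not change the coefficient of a monomial M of top degree.
  coef-of-constant : ∀ {n} (M : Vertex n) {f : Fn n} c → Deg< (suc (size M)) f →
    (x : Vertex n) → (∀ β → f (mux M β x) ≡ c) → (1 ℕ.≤ size M ⊎ c ≡ 0ℤ) → coef M f ≡ 0ℤ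
  coef-of-constant [] c _ [] h (inj₂ c≡0) = trans (h []) c≡0
  coef-of-constant (false ∷ M) {f} c (split a b) (false ∷ x) h 1≤ =
    coef-of-constant M c a x (λ β → h (false ∷ β)) 1≤
  -- The true half differs from the false half by `∂ f`, whose degree is too small for the monomial
  -- `M`.
  coef-of-constant (false ∷ M) {f} c (split a b) (true ∷ x) h 1≤ = begin
    coef M (λ y → f (false ∷ y))                          ≡⟨ +-identityʳ _ ⟨
    coef M (λ y → f (false ∷ y)) + 0ℤ                     ≡⟨ cong (λ z → coef M (λ y → f (false ∷ y)) + z) (coef-vanishes M b ℕₚ.≤-refl) ⟨
    coef M (λ y → f (false ∷ y)) + coef M (∂ f)           ≡⟨ coef-+ M _ _ ⟨
    coef M (λ y → f (false ∷ y) + ∂ f y)                  ≡⟨ coef-ext M (λ y → lem (f (false ∷ y)) (f (true ∷ y))) ⟩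
    coef M (λ y → f (true ∷ y))                           ≡⟨ coef-of-constant M c (Deg<-true {f = f} (split a b)) x (λ β → h (true ∷ β)) 1≤ ⟩
    0ℤ                                                    ∎
    where
    open ≡-Reasoning
    lem : ∀ a b → a + (b - a) ≡ b
    lem = solve-∀
  -- One derivative turns the constant into 0, which is why the last hypothesis is a disjunction: it
  -- allows `M` to become empty.
  coef-of-constant (true ∷ M) {f} c (split a b) (_ ∷ x) h _ =
    coef-of-constant M 0ℤ b x (λ β → trans (cong₂ _-_ (h (true ∷ β)) (h (false ∷ β))) (+-inverseʳ c)) (inj₂ refl)

  coef-D : ∀ {n} (M : Vertex n) (i : Fin n) {f : Fn n} → lookup M i ≡ true → coef M f ≡ coef (M [ i ]≔ false) (D i f)
  coef-D (true ∷ M)  zero    e    = refl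
  coef-D (false ∷ M) (suc i) e    = coef-D M i e
  coef-D (true ∷ M)  (suc i) {f} e = trans (coef-D M i e)
    (coef-ext (M [ i ]≔ false) (λ x → lem (f (true ∷ (x [ i ]≔ true))) (f (false ∷ (x [ i ]≔ true)))
                         (f (true ∷ (x [ i ]≔ false))) (f (false ∷ (x [ i ]≔ false)))))
    where
    lem : ∀ a b c d → (a - b) - (c - d) ≡ (a - c) - (b - d)
    lem = solve-∀

  size-remove : ∀ {n} (M : Vertex n) (i : Fin n) → lookup M i ≡ true → size M ≡ suc (size (M [ i ]≔ false))
  size-remove (true ∷ M)  zero    e = refl
  size-remove (false ∷ M) (suc i) e = size-remove M i e
  size-remove (true ∷ M)  (suc i) e = cong suc (size-remove M i e)


-- Automorphisms of the cube are signed permutations; isomorphism is decidable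

module Automorphisms where

  open import Defs
  open MultilinearDegree using (all?)
  open import Data.Bool using (Bool; true; false; not; _xor_; if_then_else_)
  import Data.Bool.Properties as Bₚ
  open import Data.Nat using (ℕ; zero; suc; _+_)
  open import Data.Nat.Properties using (+-comm; +-assoc; suc-injective)
  open import Data.Fin using (Fin; zero; suc; punchIn; _≟_)
  open import Data.Fin.Properties using (any?; punchInᵢ≢i)
  open import Data.Vec using ([]; _∷_; lookup; head; tail; insertAt; removeAt)
  open import Data.Vec.Properties using (insertAt-removeAt; removeAt-insertAt; insertAt-lookup)
  open import Data.Product using (Σ; _×_; _,_; proj₁; proj₂; ∃)
  open import Data.Empty using (⊥-elim)
  open import Data.Unit using (⊤; tt)
  open import Function.Bundles using (_⇔_; mk⇔; module Equivalence)
  open import Relation.Binary.PropositionalEquality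
  open import Relation.Nullary using (Dec; yes; no)
  open import Relation.Nullary.Decidable using (map′; _⊎-dec_)
  open import Data.Sum using (_⊎_; inj₁; inj₂)
  open Equivalence using (to; from)

  origin : ∀ {n} → Vertex n
  origin {zero}  = []
  origin {suc n} = false ∷ origin

  hamming-refl : ∀ {n} (x : Vertex n) → hamming x x ≡ 0
  hamming-refl []          = refl
  hamming-refl (false ∷ x) = hamming-refl x
  hamming-refl (true ∷ x)  = hamming-refl x

  hamming-zero : ∀ {n} (x y : Vertex n) → hamming x y ≡ 0 → x ≡ y
  hamming-zero []          []          e = refl
  hamming-zero (false ∷ x) (false ∷ y) e = cong (false ∷_) (hamming-zero x y e)
  hamming-zero (true ∷ x)  (true ∷ y)  e = cong (true ∷_) (hamming-zero x y e)

  hamming-same : ∀ {n} a (x y : Vertex n) → hamming (a ∷ x) (a ∷ y) ≡ hamming x y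
  hamming-same false x y = refl
  hamming-same true  x y = refl

  adjacent-not : ∀ {n} a (x y : Vertex n) → Adjacent (a ∷ x) (not a ∷ y) → x ≡ y
  adjacent-not false x y e = hamming-zero x y (suc-injective e)
  adjacent-not true  x y e = hamming-zero x y (suc-injective e)

  adjacent-flip : ∀ {n} i (x : Vertex n) → Adjacent x (flipAt i x)
  adjacent-flip zero    (false ∷ x) = cong suc (hamming-refl x)
  adjacent-flip zero    (true ∷ x)  = cong suc (hamming-refl x)
  adjacent-flip (suc i) (a ∷ x)     = trans (hamming-same a x (flipAt i x)) (adjacent-flip i x)

  adjacent⇒flip : ∀ {n} (x y : Vertex n) → Adjacent x y → Σ (Fin n) λ i → y ≡ flipAt i x
  adjacent⇒flip [] [] ()
  adjacent⇒flip (false ∷ x) (true ∷ y) e = zero , cong (true ∷_) (sym (adjacent-not false x y e))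
  adjacent⇒flip (true ∷ x) (false ∷ y) e = zero , cong (false ∷_) (sym (adjacent-not true x y e))
  adjacent⇒flip (false ∷ x) (false ∷ y) e = let i , p = adjacent⇒flip x y e in suc i , cong (false ∷_) p
  adjacent⇒flip (true ∷ x) (true ∷ y) e   = let i , p = adjacent⇒flip x y e in suc i , cong (true ∷_) p

  flip-involutive : ∀ {n} i (x : Vertex n) → flipAt i (flipAt i x) ≡ x
  flip-involutive zero    (a ∷ x) = cong (_∷ x) (Bₚ.not-involutive a)
  flip-involutive (suc i) (a ∷ x) = cong (a ∷_) (flip-involutive i x)

  flip-comm : ∀ {n} i j (x : Vertex n) → flipAt i (flipAt j x) ≡ flipAt j (flipAt i x)
  flip-comm zero    zero    (a ∷ x) = refl
  flip-comm zero    (suc j) (a ∷ x) = refl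
  flip-comm (suc i) zero    (a ∷ x) = refl
  flip-comm (suc i) (suc j) (a ∷ x) = cong (a ∷_) (flip-comm i j x)

  flip-injective : ∀ {n} i j (x : Vertex n) → flipAt i x ≡ flipAt j x → i ≡ j
  flip-injective zero    zero    (a ∷ x)     e = refl
  flip-injective zero    (suc j) (false ∷ x) ()
  flip-injective zero    (suc j) (true ∷ x)  ()
  flip-injective (suc i) zero    (false ∷ x) ()
  flip-injective (suc i) zero    (true ∷ x)  ()
  flip-injective (suc i) (suc j) (a ∷ x)     e = cong suc (flip-injective i j x (cong tail e))

  connected : ∀ {n} (P : Vertex n → Set) → P origin → (∀ x j → P x → P (flipAt j x)) → ∀ x → P x
  connected P o step []          = o
  connected P o step (false ∷ x) = connected (λ y → P (false ∷ y)) o (λ y j → step (false ∷ y) (suc j)) x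
  connected P o step (true ∷ x)  =
    step (false ∷ x) zero (connected (λ y → P (false ∷ y)) o (λ y j → step (false ∷ y) (suc j)) x)

  flip-insertAt : ∀ {n} (y : Vertex n) i a → flipAt i (insertAt y i a) ≡ insertAt y i (not a)
  flip-insertAt y       zero    a = refl
  flip-insertAt (b ∷ y) (suc i) a = cong (b ∷_) (flip-insertAt y i a)

  insertAt-flip : ∀ {n} (y : Vertex n) i j a → insertAt (flipAt j y) i a ≡ flipAt (punchIn i j) (insertAt y i a)
  insertAt-flip y       zero    j       a = refl
  insertAt-flip (b ∷ y) (suc i) zero    a = refl
  insertAt-flip (b ∷ y) (suc i) (suc j) a = cong (b ∷_) (insertAt-flip y i j a)

  automorphism : ∀ {n} (φ ψ : Vertex n → Vertex n) → (∀ x → ψ (φ x) ≡ x) → (∀ y → φ (ψ y) ≡ y) →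
                 (∀ x y → hamming (φ x) (φ y) ≡ hamming x y) → IsAutomorphism φ
  automorphism φ ψ ψφ φψ iso =
    ((λ {x} {y} e → trans (sym (ψφ x)) (trans (cong ψ e) (ψφ y))) ,
     (λ y → ψ y , λ { refl → φψ y })) ,
    λ x y → mk⇔ (trans (iso x y)) (trans (sym (iso x y)))

  id-automorphism : ∀ {n} → IsAutomorphism {n} (λ x → x)
  id-automorphism = automorphism _ _ (λ _ → refl) (λ _ → refl) (λ _ _ → refl)

  ∘-automorphism : ∀ {n} {φ ψ : Vertex n → Vertex n} → IsAutomorphism φ → IsAutomorphism ψ → IsAutomorphism (λ x → ψ (φ x))
  ∘-automorphism {φ = φ} {ψ} ((i₁ , s₁) , a₁) ((i₂ , s₂) , a₂) =
    ((λ e → i₁ (i₂ e)) ,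
     (λ z → let y , p = s₂ z ; x , q = s₁ y in x , λ { refl → p (q refl) })) ,
    λ x y → mk⇔ (λ e → to (a₂ (φ x) (φ y)) (to (a₁ x y) e)) (λ e → from (a₁ x y) (from (a₂ (φ x) (φ y)) e))

  module _ {n : ℕ} {φ : Vertex n → Vertex n} (aut : IsAutomorphism φ) where

    private
      inj  = proj₁ (proj₁ aut)
      surj = proj₂ (proj₁ aut)
      adj  = proj₂ aut

    inverse : Vertex n → Vertex n
    inverse y = proj₁ (surj y)

    inverseʳ : ∀ y → φ (inverse y) ≡ y
    inverseʳ y = proj₂ (surj y) refl

    inverse-automorphism : IsAutomorphism inverse
    inverse-automorphism =
      ((λ {x} {y} e → trans (sym (inverseʳ x)) (trans (cong φ e) (inverseʳ y))) ,
       (λ x → φ x , λ { refl → inj (inverseʳ (φ x)) })) ,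
      λ x y → mk⇔ (λ e → from (adj (inverse x) (inverse y)) (subst₂ Adjacent (sym (inverseʳ x)) (sym (inverseʳ y)) e))
                  (λ e → subst₂ Adjacent (inverseʳ x) (inverseʳ y) (to (adj (inverse x) (inverse y)) e))

  onTail : ∀ {n} → (Vertex n → Vertex n) → Vertex (suc n) → Vertex (suc n)
  onTail φ (a ∷ x) = a ∷ φ x

  onTail-automorphism : ∀ {n} {φ : Vertex n → Vertex n} → IsAutomorphism φ → IsAutomorphism (onTail φ)
  onTail-automorphism {φ = φ} ((inj , surj) , adj) = (inj′ , surj′) , adj′
    where
    inj′ : ∀ {x y} → onTail φ x ≡ onTail φ y → x ≡ y
    inj′ {a ∷ x} {b ∷ y} e = cong₂ _∷_ (cong head e) (inj (cong tail e))
    surj′ : ∀ y → ∃ λ x → ∀ {z} → z ≡ x → onTail φ z ≡ y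
    surj′ (a ∷ y) = let x , p = surj y in a ∷ x , λ { refl → cong (a ∷_) (p refl) }
    adj′ : ∀ x y → Adjacent x y ⇔ Adjacent (onTail φ x) (onTail φ y)
    adj′ (false ∷ x) (false ∷ y) = adj x y
    adj′ (true ∷ x)  (true ∷ y)  = adj x y
    adj′ (false ∷ x) (true ∷ y)  = mk⇔
      (λ e → cong suc (trans (cong (hamming (φ x)) (cong φ (sym (adjacent-not false x y e)))) (hamming-refl (φ x))))
      (λ e → cong suc (trans (cong (hamming x) (sym (inj (adjacent-not false (φ x) (φ y) e)))) (hamming-refl x)))
    adj′ (true ∷ x)  (false ∷ y) = mk⇔
      (λ e → cong suc (trans (cong (hamming (φ x)) (cong φ (sym (adjacent-not true x y e)))) (hamming-refl (φ x))))
      (λ e → cong suc (trans (cong (hamming x) (sym (inj (adjacent-not true (φ x) (φ y) e)))) (hamming-refl x)))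

  xorHead : ∀ {n} → Bool → Vertex (suc n) → Vertex (suc n)
  xorHead b (a ∷ x) = (a xor b) ∷ x

  xorHead-automorphism : ∀ {n} b → IsAutomorphism (xorHead {n} b)
  xorHead-automorphism b = automorphism _ (xorHead b) (cancel b) (cancel b) (isometry b)
    where
    cancel : ∀ b x → xorHead b (xorHead b x) ≡ x
    cancel false (a ∷ x)     = cong (_∷ x) (trans (Bₚ.xor-identityʳ (a xor false)) (Bₚ.xor-identityʳ a))
    cancel true  (false ∷ x) = refl
    cancel true  (true ∷ x)  = refl
    isometry : ∀ b x y → hamming (xorHead b x) (xorHead b y) ≡ hamming x y
    isometry false (a ∷ x) (b ∷ y) rewrite Bₚ.xor-identityʳ a | Bₚ.xor-identityʳ b = refl
    isometry true (false ∷ x) (false ∷ y) = refl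
    isometry true (false ∷ x) (true ∷ y)  = refl
    isometry true (true ∷ x)  (false ∷ y) = refl
    isometry true (true ∷ x)  (true ∷ y)  = refl

  toFront : ∀ {n} → Fin (suc n) → Vertex (suc n) → Vertex (suc n)
  toFront i x = lookup x i ∷ removeAt x i

  fromFront : ∀ {n} → Fin (suc n) → Vertex (suc n) → Vertex (suc n)
  fromFront i (a ∷ x) = insertAt x i a

  hamming-insertAt : ∀ {n} i a b (x y : Vertex n) → hamming (insertAt x i a) (insertAt y i b) ≡ hamming (a ∷ x) (b ∷ y)
  hamming-insertAt zero    a b x       y       = refl
  hamming-insertAt (suc i) a b (c ∷ x) (d ∷ y) rewrite hamming-insertAt i a b x y =
    lem (if c xor d then 1 else 0) (if a xor b then 1 else 0) (hamming x y)
    where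
    lem : ∀ p q r → p + (q + r) ≡ q + (p + r)
    lem p q r = trans (sym (+-assoc p q r)) (trans (cong (_+ r) (+-comm p q)) (+-assoc q p r))

  toFront-automorphism : ∀ {n} (i : Fin (suc n)) → IsAutomorphism (toFront i)
  toFront-automorphism i = automorphism _ (fromFront i) (λ x → insertAt-removeAt x i)
    (λ { (a ∷ x) → cong₂ _∷_ (insertAt-lookup x i a) (removeAt-insertAt x i a) })
    (λ x y → trans (sym (hamming-insertAt i (lookup x i) (lookup y i) (removeAt x i) (removeAt y i)))
                   (cong₂ hamming (insertAt-removeAt x i) (insertAt-removeAt y i)))

  -- An automorphism maps the edges of one direction i to the edges of direction 0, because this
  -- property of the edge at x propagates along 4-cycles to the edge at any neighbour of x.
  module _ {n : ℕ} {φ : Vertex (suc n) → Vertex (suc n)} (aut : IsAutomorphism φ) where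

    private
      inj = proj₁ (proj₁ aut)
      adj = proj₂ aut

      -- Surjectivity of `φ` finds the edge at the origin that is mapped into direction 0.
      start : Σ (Fin (suc n)) λ i → φ (flipAt i origin) ≡ flipAt zero (φ origin)
      start =
        let y = inverse aut (flipAt zero (φ origin))
            i , e = adjacent⇒flip origin y (from (adj origin y)
                      (subst (Adjacent (φ origin)) (sym (inverseʳ aut _)) (adjacent-flip zero (φ origin))))
        in i , trans (cong φ (sym e)) (inverseʳ aut _)

      -- If the edge from `p` to `r` changed the first coordinate, `r` would be `q`; likewise `s`
      -- would be `p`. Hence `r` and `s` inherit the distinct first coordinates of `p` and `q`, and
      -- the edge between them has direction 0.
      square : ∀ (p q r s : Vertex (suc n)) → q ≡ flipAt zero p → Adjacent p r → r ≢ q → Adjacent q s → Adjacent r s → s ≢ p →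
               head r ≡ head p × s ≡ flipAt zero r
      square (c ∷ p) (._ ∷ ._) (e ∷ r) (d ∷ s) refl pr r≢q qs rs s≢p with c | e | d
      ... | false | true  | _     = ⊥-elim (r≢q (cong (true ∷_) (sym (adjacent-not false p r pr))))
      ... | true  | false | _     = ⊥-elim (r≢q (cong (false ∷_) (sym (adjacent-not true p r pr))))
      ... | false | false | false = ⊥-elim (s≢p (cong (false ∷_) (sym (adjacent-not true p s qs))))
      ... | true  | true  | true  = ⊥-elim (s≢p (cong (true ∷_) (sym (adjacent-not false p s qs))))
      ... | false | false | true  = refl , cong (true ∷_) (sym (adjacent-not false r s rs))
      ... | true  | true  | false = refl , cong (false ∷_) (sym (adjacent-not true r s rs))

    direction : Fin (suc n)
    direction = proj₁ start

    private
      i = direction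

      propagate : ∀ x j → j ≢ i → φ (flipAt i x) ≡ flipAt zero (φ x) →
                  head (φ (flipAt j x)) ≡ head (φ x) × φ (flipAt i (flipAt j x)) ≡ flipAt zero (φ (flipAt j x))
      propagate x j j≢i e = square (φ x) (φ (flipAt i x)) (φ (flipAt j x)) (φ (flipAt i (flipAt j x))) e
        (to (adj _ _) (adjacent-flip j x))
        (λ p → j≢i (flip-injective j i x (inj p)))
        (subst (λ z → Adjacent (φ (flipAt i x)) (φ z)) (flip-comm j i x) (to (adj _ _) (adjacent-flip j (flipAt i x))))
        (to (adj _ _) (adjacent-flip i (flipAt j x)))
        (λ p → j≢i (flip-injective j i x (trans (sym (flip-involutive i (flipAt j x))) (cong (flipAt i) (inj p)))))

    flip-direction : ∀ x → φ (flipAt i x) ≡ flipAt zero (φ x)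
    flip-direction = connected _ (proj₂ start) step
      where
      step : ∀ x j → φ (flipAt i x) ≡ flipAt zero (φ x) → φ (flipAt i (flipAt j x)) ≡ flipAt zero (φ (flipAt j x))
      step x j e with j ≟ i
      ... | no j≢i   = proj₂ (propagate x j j≢i e)
      ... | yes refl = trans (cong φ (flip-involutive i x)) (sym (trans (cong (flipAt zero) e) (flip-involutive zero (φ x))))

    flip-other : ∀ x j → j ≢ i → head (φ (flipAt j x)) ≡ head (φ x)
    flip-other x j j≢i = proj₁ (propagate x j j≢i (flip-direction x))

    offset : Bool
    offset = head (φ (insertAt origin i false))

    remaining : Vertex n → Vertex n
    remaining y = tail (φ (insertAt y i false))

    private
      head-offset : ∀ y → head (φ (insertAt y i false)) ≡ offset
      head-offset = connected _ refl λ y j e →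
        trans (cong (λ z → head (φ z)) (insertAt-flip y i j false))
              (trans (flip-other (insertAt y i false) (punchIn i j) (punchInᵢ≢i i j)) e)

      φ-false : ∀ y → φ (insertAt y i false) ≡ offset ∷ remaining y
      φ-false y = trans (η (φ (insertAt y i false))) (cong (_∷ remaining y) (head-offset y))
        where
        η : (x : Vertex (suc n)) → x ≡ head x ∷ tail x
        η (_ ∷ _) = refl

    decomposition : ∀ y a → φ (insertAt y i a) ≡ (a xor offset) ∷ remaining y
    decomposition y false = φ-false y
    decomposition y true  = begin
      φ (insertAt y i true)               ≡⟨ cong φ (flip-insertAt y i false) ⟨
      φ (flipAt i (insertAt y i false))   ≡⟨ flip-direction (insertAt y i false) ⟩
      flipAt zero (φ (insertAt y i false)) ≡⟨ cong (flipAt zero) (φ-false y) ⟩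
      not offset ∷ remaining y            ∎
      where open ≡-Reasoning

    remaining-automorphism : IsAutomorphism remaining
    remaining-automorphism = (inj′ , surj′) , adj′
      where
      inj′ : ∀ {x y} → remaining x ≡ remaining y → x ≡ y
      inj′ {x} {y} e = trans (sym (removeAt-insertAt x i false))
        (trans (cong (λ z → removeAt z i) (inj (trans (φ-false x) (trans (cong (offset ∷_) e) (sym (φ-false y))))))
               (removeAt-insertAt y i false))
      surj′ : ∀ y → ∃ λ x → ∀ {z} → z ≡ x → remaining z ≡ y
      surj′ y = removeAt x i , λ { refl → cong tail (trans (sym (decomposition (removeAt x i) (lookup x i)))
                  (trans (cong φ (insertAt-removeAt x i)) (inverseʳ aut (offset ∷ y)))) }
        where
        x = inverse aut (offset ∷ y)
      adj′ : ∀ x y → Adjacent x y ⇔ Adjacent (remaining x) (remaining y)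
      adj′ x y = mk⇔
        (λ e → trans (sym same) (to (adj _ _) (trans ins e)))
        (λ e → trans (sym ins) (from (adj _ _) (trans same e)))
        where
        ins : hamming (insertAt x i false) (insertAt y i false) ≡ hamming x y
        ins = hamming-insertAt i false false x y
        same : hamming (φ (insertAt x i false)) (φ (insertAt y i false)) ≡ hamming (remaining x) (remaining y)
        same = trans (cong₂ hamming (φ-false x) (φ-false y)) (hamming-same offset (remaining x) (remaining y))

  applySign-involutive : ∀ ε b → applySign ε (applySign ε b) ≡ b
  applySign-involutive false b = refl
  applySign-involutive true  b = Bₚ.not-involutive b

  applySign-xor : ∀ ε δ b → applySign ε (applySign δ b) ≡ applySign (ε xor δ) b
  applySign-xor false δ     b = refl
  applySign-xor true  false b = refl
  applySign-xor true  true  b = Bₚ.not-involutive b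

  Isomorphic-sym : ∀ {n} (f g : BoolFn n) → Isomorphic f g → Isomorphic g f
  Isomorphic-sym f g (φ , aut , ε , e) = inverse aut , inverse-automorphism aut , ε , λ x → begin
    g x                                            ≡⟨ applySign-involutive ε (g x) ⟨
    applySign ε (applySign ε (g x))                ≡⟨ cong (λ z → applySign ε (applySign ε (g z))) (inverseʳ aut x) ⟨
    applySign ε (applySign ε (g (φ (inverse aut x)))) ≡⟨ cong (applySign ε) (e (inverse aut x)) ⟨
    applySign ε (f (inverse aut x))                ∎
    where open ≡-Reasoning

  Isomorphic-trans : ∀ {n} (f g h : BoolFn n) → Isomorphic f g → Isomorphic g h → Isomorphic f h
  Isomorphic-trans f g h (φ , aut , ε , e) (ψ , aut′ , δ , e′) =
    (λ x → ψ (φ x)) , ∘-automorphism aut aut′ , ε xor δ ,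
    λ x → trans (e x) (trans (cong (applySign ε) (e′ (φ x))) (applySign-xor ε δ (h (ψ (φ x)))))

  ≗⇒Isomorphic : ∀ {n} (f g : BoolFn n) → (∀ x → f x ≡ g x) → Isomorphic f g
  ≗⇒Isomorphic f g e = (λ x → x) , id-automorphism , false , e

  -- The `2 ^ n * n !` signed permutations: the direction sent to direction 0, a sign there, and
  -- recursively the rest. Since `encode` reaches every automorphism, a search for an isomorphism is
  -- finite.
  Code : ℕ → Set
  Code zero    = ⊤
  Code (suc n) = Fin (suc n) × Bool × Code n

  decode : ∀ {n} → Code n → Vertex n → Vertex n
  decode {zero}  _           x = x
  decode {suc n} (i , b , c) x = xorHead b (onTail (decode c) (toFront i x))

  decode-automorphism : ∀ {n} (c : Code n) → IsAutomorphism (decode c)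
  decode-automorphism {zero}  _           = id-automorphism
  decode-automorphism {suc n} (i , b , c) =
    ∘-automorphism (∘-automorphism (toFront-automorphism i) (onTail-automorphism (decode-automorphism c)))
                   (xorHead-automorphism b)

  encode : ∀ {n} {φ : Vertex n → Vertex n} → IsAutomorphism φ → Σ (Code n) λ c → ∀ x → φ x ≡ decode c x
  encode {zero} {φ} aut = tt , λ { [] → empty (φ []) }
    where
    empty : (x : Vertex 0) → x ≡ []
    empty [] = refl
  encode {suc n} {φ} aut =
    let c , e = encode (remaining-automorphism aut)
        i = direction aut
    in (i , offset aut , c) , λ x →
       trans (cong φ (sym (insertAt-removeAt x i)))
             (trans (decomposition aut (removeAt x i) (lookup x i))
                    (cong ((lookup x i xor offset aut) ∷_) (e (removeAt x i))))

  anyBool? : {P : Bool → Set} → (∀ b → Dec (P b)) → Dec (∃ P)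
  anyBool? P? = map′ (λ { (inj₁ p) → false , p ; (inj₂ p) → true , p })
                     (λ { (false , p) → inj₁ p ; (true , p) → inj₂ p }) (P? false ⊎-dec P? true)

  anyCode? : ∀ {n} {P : Code n → Set} → (∀ c → Dec (P c)) → Dec (∃ P)
  anyCode? {zero}  P? = map′ (tt ,_) (λ { (tt , p) → p }) (P? tt)
  anyCode? {suc n} P? = map′ (λ { (i , b , c , p) → (i , b , c) , p }) (λ { ((i , b , c) , p) → i , b , c , p })
    (any? λ i → anyBool? λ b → anyCode? λ c → P? (i , b , c))

  isomorphic? : ∀ {n} (f g : BoolFn n) → Dec (Isomorphic f g)
  isomorphic? f g = map′
    (λ (c , ε , e) → decode c , decode-automorphism c , ε , e)
    (λ (φ , aut , ε , e) → let c , d = encode aut in c , ε , λ x → trans (e x) (cong (λ z → applySign ε (g z)) (d x)))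
    (anyCode? λ c → anyBool? λ ε → all? λ x → f x Bₚ.≟ applySign ε (g (decode c x)))

  Isomorphic-tail : ∀ {n} (f g : BoolFn n) → Isomorphic f g → Isomorphic (λ x → f (tail x)) (λ x → g (tail x))
  Isomorphic-tail f g (φ , aut , ε , e) = onTail φ , onTail-automorphism aut , ε , λ { (a ∷ x) → e x }

  -- If the direction that φ maps to direction 0 is not itself direction 0, then f does not depend on
  -- that coordinate j, and its value may be used in place of the unused coordinate 0.
  Isomorphic-tail⁻¹ : ∀ {n} (f g : BoolFn n) → Isomorphic (λ x → f (tail x)) (λ x → g (tail x)) → Isomorphic f g
  Isomorphic-tail⁻¹ f g (φ , aut , ε , e) = go {g = g} (remaining-automorphism aut) (direction aut) key
    where
    key : ∀ y a → f (tail (insertAt y (direction aut) a)) ≡ applySign ε (g (remaining aut y))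
    key y a = trans (e (insertAt y (direction aut) a)) (cong (λ z → applySign ε (g (tail z))) (decomposition aut y a))
    go : ∀ {n} {f g : BoolFn n} {ψ : Vertex n → Vertex n} → IsAutomorphism ψ → (i : Fin (suc n)) →
         (∀ y a → f (tail (insertAt y i a)) ≡ applySign ε (g (ψ y))) → Isomorphic f g
    go {ψ = ψ} aut zero key = ψ , aut , ε , λ y → key y false
    go {suc n} {f} {ψ = ψ} aut (suc j) key =
      (λ x → ψ (toFront j x)) , ∘-automorphism (toFront-automorphism j) aut , ε ,
      λ x → trans (cong f (sym (insertAt-removeAt x j))) (key (toFront j x) (lookup x j))

  -- The coordinate is the direction that the automorphism maps to direction 0, which `tail`
  -- forgets.
  irrelevant-coordinate : ∀ {n} (f : BoolFn (suc n)) (g : BoolFn n) → Isomorphic f (λ x → g (tail x)) →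
                          Σ (Fin (suc n)) λ i → ∀ x → f (flipAt i x) ≡ f x
  irrelevant-coordinate f g (φ , aut , ε , e) = i , λ x → begin
    f (flipAt i x)                            ≡⟨ e (flipAt i x) ⟩
    applySign ε (g (tail (φ (flipAt i x))))   ≡⟨ cong (λ z → applySign ε (g (tail z))) (flip-direction aut x) ⟩
    applySign ε (g (tail (flipAt zero (φ x)))) ≡⟨ cong (λ z → applySign ε (g z)) (tail-flip (φ x)) ⟩
    applySign ε (g (tail (φ x)))              ≡⟨ e x ⟨
    f x                                       ∎
    where
    open ≡-Reasoning
    i = direction aut
    tail-flip : ∀ {n} (x : Vertex (suc n)) → tail (flipAt zero x) ≡ tail x
    tail-flip (_ ∷ _) = refl

  drop-coordinate : ∀ {n} (f : BoolFn (suc n)) i → (∀ x → f (flipAt i x) ≡ f x) →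
                    Isomorphic f (λ x → f (insertAt (tail x) i false))
  drop-coordinate f i irr = toFront i , toFront-automorphism i , false , λ x →
    trans (cong f (sym (insertAt-removeAt x i))) (either (removeAt x i) (lookup x i))
    where
    either : ∀ y a → f (insertAt y i a) ≡ f (insertAt y i false)
    either y false = refl
    either y true  = trans (cong f (sym (flip-insertAt y i false))) (irr (insertAt y i false))


-- Weights, Parseval and the Laplacian

module Weights where

  open import Defs using (Vertex)
  open MultilinearDegree
  open import Data.Bool using (Bool; true; false; not)
  open import Data.Nat as ℕ using (ℕ; zero; suc; z≤n; s≤s)
  import Data.Nat.Properties as ℕₚ
  import Data.Nat.Tactic.RingSolver as ℕ-Ring
  open import Data.Integer hiding (suc)
  open import Data.Integer.Properties
  open import Data.Integer.Tactic.RingSolver using (solve-∀)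
  open import Data.Fin using (Fin; zero; suc)
  open import Data.Vec using ([]; _∷_; lookup; _[_]≔_)
  open import Data.Product using (_,_)
  open import Data.Sum using (_⊎_; inj₁; inj₂)
  open import Data.Empty using (⊥-elim)
  open import Relation.Binary.PropositionalEquality
  open import Relation.Nullary using (Dec; yes; no; ¬_)

  Deg<-mono : ∀ {d e n} {f : Fn n} → d ℕ.≤ e → Deg< d f → Deg< e f
  Deg<-mono {e = e} z≤n (null p)       = Deg<-zero e p
  Deg<-mono (s≤s l) point              = point
  Deg<-mono (s≤s l) (split a b)        = split (Deg<-mono (s≤s l) a) (Deg<-mono l b)

  fix : ∀ {n} → Fin n → Bool → Fn n → Fn n
  fix i b g x = g (x [ i ]≔ b)

  Deg<-fix : ∀ {d n} (i : Fin n) b {g : Fn n} → Deg< d g → Deg< d (fix i b g)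
  Deg<-fix i b (null p) = null λ x → p (x [ i ]≔ b)
  Deg<-fix zero false {g} (split p q) = split p (Deg<-zero _ (λ x → +-inverseʳ (g (false ∷ x))))
  Deg<-fix zero true  {g} (split p q) = split (Deg<-true {f = g} (split p q)) (Deg<-zero _ (λ x → +-inverseʳ (g (true ∷ x))))
  Deg<-fix (suc i) b (split p q) = split (Deg<-fix i b p) (Deg<-fix i b q)

  data HasDegree {n} (g : Fn n) : Set where
    vanishing : (∀ x → g x ≡ 0ℤ) → HasDegree g
    exactly   : ∀ e → e ℕ.≤ n → Deg< (suc e) g → ¬ Deg< e g → HasDegree g

  degree : ∀ {n} (g : Fn n) → HasDegree g
  degree {n} g = search n ℕₚ.≤-refl (Deg<-full n)
    where
    search : ∀ e → e ℕ.≤ n → Deg< (suc e) g → HasDegree g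
    search e l p with deg<? e g
    search e       l p | no ¬q       = exactly e l p ¬q
    search zero    l p | yes (null q) = vanishing q
    search (suc e) l p | yes q       = search e (ℕₚ.<⇒≤ l) q

  -- The scaled weight 2 ^ n * 2 ^ (- deg g), and 0 for the zero function.
  weight : ∀ {n} → Fn n → ℕ
  weight {n} g with degree g
  ... | vanishing _     = 0
  ... | exactly e _ _ _ = 2 ℕ.^ (n ℕ.∸ e)

  pow-∸ : ∀ {n e} → e ℕ.≤ n → 2 ℕ.^ (n ℕ.∸ e) ℕ.* 2 ℕ.^ e ≡ 2 ℕ.^ n
  pow-∸ {n} {e} l = trans (sym (ℕₚ.^-distribˡ-+-* 2 (n ℕ.∸ e) e)) (cong (2 ℕ.^_) (ℕₚ.m∸n+n≡m l))

  weight-upper : ∀ {n e} {g : Fn n} → ¬ Deg< e g → weight g ℕ.* 2 ℕ.^ e ℕ.≤ 2 ℕ.^ n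
  weight-upper {n} {e} {g} ¬p with degree g
  ... | vanishing _       = z≤n
  ... | exactly e′ l q _ = ℕₚ.≤-trans
    (ℕₚ.*-monoʳ-≤ (2 ℕ.^ (n ℕ.∸ e′)) (ℕₚ.^-monoʳ-≤ 2 (ℕₚ.≮⇒≥ λ e′<e → ¬p (Deg<-mono e′<e q))))
    (ℕₚ.≤-reflexive (pow-∸ l))

  weight-lower : ∀ {n e} {g : Fn n} → ¬ (∀ x → g x ≡ 0ℤ) → Deg< (suc e) g → 2 ℕ.^ n ℕ.≤ weight g ℕ.* 2 ℕ.^ e
  weight-lower {n} {e} {g} ¬z p with degree g
  ... | vanishing z        = ⊥-elim (¬z z)
  ... | exactly e′ l q ¬q = ℕₚ.≤-trans (ℕₚ.≤-reflexive (sym (pow-∸ l)))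
    (ℕₚ.*-monoʳ-≤ (2 ℕ.^ (n ℕ.∸ e′)) (ℕₚ.^-monoʳ-≤ 2 (ℕₚ.≮⇒≥ λ e<e′ → ¬q (Deg<-mono e<e′ p))))

  pow-cancel : ∀ e {a b} → a ℕ.* 2 ℕ.^ e ℕ.≤ b ℕ.* 2 ℕ.^ e → a ℕ.≤ b
  pow-cancel e {a} {b} = ℕₚ.*-cancelʳ-≤ a b (2 ℕ.^ e) ⦃ ℕₚ.m^n≢0 2 e ⦄

  set-same : ∀ {n} (x : Vertex n) i b → lookup x i ≡ b → x [ i ]≔ b ≡ x
  set-same (a ∷ x) zero    b e = cong (_∷ x) (sym e)
  set-same (a ∷ x) (suc i) b e = cong (a ∷_) (set-same x i b e)

  module _ {n : ℕ} (i : Fin n) (g : Fn n) where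
    private
      g₀ = fix i false g
      g₁ = fix i true g

    fix-zero : (∀ x → g₀ x ≡ 0ℤ) → (∀ x → g₁ x ≡ 0ℤ) → ∀ x → g x ≡ 0ℤ
    fix-zero p q x with lookup x i in e
    ... | false = trans (cong g (sym (set-same x i false e))) (p x)
    ... | true  = trans (cong g (sym (set-same x i true e))) (q x)

    -- If one half vanishes, the other is `D i g` up to sign, and a derivative has smaller degree.
    Deg<-fix-pred : ∀ {d} → (∀ x → g₀ x ≡ 0ℤ) ⊎ (∀ x → g₁ x ≡ 0ℤ) → Deg< (suc d) g → ∀ b → Deg< d (fix i b g)
    Deg<-fix-pred (inj₁ z) p false = Deg<-zero _ z
    Deg<-fix-pred (inj₂ z) p true  = Deg<-zero _ z
    Deg<-fix-pred (inj₁ z) p true  = Deg<-ext (λ x → trans (cong (λ y → g₁ x - y) (z x)) (+-identityʳ (g₁ x))) (Deg<-D i p)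
    Deg<-fix-pred (inj₂ z) p false = Deg<-ext
      (λ x → trans (cong (λ y → - 1ℤ * (y - g₀ x)) (z x)) (lem (g₀ x))) (Deg<-scale (- 1ℤ) (Deg<-D i p))
      where
      lem : ∀ a → - 1ℤ * (0ℤ - a) ≡ a
      lem = solve-∀

    weight-fix-gain : ∀ e → e ℕ.≤ n → Deg< (suc e) g → (∀ x → g₀ x ≡ 0ℤ) ⊎ (∀ x → g₁ x ≡ 0ℤ) →
      ∀ b → ¬ (∀ x → fix i b g x ≡ 0ℤ) → 2 ℕ.* 2 ℕ.^ (n ℕ.∸ e) ℕ.≤ weight (fix i b g)
    weight-fix-gain zero l p z b ¬z with Deg<-fix-pred z p b
    ... | null q = ⊥-elim (¬z q)
    weight-fix-gain (suc e) l p z b ¬z = pow-cancel e (begin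
      2 ℕ.* 2 ℕ.^ (n ℕ.∸ suc e) ℕ.* 2 ℕ.^ e    ≡⟨ lem (2 ℕ.^ (n ℕ.∸ suc e)) (2 ℕ.^ e) ⟩
      2 ℕ.^ (n ℕ.∸ suc e) ℕ.* 2 ℕ.^ suc e      ≡⟨ pow-∸ l ⟩
      2 ℕ.^ n                                  ≤⟨ weight-lower ¬z (Deg<-fix-pred z p b) ⟩
      weight (fix i b g) ℕ.* 2 ℕ.^ e           ∎)
      where
      open ℕₚ.≤-Reasoning
      lem : ∀ a b → 2 ℕ.* a ℕ.* b ≡ a ℕ.* (2 ℕ.* b)
      lem = ℕ-Ring.solve-∀

    -- If neither restriction is zero, each has degree at most that of `g`. If one is zero, the
    -- degree of the other drops, and its weight alone is at least twice that of `g`.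
    weight-fix : 2 ℕ.* weight g ℕ.≤ weight g₀ ℕ.+ weight g₁
    weight-fix with degree g
    ... | vanishing _ = z≤n
    ... | exactly e l p ¬p = cases (all? (λ x → g₀ x ≟ 0ℤ)) (all? (λ x → g₁ x ≟ 0ℤ))
      where
      W = 2 ℕ.^ (n ℕ.∸ e)
      both : ∀ b → ¬ (∀ x → fix i b g x ≡ 0ℤ) → W ℕ.≤ weight (fix i b g)
      both b ¬z = pow-cancel e (ℕₚ.≤-trans (ℕₚ.≤-reflexive (pow-∸ l)) (weight-lower ¬z (Deg<-fix i b p)))
      cases : Dec (∀ x → g₀ x ≡ 0ℤ) → Dec (∀ x → g₁ x ≡ 0ℤ) → 2 ℕ.* W ℕ.≤ weight g₀ ℕ.+ weight g₁
      cases (yes z₀) (yes z₁) = ⊥-elim (¬p (Deg<-zero e (fix-zero z₀ z₁)))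
      cases (yes z₀) (no ¬z₁) = ℕₚ.≤-trans (weight-fix-gain e l p (inj₁ z₀) true ¬z₁) (ℕₚ.m≤n+m _ (weight g₀))
      cases (no ¬z₀) (yes z₁) = ℕₚ.≤-trans (weight-fix-gain e l p (inj₂ z₁) false ¬z₀) (ℕₚ.m≤m+n _ (weight g₁))
      cases (no ¬z₀) (no ¬z₁) = ℕₚ.≤-trans (ℕₚ.≤-reflexive (cong (W ℕ.+_) (ℕₚ.+-identityʳ W)))
                                           (ℕₚ.+-mono-≤ (both false ¬z₀) (both true ¬z₁))

  nonzero : ℤ → ℕ
  nonzero +0       = 0
  nonzero +[1+ _ ] = 1
  nonzero -[1+ _ ] = 1

  nonzero≤sq : ∀ z → + nonzero z ≤ z * z
  nonzero≤sq +0       = +≤+ z≤n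
  nonzero≤sq +[1+ _ ] = +≤+ (s≤s z≤n)
  nonzero≤sq -[1+ _ ] = +≤+ (s≤s z≤n)

  nonzero-pos : ∀ {z} → z ≢ 0ℤ → 1 ℕ.≤ nonzero z
  nonzero-pos {+0}       z≢0 = ⊥-elim (z≢0 refl)
  nonzero-pos {+[1+ _ ]} _   = s≤s z≤n
  nonzero-pos { -[1+ _ ]} _  = s≤s z≤n

  support : ∀ {n} → Fn n → ℕ
  support {zero}  g = nonzero (g [])
  support {suc n} g = support (λ x → g (false ∷ x)) ℕ.+ support (λ x → g (true ∷ x))

  -- The Schwartz-Zippel bound on the cube. If one half vanishes, the other is the derivative up to
  -- sign, and its smaller degree compensates for the halved domain.
  support-bound : ∀ n {d} {g : Fn n} → ¬ (∀ x → g x ≡ 0ℤ) → Deg< (suc d) g → 2 ℕ.^ n ℕ.≤ support g ℕ.* 2 ℕ.^ d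
  support-bound zero {d} {g} ¬z p =
    ℕₚ.*-mono-≤ (nonzero-pos {g []} (λ e → ¬z λ { [] → e })) (ℕₚ.m^n>0 2 d)
  support-bound (suc n) {d} {g} ¬z (split p q) =
    cases (all? (λ x → g (false ∷ x) ≟ 0ℤ)) (all? (λ x → g (true ∷ x) ≟ 0ℤ))
    where
    open ℕₚ.≤-Reasoning
    s₀ = support (λ x → g (false ∷ x))
    s₁ = support (λ x → g (true ∷ x))
    lem : ∀ a b → 2 ℕ.* (a ℕ.* b) ≡ a ℕ.* (2 ℕ.* b)
    lem = ℕ-Ring.solve-∀
    half : ∀ {d b} → Deg< d (λ x → g (b ∷ x)) → ¬ (∀ x → g (b ∷ x) ≡ 0ℤ) →
           2 ℕ.* 2 ℕ.^ n ℕ.≤ support (λ x → g (b ∷ x)) ℕ.* 2 ℕ.^ d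
    half {zero} (null z) ¬z′ = ⊥-elim (¬z′ z)
    half {suc d} {b} r ¬z′ = ℕₚ.≤-trans (ℕₚ.*-monoʳ-≤ 2 (support-bound n ¬z′ r))
                            (ℕₚ.≤-reflexive (lem (support (λ x → g (b ∷ x))) (2 ℕ.^ d)))
    cases : Dec (∀ x → g (false ∷ x) ≡ 0ℤ) → Dec (∀ x → g (true ∷ x) ≡ 0ℤ) →
            2 ℕ.* 2 ℕ.^ n ℕ.≤ (s₀ ℕ.+ s₁) ℕ.* 2 ℕ.^ d
    cases (yes z₀) (yes z₁) = ⊥-elim (¬z λ { (false ∷ x) → z₀ x ; (true ∷ x) → z₁ x })
    cases (yes z₀) (no ¬z₁) = ℕₚ.≤-trans
      (half (Deg<-ext (λ x → trans (cong (λ y → g (true ∷ x) - y) (z₀ x)) (+-identityʳ (g (true ∷ x)))) q) ¬z₁)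
      (ℕₚ.*-monoˡ-≤ (2 ℕ.^ d) (ℕₚ.m≤n+m s₁ s₀))
    cases (no ¬z₀) (yes z₁) = ℕₚ.≤-trans
      (half (Deg<-ext (λ x → trans (cong (λ y → - 1ℤ * (y - g (false ∷ x))) (z₁ x)) (lem′ (g (false ∷ x))))
                      (Deg<-scale (- 1ℤ) q)) ¬z₀)
      (ℕₚ.*-monoˡ-≤ (2 ℕ.^ d) (ℕₚ.m≤m+n s₀ s₁))
      where
      lem′ : ∀ a → - 1ℤ * (0ℤ - a) ≡ a
      lem′ = solve-∀
    cases (no ¬z₀) (no ¬z₁) = begin
      2 ℕ.* 2 ℕ.^ n                               ≡⟨ cong (2 ℕ.^ n ℕ.+_) (ℕₚ.+-identityʳ _) ⟩
      2 ℕ.^ n ℕ.+ 2 ℕ.^ n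
        ≤⟨ ℕₚ.+-mono-≤ (support-bound n ¬z₀ p) (support-bound n ¬z₁ (Deg<-true {f = g} (split p q))) ⟩
      s₀ ℕ.* 2 ℕ.^ d ℕ.+ s₁ ℕ.* 2 ℕ.^ d           ≡⟨ ℕₚ.*-distribʳ-+ (2 ℕ.^ d) s₀ s₁ ⟨
      (s₀ ℕ.+ s₁) ℕ.* 2 ℕ.^ d                     ∎

  weight≤support : ∀ {n} (g : Fn n) → weight g ℕ.≤ support g
  weight≤support {n} g with degree g
  ... | vanishing _      = z≤n
  ... | exactly e l p ¬p = pow-cancel e
    (ℕₚ.≤-trans (ℕₚ.≤-reflexive (pow-∸ l)) (support-bound n (λ z → ¬p (Deg<-zero e z)) p))

  sum : ∀ {n} → Fn n → ℤ
  sum {zero}  f = f []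
  sum {suc n} f = sum (λ x → f (false ∷ x)) + sum (λ x → f (true ∷ x))

  sum-ext : ∀ {n} {f g : Fn n} → (∀ x → f x ≡ g x) → sum f ≡ sum g
  sum-ext {zero}  e = e []
  sum-ext {suc n} e = cong₂ _+_ (sum-ext (λ x → e (false ∷ x))) (sum-ext (λ x → e (true ∷ x)))

  sum-+ : ∀ {n} (f g : Fn n) → sum (λ x → f x + g x) ≡ sum f + sum g
  sum-+ {zero}  f g = refl
  sum-+ {suc n} f g = trans
    (cong₂ _+_ (sum-+ (λ x → f (false ∷ x)) (λ x → g (false ∷ x))) (sum-+ (λ x → f (true ∷ x)) (λ x → g (true ∷ x))))
    (lem (sum (λ x → f (false ∷ x))) (sum (λ x → g (false ∷ x))) (sum (λ x → f (true ∷ x))) (sum (λ x → g (true ∷ x))))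
    where
    lem : ∀ a b c d → (a + b) + (c + d) ≡ (a + c) + (b + d)
    lem = solve-∀

  sum-* : ∀ {n} c (f : Fn n) → sum (λ x → c * f x) ≡ c * sum f
  sum-* {zero}  c f = refl
  sum-* {suc n} c f = trans (cong₂ _+_ (sum-* c (λ x → f (false ∷ x))) (sum-* c (λ x → f (true ∷ x))))
    (sym (*-distribˡ-+ c (sum (λ x → f (false ∷ x))) (sum (λ x → f (true ∷ x)))))

  sum-zero : ∀ {n} {f : Fn n} → (∀ x → f x ≡ 0ℤ) → sum f ≡ 0ℤ
  sum-zero {zero}  p = p []
  sum-zero {suc n} p = cong₂ _+_ (sum-zero (λ x → p (false ∷ x))) (sum-zero (λ x → p (true ∷ x)))

  sum-one : ∀ n → sum {n} (λ _ → 1ℤ) ≡ + (2 ℕ.^ n)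
  sum-one zero    = refl
  sum-one (suc n) rewrite sum-one n = cong +_ (cong (2 ℕ.^ n ℕ.+_) (sym (ℕₚ.+-identityʳ _)))

  sq : ∀ {n} → Fn n → Fn n
  sq f x = f x * f x

  -- Every edge counts at both of its ends, hence the factor 2; `energy≡` identifies this with the
  -- sum over all `D i f`.
  energy : ∀ {n} → Fn n → ℤ
  energy {zero}  f = 0ℤ
  energy {suc n} f = + 2 * sum (sq (∂ f)) + (energy (λ x → f (false ∷ x)) + energy (λ x → f (true ∷ x)))

  energy-ext : ∀ {n} {f g : Fn n} → (∀ x → f x ≡ g x) → energy f ≡ energy g
  energy-ext {zero}  e = refl
  energy-ext {suc n} {f} {g} e = cong₂ _+_
    (cong (+ 2 *_) (sum-ext (λ x → cong (λ z → z * z) (cong₂ _-_ (e (true ∷ x)) (e (false ∷ x))))))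
    (cong₂ _+_ (energy-ext (λ x → e (false ∷ x))) (energy-ext (λ x → e (true ∷ x))))

  energy-affine : ∀ {n} a c (f : Fn n) → energy (λ x → a + c * f x) ≡ c * c * energy f
  energy-affine {zero}  a c f = sym (*-zeroʳ (c * c))
  energy-affine {suc n} a c f = trans
    (cong₂ _+_ (cong (+ 2 *_) (trans (sum-ext (λ x → lem a c (f (true ∷ x)) (f (false ∷ x)))) (sum-* (c * c) (sq (∂ f)))))
               (cong₂ _+_ (energy-affine a c (λ x → f (false ∷ x))) (energy-affine a c (λ x → f (true ∷ x)))))
    (lem′ (c * c) (sum (sq (∂ f))) (energy (λ x → f (false ∷ x))) (energy (λ x → f (true ∷ x))))
    where
    lem : ∀ a c x y → ((a + c * x) - (a + c * y)) * ((a + c * x) - (a + c * y)) ≡ c * c * ((x - y) * (x - y))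
    lem = solve-∀
    lem′ : ∀ c s x y → + 2 * (c * s) + (c * x + c * y) ≡ c * (+ 2 * s + (x + y))
    lem′ = solve-∀

  sum-parallelogram : ∀ {n} (f g : Fn n) →
    sum (sq (λ x → f x + g x)) + sum (sq (λ x → g x - f x)) ≡ + 2 * (sum (sq f) + sum (sq g))
  sum-parallelogram f g = begin
    sum (sq (λ x → f x + g x)) + sum (sq (λ x → g x - f x))    ≡⟨ sum-+ (sq (λ x → f x + g x)) (sq (λ x → g x - f x)) ⟨
    sum (λ x → (f x + g x) * (f x + g x) + (g x - f x) * (g x - f x))
      ≡⟨ sum-ext (λ x → lem (f x) (g x)) ⟩
    sum (λ x → + 2 * (f x * f x + g x * g x))                  ≡⟨ sum-* (+ 2) (λ x → f x * f x + g x * g x) ⟩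
    + 2 * sum (λ x → f x * f x + g x * g x)                    ≡⟨ cong (+ 2 *_) (sum-+ (sq f) (sq g)) ⟩
    + 2 * (sum (sq f) + sum (sq g))                            ∎
    where
    open ≡-Reasoning
    lem : ∀ a b → (a + b) * (a + b) + (b - a) * (b - a) ≡ + 2 * (a * a + b * b)
    lem = solve-∀

  energy-parallelogram : ∀ {n} (f g : Fn n) →
    energy (λ x → f x + g x) + energy (λ x → g x - f x) ≡ + 2 * (energy f + energy g)
  energy-parallelogram {zero}  f g = refl
  energy-parallelogram {suc n} f g = begin
    energy (λ x → f x + g x) + energy (λ x → g x - f x)
      ≡⟨ cong₂ (λ a b → + 2 * a + (a₁ + b₁) + (+ 2 * b + (a₂ + b₂)))
           (sum-ext (λ x → cong (λ z → z * z) (lem₁ (f (true ∷ x)) (f (false ∷ x)) (g (true ∷ x)) (g (false ∷ x)))))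
           (sum-ext (λ x → cong (λ z → z * z) (lem₂ (f (true ∷ x)) (f (false ∷ x)) (g (true ∷ x)) (g (false ∷ x))))) ⟩
    + 2 * s₁ + (a₁ + b₁) + (+ 2 * s₂ + (a₂ + b₂))    ≡⟨ lem₃ s₁ s₂ a₁ b₁ a₂ b₂ ⟩
    + 2 * (s₁ + s₂) + ((a₁ + a₂) + (b₁ + b₂))
      ≡⟨ cong₂ (λ x y → + 2 * x + y) (sum-parallelogram (∂ f) (∂ g))
           (cong₂ _+_ (energy-parallelogram (λ x → f (false ∷ x)) (λ x → g (false ∷ x)))
                      (energy-parallelogram (λ x → f (true ∷ x)) (λ x → g (true ∷ x)))) ⟩
    + 2 * (+ 2 * (sum (sq (∂ f)) + sum (sq (∂ g)))) + (+ 2 * (f₀ + g₀) + + 2 * (f₁ + g₁))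
      ≡⟨ lem₄ (sum (sq (∂ f))) (sum (sq (∂ g))) f₀ g₀ f₁ g₁ ⟩
    + 2 * (energy f + energy g) ∎
    where
    open ≡-Reasoning
    s₁ = sum (sq (λ x → ∂ f x + ∂ g x))
    s₂ = sum (sq (λ x → ∂ g x - ∂ f x))
    a₁ = energy (λ x → f (false ∷ x) + g (false ∷ x))
    b₁ = energy (λ x → f (true ∷ x) + g (true ∷ x))
    a₂ = energy (λ x → g (false ∷ x) - f (false ∷ x))
    b₂ = energy (λ x → g (true ∷ x) - f (true ∷ x))
    f₀ = energy (λ x → f (false ∷ x))
    f₁ = energy (λ x → f (true ∷ x))
    g₀ = energy (λ x → g (false ∷ x))
    g₁ = energy (λ x → g (true ∷ x))
    lem₁ : ∀ a b c d → (a + c) - (b + d) ≡ (a - b) + (c - d)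
    lem₁ = solve-∀
    lem₂ : ∀ a b c d → (c - a) - (d - b) ≡ (c - d) - (a - b)
    lem₂ = solve-∀
    lem₃ : ∀ s t a b c d → + 2 * s + (a + b) + (+ 2 * t + (c + d)) ≡ + 2 * (s + t) + ((a + c) + (b + d))
    lem₃ = solve-∀
    lem₄ : ∀ s t a b c d → + 2 * (+ 2 * (s + t)) + (+ 2 * (a + b) + + 2 * (c + d))
         ≡ + 2 * ((+ 2 * s + (a + c)) + (+ 2 * t + (b + d)))
    lem₄ = solve-∀

  energy-zero : ∀ {n} {f : Fn n} → (∀ x → f x ≡ 0ℤ) → energy f ≡ 0ℤ
  energy-zero {zero}  p = refl
  energy-zero {suc n} p = cong₂ _+_
    (cong (+ 2 *_) (sum-zero (λ x → cong (λ z → z * z) (cong₂ _-_ (p (true ∷ x)) (p (false ∷ x))))))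
    (cong₂ _+_ (energy-zero (λ x → p (false ∷ x))) (energy-zero (λ x → p (true ∷ x))))

  sum-sq-nonneg : ∀ {n} (f : Fn n) → 0ℤ ≤ sum (sq f)
  sum-sq-nonneg {zero}  f = ≤-trans (+≤+ z≤n) (nonzero≤sq (f []))
  sum-sq-nonneg {suc n} f = +-mono-≤ (sum-sq-nonneg (λ x → f (false ∷ x))) (sum-sq-nonneg (λ x → f (true ∷ x)))

  -- Parseval: split f into the sum and the difference of its two halves.
  energy-bound : ∀ n {d} {f : Fn n} → Deg< (suc d) f → energy f ≤ + 4 * + d * sum (sq f)
  energy-bound zero {d} {f} p = subst (_≤ + 4 * + d * sum (sq f)) (*-zeroʳ (+ 4 * + d))
    (subst (λ z → z * 0ℤ ≤ z * sum (sq f)) (pos-* 4 d) (*-monoˡ-≤-nonNeg (+ (4 ℕ.* d)) (sum-sq-nonneg f)))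
  energy-bound (suc n) {d} {f} (split p q) = *-cancelˡ-≤-pos _ _ (+ 2) (begin
    + 2 * (+ 2 * H + (E₀ + E₁))                ≡⟨ lem₁ H (E₀ + E₁) ⟩
    + 4 * H + + 2 * (E₀ + E₁)                  ≡⟨ cong (λ z → + 4 * H + z) (energy-parallelogram f₀ f₁) ⟨
    + 4 * H + (energy g + energy h)            ≡⟨ lem₂ (+ 4 * H) (energy g) (energy h) ⟩
    energy g + (energy h + + 4 * H)
      ≤⟨ +-mono-≤ (energy-bound n (Deg<-+ p (Deg<-true {f = f} (split p q)))) (h-bound q) ⟩
    + 4 * + d * sum (sq g) + + 4 * + d * H     ≡⟨ *-distribˡ-+ (+ 4 * + d) (sum (sq g)) H ⟨
    + 4 * + d * (sum (sq g) + H)               ≡⟨ cong (+ 4 * + d *_) (sum-parallelogram f₀ f₁) ⟩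
    + 4 * + d * (+ 2 * (sum (sq f₀) + sum (sq f₁)))  ≡⟨ lem₃ (+ 4 * + d) (sum (sq f₀) + sum (sq f₁)) ⟩
    + 2 * (+ 4 * + d * sum (sq f))             ∎)
    where
    open ≤-Reasoning
    f₀ = λ x → f (false ∷ x)
    f₁ = λ x → f (true ∷ x)
    g  = λ x → f₀ x + f₁ x
    h  = ∂ f
    H  = sum (sq h)
    E₀ = energy f₀
    E₁ = energy f₁
    lem₁ : ∀ a b → + 2 * (+ 2 * a + b) ≡ + 4 * a + + 2 * b
    lem₁ = solve-∀
    lem₂ : ∀ a b c → a + (b + c) ≡ b + (c + a)
    lem₂ = solve-∀
    lem₃ : ∀ a b → a * (+ 2 * b) ≡ + 2 * (a * b)
    lem₃ = solve-∀
    -- The characters in `h` come from those of `f` that contain the first coordinate. Their degree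
    -- in the remaining ones is smaller by one, and this pays for the term `4 * H`.
    h-bound : ∀ {d} → Deg< d h → energy h + + 4 * H ≤ + 4 * + d * H
    h-bound {zero} (null z) = ≤-reflexive (trans (cong₂ (λ a b → a + + 4 * b) (energy-zero z) H0)
                                                 (sym (cong (+ 4 * + 0 *_) H0)))
      where
      H0 : H ≡ 0ℤ
      H0 = sum-zero (λ x → cong (λ z → z * z) (z x))
    h-bound {suc d} r = begin
      energy h + + 4 * H            ≤⟨ +-monoˡ-≤ (+ 4 * H) (energy-bound n r) ⟩
      + 4 * + d * H + + 4 * H       ≡⟨ lem₄ (+ d) H ⟩
      + 4 * + suc d * H             ∎
      where
      lem₄ : ∀ d H → + 4 * d * H + + 4 * H ≡ + 4 * (1ℤ + d) * H
      lem₄ = solve-∀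

  sumFin : ∀ {n} → (Fin n → ℕ) → ℕ
  sumFin {zero}  c = 0
  sumFin {suc n} c = c zero ℕ.+ sumFin (λ i → c (suc i))

  sumFin-+ : ∀ {n} (a b : Fin n → ℕ) → sumFin (λ i → a i ℕ.+ b i) ≡ sumFin a ℕ.+ sumFin b
  sumFin-+ {zero}  a b = refl
  sumFin-+ {suc n} a b rewrite sumFin-+ (λ i → a (suc i)) (λ i → b (suc i)) =
    lem (a zero) (b zero) _ _
    where
    lem : ∀ a b c d → (a ℕ.+ b) ℕ.+ (c ℕ.+ d) ≡ (a ℕ.+ c) ℕ.+ (b ℕ.+ d)
    lem = ℕ-Ring.solve-∀

  sumFin-mono : ∀ {n} {a b : Fin n → ℕ} → (∀ i → a i ℕ.≤ b i) → sumFin a ℕ.≤ sumFin b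
  sumFin-mono {zero}  l = z≤n
  sumFin-mono {suc n} l = ℕₚ.+-mono-≤ (l zero) (sumFin-mono (λ i → l (suc i)))

  sumFin-ext : ∀ {n} {a b : Fin n → ℕ} → (∀ i → a i ≡ b i) → sumFin a ≡ sumFin b
  sumFin-ext {zero}  e = refl
  sumFin-ext {suc n} e = cong₂ ℕ._+_ (e zero) (sumFin-ext (λ i → e (suc i)))

  support≤sum-sq : ∀ {n} (g : Fn n) → + support g ≤ sum (sq g)
  support≤sum-sq {zero}  g = nonzero≤sq (g [])
  support≤sum-sq {suc n} g = +-mono-≤ (support≤sum-sq (λ x → g (false ∷ x))) (support≤sum-sq (λ x → g (true ∷ x)))

  sumFinℤ : ∀ {n} → (Fin n → ℤ) → ℤ
  sumFinℤ {zero}  c = 0ℤ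
  sumFinℤ {suc n} c = c zero + sumFinℤ (λ i → c (suc i))

  sumFinℤ-+ : ∀ {n} (a b : Fin n → ℤ) → sumFinℤ (λ i → a i + b i) ≡ sumFinℤ a + sumFinℤ b
  sumFinℤ-+ {zero}  a b = refl
  sumFinℤ-+ {suc n} a b rewrite sumFinℤ-+ (λ i → a (suc i)) (λ i → b (suc i)) =
    lem (a zero) (b zero) _ _
    where
    lem : ∀ a b c d → (a + b) + (c + d) ≡ (a + c) + (b + d)
    lem = solve-∀

  sumFin≤sumFinℤ : ∀ {n} {a : Fin n → ℕ} {b : Fin n → ℤ} → (∀ i → + a i ≤ b i) → + sumFin a ≤ sumFinℤ b
  sumFin≤sumFinℤ {zero}  l = ≤-refl
  sumFin≤sumFinℤ {suc n} l = +-mono-≤ (l zero) (sumFin≤sumFinℤ (λ i → l (suc i)))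

  energy≡ : ∀ {n} (f : Fn n) → sumFinℤ (λ i → sum (sq (D i f))) ≡ energy f
  energy≡ {zero}  f = refl
  energy≡ {suc n} f = cong₂ _+_ (lem (sum (sq (∂ f))))
    (trans (sumFinℤ-+ (λ i → sum (sq (D i (λ x → f (false ∷ x))))) (λ i → sum (sq (D i (λ x → f (true ∷ x))))))
           (cong₂ _+_ (energy≡ (λ x → f (false ∷ x))) (energy≡ (λ x → f (true ∷ x)))))
    where
    lem : ∀ a → a + a ≡ + 2 * a
    lem = solve-∀

  -- The sum over the relevant variables i of 2 ^ (- deg (D i f)), scaled by 2 ^ n.
  totalWeight : ∀ {n} → Fn n → ℕ
  totalWeight f = sumFin (λ i → weight (D i f))

  bit : ∀ {n} → (Vertex n → Bool) → Fn n
  bit f x = val (f x)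

  -- Weight is at most support, and support at most the sum of squares, so the energy bounds the
  -- total. Parseval is applied to the sign function 1 - 2 f, whose squares sum to exactly `2 ^ n`;
  -- the factor 4 in its energy cancels the 4 in `energy-bound`.
  influence-bound : ∀ {n d} (f : Vertex n → Bool) → Deg< (suc d) (bit f) → totalWeight (bit f) ℕ.≤ d ℕ.* 2 ℕ.^ n
  influence-bound {n} {d} f p = drop‿+≤+ (begin
    + totalWeight (bit f)                          ≤⟨ sumFin≤sumFinℤ (λ i → ≤-trans (+≤+ (weight≤support (D i (bit f)))) (support≤sum-sq (D i (bit f)))) ⟩
    sumFinℤ (λ i → sum (sq (D i (bit f))))         ≡⟨ energy≡ (bit f) ⟩
    energy (bit f)                                 ≤⟨ *-cancelˡ-≤-pos _ _ (+ 4) signed ⟩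
    + d * + (2 ℕ.^ n)                              ≡⟨ pos-* d (2 ℕ.^ n) ⟨
    + (d ℕ.* 2 ℕ.^ n)                              ∎)
    where
    open ≤-Reasoning
    F : Fn n
    F x = 1ℤ + - + 2 * bit f x
    F² : ∀ x → F x * F x ≡ 1ℤ
    F² x with f x
    ... | false = refl
    ... | true  = refl
    signed : + 4 * energy (bit f) ≤ + 4 * (+ d * + (2 ℕ.^ n))
    signed = begin
      + 4 * energy (bit f)            ≡⟨ energy-affine 1ℤ (- + 2) (bit f) ⟨
      energy F                        ≤⟨ energy-bound n (Deg<-+ (Deg<-const d 1ℤ) (Deg<-scale (- + 2) p)) ⟩
      + 4 * + d * sum (sq F)          ≡⟨ cong (+ 4 * + d *_) (trans (sum-ext F²) (sum-one n)) ⟩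
      + 4 * + d * + (2 ℕ.^ n)         ≡⟨ *-assoc (+ 4) (+ d) (+ (2 ℕ.^ n)) ⟩
      + 4 * (+ d * + (2 ℕ.^ n))       ∎

  laplacian : ∀ {n} → Fn n → Fn n
  laplacian f []      = 0ℤ
  laplacian f (a ∷ x) = f (a ∷ x) - f (not a ∷ x) + laplacian (λ y → f (a ∷ y)) x

  laplacian-+ : ∀ {n} (f g : Fn n) x → laplacian (λ y → f y + g y) x ≡ laplacian f x + laplacian g x
  laplacian-+ f g []      = refl
  laplacian-+ f g (a ∷ x) rewrite laplacian-+ (λ y → f (a ∷ y)) (λ y → g (a ∷ y)) x =
    lem (f (a ∷ x)) (f (not a ∷ x)) (g (a ∷ x)) (g (not a ∷ x)) _ _
    where
    lem : ∀ a b c d l m → (a + c) - (b + d) + (l + m) ≡ (a - b + l) + (c - d + m)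
    lem = solve-∀

  laplacian-- : ∀ {n} (f g : Fn n) x → laplacian (λ y → f y - g y) x ≡ laplacian f x - laplacian g x
  laplacian-- f g []      = refl
  laplacian-- f g (a ∷ x) rewrite laplacian-- (λ y → f (a ∷ y)) (λ y → g (a ∷ y)) x =
    lem (f (a ∷ x)) (f (not a ∷ x)) (g (a ∷ x)) (g (not a ∷ x)) _ _
    where
    lem : ∀ a b c d l m → (a - c) - (b - d) + (l - m) ≡ (a - b + l) - (c - d + m)
    lem = solve-∀

  module _ {n : ℕ} (f : Fn (suc n)) (μ : ℤ) (eigen : ∀ x → laplacian f x ≡ μ * f x) where
    private
      f₀ f₁ : Fn n
      f₀ x = f (false ∷ x)
      f₁ x = f (true ∷ x)
      lap₀ : ∀ x → laplacian f₀ x ≡ μ * f₀ x - (f₀ x - f₁ x)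
      lap₀ x = trans (lem (f₀ x - f₁ x) (laplacian f₀ x)) (cong (_- (f₀ x - f₁ x)) (eigen (false ∷ x)))
        where
        lem : ∀ a l → l ≡ a + l - a
        lem = solve-∀
      lap₁ : ∀ x → laplacian f₁ x ≡ μ * f₁ x - (f₁ x - f₀ x)
      lap₁ x = trans (lem (f₁ x - f₀ x) (laplacian f₁ x)) (cong (_- (f₁ x - f₀ x)) (eigen (true ∷ x)))
        where
        lem : ∀ a l → l ≡ a + l - a
        lem = solve-∀

    eigen-sum : ∀ x → laplacian (λ y → f₀ y + f₁ y) x ≡ μ * (f₀ x + f₁ x)
    eigen-sum x = trans (laplacian-+ f₀ f₁ x) (trans (cong₂ _+_ (lap₀ x) (lap₁ x)) (lem μ (f₀ x) (f₁ x)))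
      where
      lem : ∀ m a b → (m * a - (a - b)) + (m * b - (b - a)) ≡ m * (a + b)
      lem = solve-∀

    eigen-difference : ∀ x → laplacian (∂ f) x ≡ (μ - + 2) * ∂ f x
    eigen-difference x = trans (laplacian-- f₁ f₀ x) (trans (cong₂ _-_ (lap₁ x) (lap₀ x)) (lem μ (f₀ x) (f₁ x)))
      where
      lem : ∀ m a b → (m * b - (b - a)) - (m * a - (a - b)) ≡ (m - + 2) * (b - a)
      lem = solve-∀

    halves : ∀ x → + 2 * f₀ x ≡ (f₀ x + f₁ x) + - 1ℤ * ∂ f x
    halves x = lem (f₀ x) (f₁ x)
      where
      lem : ∀ a b → + 2 * a ≡ (a + b) + - 1ℤ * (b - a)
      lem = solve-∀

  -- The sum of the two halves has the same negative eigenvalue and their difference one that is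
  -- smaller by 2, so both vanish by induction on the dimension.
  negative-eigen : ∀ n c (f : Fn n) → (∀ x → laplacian f x ≡ - (+ 2 * + suc c) * f x) → ∀ x → f x ≡ 0ℤ
  negative-eigen zero c f eigen [] =
    *-cancelˡ-≡ (- (+ 2 * + suc c)) (f []) 0ℤ (trans (sym (eigen [])) (sym (*-zeroʳ (- (+ 2 * + suc c)))))
  negative-eigen (suc n) c f eigen = λ { (false ∷ x) → f₀≡0 x ; (true ∷ x) → trans (i-j≡0⇒i≡j _ _ (∂≡0 x)) (f₀≡0 x) }
    where
    μ = - (+ 2 * + suc c)
    lem : ∀ c → - (+ 2 * c) - + 2 ≡ - (+ 2 * (1ℤ + c))
    lem = solve-∀
    ∂≡0 : ∀ x → ∂ f x ≡ 0ℤ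
    ∂≡0 = negative-eigen n (suc c) (∂ f) (λ x → trans (eigen-difference f μ eigen x) (cong (_* ∂ f x) (lem (+ suc c))))
    sum≡0 : ∀ x → f (false ∷ x) + f (true ∷ x) ≡ 0ℤ
    sum≡0 = negative-eigen n c _ (eigen-sum f μ eigen)
    f₀≡0 : ∀ x → f (false ∷ x) ≡ 0ℤ
    f₀≡0 x = *-cancelˡ-≡ (+ 2) (f (false ∷ x)) 0ℤ
      (trans (halves f μ eigen x) (cong₂ (λ a b → a + - 1ℤ * b) (sum≡0 x) (∂≡0 x)))

  -- Lowering the eigenvalue by 2 in the difference of the halves matches the degree lost by `∂`;
  -- the sum of the halves keeps `k`, and `halves` recovers twice the false half from both.
  eigen-degree : ∀ n k (f : Fn n) → (∀ x → laplacian f x ≡ + 2 * + k * f x) → Deg< (suc k) f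
  eigen-degree zero    k f eigen = point
  eigen-degree (suc n) k f eigen = split
    (Deg<-cancel (+ 2) (Deg<-ext (λ x → sym (halves f μ eigen x)) (Deg<-+ sum-deg (Deg<-scale (- 1ℤ) (Deg<-suc ∂-deg)))))
    ∂-deg
    where
    μ = + 2 * + k
    sum-deg : Deg< (suc k) (λ x → f (false ∷ x) + f (true ∷ x))
    sum-deg = eigen-degree n k _ (eigen-sum f μ eigen)
    lem : ∀ k → + 2 * (1ℤ + k) - + 2 ≡ + 2 * k
    lem = solve-∀
    difference : ∀ k → (∀ x → laplacian (∂ f) x ≡ (+ 2 * + k - + 2) * ∂ f x) → Deg< k (∂ f)
    -- For `k = 0` the derivative would have eigenvalue -2.
    difference zero    e = null (negative-eigen n 0 (∂ f) e)
    difference (suc k) e = eigen-degree n k (∂ f) (λ x → trans (e x) (cong (_* ∂ f x) (lem (+ k))))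
    ∂-deg : Deg< k (∂ f)
    ∂-deg = difference k (eigen-difference f μ eigen)


-- Symmetrization, sensitive blocks, and restriction by a top monomial

module BlockSensitivity where

  open import Defs using (Vertex)
  open Polynomials
  open MultilinearDegree
  open Automorphisms using (origin)
  open Weights
  open import Data.Bool using (Bool; true; false; not; if_then_else_)
  import Data.Bool.Properties as Bₚ
  open import Data.Nat as ℕ using (ℕ; zero; suc; z≤n; s≤s; _!)
  import Data.Nat.Properties as ℕₚ
  import Data.Nat.Tactic.RingSolver as ℕ-Ring
  open import Data.Integer hiding (suc)
  open import Data.Integer.Properties
  open import Data.Integer.Tactic.RingSolver using (solve-∀)
  open import Data.Fin using (Fin; zero; suc)
  open import Data.Vec using ([]; _∷_; Vec; lookup; _[_]≔_)
  open import Data.Product using (Σ; _×_; _,_)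
  open import Data.Sum using (_⊎_; inj₁; inj₂)
  open import Data.Empty using (⊥; ⊥-elim)
  open import Data.Unit using (⊤; tt)
  open import Relation.Binary.PropositionalEquality
  open import Relation.Nullary using (yes; no; ¬_)

  -- symmetrize r h j is r ! times the average of h over the vertices with j coordinates true.
  symmetrize : ∀ r → Fn r → ℕ → ℤ
  symmetrize zero    h j = h []
  symmetrize (suc r) h j =
    (+ suc r - + j) * symmetrize r (λ t → h (false ∷ t)) j + up (symmetrize r (λ t → h (true ∷ t))) j

  up-+ : ∀ {u v w} → (∀ j → w j ≡ u j + v j) → ∀ j → up w j ≡ up u j + up v j
  up-+ e zero    = refl
  up-+ {u} {v} e (suc j) = trans (cong (+ suc j *_) (e j)) (*-distribˡ-+ (+ suc j) (u j) (v j))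

  symmetrize-+ : ∀ r {f g h : Fn r} → (∀ t → h t ≡ f t + g t) →
                 ∀ j → symmetrize r h j ≡ symmetrize r f j + symmetrize r g j
  symmetrize-+ zero    e j = e []
  symmetrize-+ (suc r) {f} {g} {h} e j = trans
    (cong₂ (λ a b → (+ suc r - + j) * a + b)
      (symmetrize-+ r {λ t → f (false ∷ t)} {λ t → g (false ∷ t)} (λ t → e (false ∷ t)) j)
      (up-+ {symmetrize r (λ t → f (true ∷ t))} {symmetrize r (λ t → g (true ∷ t))}
        (symmetrize-+ r (λ t → e (true ∷ t))) j))
    (lem (+ suc r - + j) (symmetrize r (λ t → f (false ∷ t)) j) (symmetrize r (λ t → g (false ∷ t)) j)
         (up (symmetrize r (λ t → f (true ∷ t))) j) (up (symmetrize r (λ t → g (true ∷ t))) j))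
    where
    lem : ∀ c a b x y → c * (a + b) + (x + y) ≡ (c * a + x) + (c * b + y)
    lem = solve-∀

  Poly<-zero : ∀ d {u} → (∀ j → u j ≡ 0ℤ) → Poly< d u
  Poly<-zero zero    p = p
  Poly<-zero (suc d) p = (λ _ → 0ℤ) , Poly<-zero d (λ _ → refl) ,
    λ j → trans (p (suc j)) (sym (cong₂ _+_ (p 0) (*-zeroʳ (+ suc j))))

  symmetrize-zero : ∀ r {h : Fn r} → (∀ t → h t ≡ 0ℤ) → ∀ j → symmetrize r h j ≡ 0ℤ
  symmetrize-zero zero    p j = p []
  symmetrize-zero (suc r) {h} p j = cong₂ _+_
    (trans (cong ((+ suc r - + j) *_) (symmetrize-zero r (λ t → p (false ∷ t)) j)) (*-zeroʳ (+ suc r - + j)))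
    (up-zero j)
    where
    up-zero : ∀ j → up (symmetrize r (λ t → h (true ∷ t))) j ≡ 0ℤ
    up-zero zero    = refl
    up-zero (suc j) = trans (cong (+ suc j *_) (symmetrize-zero r (λ t → p (true ∷ t)) j)) (*-zeroʳ (+ suc j))

  -- Writing the true half as the false half plus `∂ h`, the recursion becomes a `Poly<-mix` of the
  -- false half, which keeps the degree, and `up` of the symmetrized `∂ h`, which has one degree to
  -- spare.
  symmetrize-poly : ∀ {d r} {h : Fn r} → Deg< d h → Poly< d (symmetrize r h)
  symmetrize-poly {r = r} (null p) = symmetrize-zero r p
  symmetrize-poly {suc d} {h = h} point =
    (λ _ → 0ℤ) , Poly<-zero d (λ _ → refl) ,
    λ j → sym (trans (cong (λ z → h [] + z) (*-zeroʳ (+ suc j))) (+-identityʳ (h [])))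
  symmetrize-poly {suc d} {suc r} {h} (split a b) =
    Poly<-ext (suc d) eq
      (Poly<-+ (suc d) {u = λ j → (+ suc r - + j) * symmetrize r h₀ j + up (symmetrize r h₀) j} {up (symmetrize r (∂ h))}
        (Poly<-mix (suc d) (+ suc r) {symmetrize r h₀} (symmetrize-poly a))
        (Poly<-up d {symmetrize r (∂ h)} (symmetrize-poly b)))
    where
    h₀ = λ t → h (false ∷ t)
    h₁ = λ t → h (true ∷ t)
    lem : ∀ a b → b ≡ a + (b - a)
    lem = solve-∀
    eq : ∀ j → (+ suc r - + j) * symmetrize r h₀ j + up (symmetrize r h₀) j + up (symmetrize r (∂ h)) j
       ≡ (+ suc r - + j) * symmetrize r h₀ j + up (symmetrize r h₁) j
    eq j = trans (+-assoc ((+ suc r - + j) * symmetrize r h₀ j) (up (symmetrize r h₀) j) (up (symmetrize r (∂ h)) j))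
      (cong (λ z → (+ suc r - + j) * symmetrize r h₀ j + z)
        (sym (up-+ {symmetrize r h₀} {symmetrize r (∂ h)} (symmetrize-+ r {h₀} {∂ h} (λ t → lem (h₀ t) (h₁ t))) j)))

  -- Every one of the r coordinates is sensitive at the origin.
  Sensitive : ∀ r → (Vertex r → Bool) → Set
  Sensitive zero    h = ⊤
  Sensitive (suc r) h = h (true ∷ origin) ≢ h origin × Sensitive r (λ t → h (false ∷ t))

  Sensitive-ext : ∀ r {g h : Vertex r → Bool} → (∀ t → g t ≡ h t) → Sensitive r g → Sensitive r h
  Sensitive-ext zero    e s       = tt
  Sensitive-ext (suc r) e (n , s) =
    (λ eq → n (trans (e _) (trans eq (sym (e _))))) , Sensitive-ext r (λ t → e (false ∷ t)) s

  symmetrize-bound : ∀ r (h : Vertex r → Bool) j → j ℕ.≤ r → Σ ℕ λ m → symmetrize r (bit h) j ≡ + m × m ℕ.≤ r !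
  symmetrize-bound zero h j l with h []
  ... | false = 0 , refl , z≤n
  ... | true  = 1 , refl , s≤s z≤n
  symmetrize-bound (suc r) h j l =
    let a , ea , la = lower (ℕₚ.m≤n⇒m<n∨m≡n l)
        b , eb , lb = upper j l
    in a ℕ.+ b , cong₂ _+_ ea eb , ℕₚ.≤-trans (ℕₚ.+-mono-≤ la lb) (ℕₚ.≤-reflexive total≡)
    where
    c = suc r ℕ.∸ j
    total≡ : c ℕ.* r ! ℕ.+ j ℕ.* r ! ≡ suc r !
    total≡ = trans (sym (ℕₚ.*-distribʳ-+ (r !) c j)) (cong (ℕ._* r !) (ℕₚ.m∸n+n≡m l))
    c≡ : + suc r - + j ≡ + c
    c≡ = trans (m-n≡m⊖n (suc r) j) (⊖-≥ l)
    lower : j ℕ.< suc r ⊎ j ≡ suc r →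
            Σ ℕ λ a → (+ suc r - + j) * symmetrize r (λ t → val (h (false ∷ t))) j ≡ + a × a ℕ.≤ c ℕ.* r !
    lower (inj₁ (s≤s j≤r)) =
      let m , e , m≤ = symmetrize-bound r (λ t → h (false ∷ t)) j j≤r
      in c ℕ.* m , trans (cong₂ _*_ c≡ e) (sym (pos-* c m)) , ℕₚ.*-monoʳ-≤ c m≤
    lower (inj₂ refl) = 0 , trans (cong (_* S) (+-inverseʳ (+ suc r))) (*-zeroˡ S) , z≤n
      where S = symmetrize r (λ t → val (h (false ∷ t))) j
    upper : ∀ j → j ℕ.≤ suc r →
            Σ ℕ λ b → up (symmetrize r (λ t → val (h (true ∷ t)))) j ≡ + b × b ℕ.≤ j ℕ.* r !
    upper zero    _       = 0 , refl , z≤n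
    upper (suc j) (s≤s l) =
      let m , e , m≤ = symmetrize-bound r (λ t → h (true ∷ t)) j l
      in suc j ℕ.* m , trans (cong (+ suc j *_) e) (sym (pos-* (suc j) m)) , ℕₚ.*-monoʳ-≤ (suc j) m≤

  symmetrize-0 : ∀ r (h : Fn r) → symmetrize r h 0 ≡ + (r !) * h origin
  symmetrize-0 zero    h = sym (*-identityˡ (h []))
  symmetrize-0 (suc r) h = begin
    (+ suc r - 0ℤ) * symmetrize r (λ t → h (false ∷ t)) 0 + 0ℤ   ≡⟨ cong (λ z → (+ suc r - 0ℤ) * z + 0ℤ) (symmetrize-0 r _) ⟩
    (+ suc r - 0ℤ) * (+ (r !) * h origin) + 0ℤ                    ≡⟨ lem (+ suc r) (+ (r !)) (h origin) ⟩
    + suc r * + (r !) * h origin                                  ≡⟨ cong (_* h origin) (pos-* (suc r) (r !)) ⟨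
    + (suc r !) * h origin                                        ∎
    where
    open ≡-Reasoning
    lem : ∀ a b c → (a - 0ℤ) * (b * c) + 0ℤ ≡ a * b * c
    lem = solve-∀

  -- Sensitivity makes `h` true at every point with exactly one true coordinate, so the average over
  -- these points is 1.
  symmetrize-1 : ∀ r (h : Vertex (suc r) → Bool) → h origin ≡ false → Sensitive (suc r) h →
                 symmetrize (suc r) (bit h) 1 ≡ + (suc r !)
  symmetrize-1 r h h0 (n , s) = begin
    (+ suc r - 1ℤ) * symmetrize r (bit h₀) 1 + 1ℤ * symmetrize r (bit h₁) 0
      ≡⟨ cong₂ (λ a b → a + 1ℤ * b) (first r h₀ h0 s) (trans (symmetrize-0 r (bit h₁)) (cong (λ b → + (r !) * val b) h1)) ⟩
    + (r ℕ.* r !) + 1ℤ * (+ (r !) * 1ℤ)   ≡⟨ cong (λ z → + (r ℕ.* r !) + z) (trans (*-identityˡ (+ (r !) * 1ℤ)) (*-identityʳ (+ (r !)))) ⟩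
    + (r ℕ.* r ! ℕ.+ r !)                 ≡⟨ cong +_ (ℕₚ.+-comm (r ℕ.* r !) (r !)) ⟩
    + (suc r !)                           ∎
    where
    open ≡-Reasoning
    h₀ = λ t → h (false ∷ t)
    h₁ = λ t → h (true ∷ t)
    h1 : h₁ origin ≡ true
    h1 = trans (Bₚ.¬-not n) (cong not h0)
    first : ∀ r (h : Vertex r → Bool) → h origin ≡ false → Sensitive r h →
            (+ suc r - 1ℤ) * symmetrize r (bit h) 1 ≡ + (r ℕ.* r !)
    first zero    h _  _ = *-zeroˡ (bit h [])
    first (suc r) h h0 s = trans (cong (+ suc r *_) (symmetrize-1 r h h0 s)) (sym (pos-* (suc r) (suc r !)))

  SteepFree : ℕ → ℕ → Set
  SteepFree d r = ∀ {u} → Poly< (suc d) u → Steep r u → ⊥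

  sensitive-steep : ∀ {d} r (h : Vertex (suc r) → Bool) → Deg< (suc d) (bit h) → h origin ≡ false → Sensitive (suc r) h →
                    SteepFree d (suc r) → ⊥
  sensitive-steep r h p h0 s free = free (symmetrize-poly p)
    ( ℕ.pred (suc r !)
    , trans (symmetrize-0 (suc r) (bit h)) (trans (cong (λ b → + (suc r !) * val b) h0) (*-zeroʳ (+ (suc r !))))
    , trans (symmetrize-1 r h h0 s) (cong +_ (sym fact≡))
    , λ j l → let m , e , m≤ = symmetrize-bound (suc r) h j l
              in subst (0ℤ ≤_) (sym e) (+≤+ z≤n) , subst₂ _≤_ (sym e) (cong +_ (sym fact≡)) (+≤+ m≤) )
    where
    fact≡ : suc (ℕ.pred (suc r !)) ≡ suc r !
    fact≡ = ℕₚ.suc-pred (suc r !) ⦃ ℕₚ._!≢0 (suc r) ⦄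

  Deg<-not : ∀ {d n} (h : Vertex n → Bool) → Deg< (suc d) (bit h) → Deg< (suc d) (bit (λ t → not (h t)))
  Deg<-not {d} h p = Deg<-ext (λ t → lem (h t)) (Deg<-+ (Deg<-const d 1ℤ) (Deg<-scale (- 1ℤ) p))
    where
    lem : ∀ b → 1ℤ + - 1ℤ * val b ≡ val (not b)
    lem false = refl
    lem true  = refl

  Sensitive-not : ∀ r (h : Vertex r → Bool) → Sensitive r h → Sensitive r (λ t → not (h t))
  Sensitive-not zero    h s       = tt
  Sensitive-not (suc r) h (n , s) = (λ e → n (Bₚ.not-injective e)) , Sensitive-not r _ s

  sensitive-bound : ∀ {d r} → SteepFree d (suc r) → ∀ s (h : Vertex s → Bool) →
                    Deg< (suc d) (bit h) → Sensitive s h → s ℕ.≤ r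
  sensitive-bound {d} {r} free zero    h p s = z≤n
  sensitive-bound {d} {r} free (suc s) h p (n , t) with ℕₚ.m≤n⇒m<n∨m≡n (sensitive-bound free s (λ x → h (false ∷ x)) (Deg<-false p) t)
  ... | inj₁ s<r = s<r
  ... | inj₂ refl with h origin in e
  ...   | false = ⊥-elim (sensitive-steep s h p e (subst (h (true ∷ origin) ≢_) (sym e) n , t) free)
  ...   | true  = ⊥-elim (sensitive-steep s (λ x → not (h x)) (Deg<-not h p) (cong not e)
                           (Sensitive-not (suc s) h (subst (h (true ∷ origin) ≢_) (sym e) n , t)) free)

  -- r disjoint sensitive blocks: ℓs replaces every variable by a constant or by
  -- ± the parameter of the block containing it.
  Blocks : ∀ {n} → ℕ → (Vertex n → Bool) → Set
  Blocks {n} r f = Σ (Vec (Literal r) n) λ ℓs → Sensitive r (λ t → f (eval ℓs t))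

  AtMostBlocks : ∀ {n} → (Vertex n → Bool) → ℕ → Set
  AtMostBlocks f b = ∀ r → Blocks r f → r ℕ.≤ b

  blocks-bound : ∀ {d r n} → SteepFree d (suc r) → (f : Vertex n → Bool) → Deg< (suc d) (bit f) → AtMostBlocks f r
  blocks-bound free f p s (ℓs , sens) = sensitive-bound free s (λ t → f (eval ℓs t)) (Deg<-eval ℓs p) sens

  Deg<-mux : ∀ {d n} (M α : Vertex n) {g : Fn n} → Deg< d g → Deg< d (λ x → g (mux M α x))
  Deg<-mux M α (null p) = null λ x → p (mux M α x)
  Deg<-mux [] [] point = point
  Deg<-mux (false ∷ M) (_ ∷ α) (split p q) = split (Deg<-mux M α p) (Deg<-mux M α q)
  Deg<-mux (true ∷ M) (a ∷ α) {g} (split {d} p q) =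
    split (Deg<-mux M α (half a)) (Deg<-zero d (λ x → +-inverseʳ (g (a ∷ mux M α x))))
    where
    half : ∀ a → Deg< (suc d) (λ x → g (a ∷ x))
    half false = p
    half true  = Deg<-true {f = g} (split p q)

  weaken : ∀ {r} → Literal r → Literal (suc r)
  weaken (const b) = const b
  weaken (var j s) = var (suc j) s

  branch : ∀ {r} → Bool → Bool → Literal (suc r)
  branch false false = const false
  branch true  true  = const true
  -- Here the second argument is `not a`, the value of the literal at `true`.
  branch a     _     = var zero a

  -- The new block consists of the variables of `M` on which `α` and `β` differ. The old literals
  -- are overwritten on `M`, which keeps the blocks disjoint.
  extend : ∀ {r n} → Vertex n → Vertex n → Vertex n → Vec (Literal r) n → Vec (Literal (suc r)) n
  extend []          []      []      []       = []
  extend (true ∷ M)  (a ∷ α) (b ∷ β) (_ ∷ ℓs) = branch a b ∷ extend M α β ℓs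
  extend (false ∷ M) (_ ∷ α) (_ ∷ β) (ℓ ∷ ℓs) = weaken ℓ ∷ extend M α β ℓs

  eval-weaken : ∀ {r} b (t : Vertex r) ℓ → evalLit (b ∷ t) (weaken ℓ) ≡ evalLit t ℓ
  eval-weaken b t (const _) = refl
  eval-weaken b t (var _ _) = refl

  eval-branch : ∀ {r} c (t : Vertex r) a b → evalLit (c ∷ t) (branch a b) ≡ (if c then b else a)
  eval-branch false t false false = refl
  eval-branch false t false true  = refl
  eval-branch false t true  false = refl
  eval-branch false t true  true  = refl
  eval-branch true  t false false = refl
  eval-branch true  t false true  = refl
  eval-branch true  t true  false = refl
  eval-branch true  t true  true  = refl

  eval-extend : ∀ {r n} c (M α β : Vertex n) (ℓs : Vec (Literal r) n) t →
                eval (extend M α β ℓs) (c ∷ t) ≡ mux M (if c then β else α) (eval ℓs t)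
  eval-extend c [] [] [] [] t = refl
  eval-extend false (true ∷ M) (a ∷ α) (b ∷ β) (_ ∷ ℓs) t = cong₂ _∷_ (eval-branch false t a b) (eval-extend false M α β ℓs t)
  eval-extend true (true ∷ M) (a ∷ α) (b ∷ β) (_ ∷ ℓs) t  = cong₂ _∷_ (eval-branch true t a b) (eval-extend true M α β ℓs t)
  eval-extend false (false ∷ M) (a ∷ α) (b ∷ β) (ℓ ∷ ℓs) t = cong₂ _∷_ (eval-weaken false t ℓ) (eval-extend false M α β ℓs t)
  eval-extend true (false ∷ M) (a ∷ α) (b ∷ β) (ℓ ∷ ℓs) t  = cong₂ _∷_ (eval-weaken true t ℓ) (eval-extend true M α β ℓs t)

  val-injective : ∀ {a b} → val a ≡ val b → a ≡ b
  val-injective {false} {false} _ = refl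
  val-injective {true}  {true}  _ = refl

  -- A monomial of top degree contains a sensitive block at every point,
  -- so fixing its variables lowers the number of disjoint sensitive blocks.
  module _ {n : ℕ} (f : Vertex n → Bool) (M : Vertex n) (p : Deg< (suc (size M)) (bit f))
           (c≢0 : coef M (bit f) ≢ 0ℤ) (1≤M : 1 ℕ.≤ size M) where

    nonconstant : ∀ α x → Σ (Vertex n) λ β → f (mux M β x) ≢ f (mux M α x)
    nonconstant α x =
      let β , ne = ¬∀⇒∃¬ (λ β → bit f (mux M β x) ≟ bit f (mux M α x))
                     (λ h → c≢0 (coef-of-constant M _ p x h (inj₁ 1≤M)))
      in β , λ e → ne (cong val e)

    blocks-suc : ∀ α r → Blocks r (λ x → f (mux M α x)) → Blocks (suc r) f
    blocks-suc α r (ℓs , s) =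
      -- `β` is chosen against `α` at the base point of the given blocks, so the new block is
      -- sensitive there.
      let β , ne = nonconstant α (eval ℓs origin)
          ℓs′ = extend M α β ℓs
      in ℓs′ , (λ e → ne (trans (cong f (sym (eval-extend true M α β ℓs origin)))
                           (trans e (cong f (eval-extend false M α β ℓs origin)))))
             , Sensitive-ext r (λ t → cong f (sym (eval-extend false M α β ℓs t))) s

  weight-mono : ∀ {n} {g h : Fn n} → (∀ x → g x ≡ h x) → weight g ℕ.≤ weight h
  weight-mono {g = g} {h} e with degree g
  ... | vanishing _       = z≤n
  ... | exactly d l p ¬p = pow-cancel d (ℕₚ.≤-trans (ℕₚ.≤-reflexive (pow-∸ l))
    (weight-lower (λ z → ¬p (Deg<-zero d (λ x → trans (e x) (z x)))) (Deg<-ext e p)))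

  keepHead : ∀ {n} → (Vertex n → Vertex n) → Vertex (suc n) → Vertex (suc n)
  keepHead τ (a ∷ x) = a ∷ τ x

  setHead : ∀ {n} → Bool → (Vertex n → Vertex n) → Vertex (suc n) → Vertex (suc n)
  setHead b τ (_ ∷ x) = b ∷ τ x

  -- Greedy choice of an assignment α of the variables in M.
  choose : ∀ {n} (M : Vertex n) (P : (Vertex n → Vertex n) → ℕ) →
    (∀ {σ τ} → (∀ x → σ x ≡ τ x) → P σ ℕ.≤ P τ) →
    (∀ i → lookup M i ≡ true → ∀ σ → Σ Bool λ b → P σ ℕ.≤ P (λ x → σ (x [ i ]≔ b))) →
    Σ (Vertex n) λ α → P (λ x → x) ℕ.≤ P (mux M α)
  choose [] P ext step = [] , ext λ { [] → refl }
  choose (false ∷ M) P ext step =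
    let α , l = choose M (λ τ → P (keepHead τ))
                  (λ e → ext λ { (a ∷ x) → cong (a ∷_) (e x) })
                  (λ i m τ → let b , l = step (suc i) m (keepHead τ)
                             in b , ℕₚ.≤-trans l (ext λ { (a ∷ x) → refl }))
    in false ∷ α , ℕₚ.≤-trans (ext λ { (a ∷ x) → refl }) (ℕₚ.≤-trans l (ext λ { (a ∷ x) → refl }))
  choose (true ∷ M) P ext step =
    let b , l₀ = step zero refl (λ x → x)
        α , l  = choose M (λ τ → P (setHead b τ))
                   (λ e → ext λ { (a ∷ x) → cong (b ∷_) (e x) })
                   (λ i m τ → let b′ , l = step (suc i) m (setHead b τ)
                              in b′ , ℕₚ.≤-trans l (ext λ { (a ∷ x) → refl }))
    in b ∷ α , ℕₚ.≤-trans l₀ (ℕₚ.≤-trans (ext λ { (a ∷ x) → refl }) (ℕₚ.≤-trans l (ext λ { (a ∷ x) → refl })))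

  inside outside : ∀ {n} → Vertex n → Fn n → Fin n → ℕ
  inside  M g i = if lookup M i then weight (D i g) else 0
  outside M g i = if lookup M i then 0 else weight (D i g)

  inside+outside : ∀ {n} (M : Vertex n) (g : Fn n) → totalWeight g ≡ sumFin (inside M g) ℕ.+ sumFin (outside M g)
  inside+outside M g = trans (sumFin-ext (λ i → lem (lookup M i) (weight (D i g)))) (sumFin-+ (inside M g) (outside M g))
    where
    lem : ∀ b w → w ≡ (if b then w else 0) ℕ.+ (if b then 0 else w)
    lem true  w = sym (ℕₚ.+-identityʳ w)
    lem false w = refl

  outside≤total : ∀ {n} (M : Vertex n) (g : Fn n) → sumFin (outside M g) ℕ.≤ totalWeight g
  outside≤total M g = sumFin-mono (λ i → lem (lookup M i) (weight (D i g)))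
    where
    lem : ∀ b w → (if b then 0 else w) ℕ.≤ w
    lem true  w = z≤n
    lem false w = ℕₚ.≤-refl

  sumFin-size : ∀ {n} (M : Vertex n) C → sumFin (λ i → if lookup M i then C else 0) ≡ size M ℕ.* C
  sumFin-size []          C = refl
  sumFin-size (true ∷ M)  C = cong (C ℕ.+_) (sumFin-size M C)
  sumFin-size (false ∷ M) C = sumFin-size M C

  sumFin-*ʳ : ∀ {n} (a : Fin n → ℕ) c → sumFin a ℕ.* c ≡ sumFin (λ i → a i ℕ.* c)
  sumFin-*ʳ {zero}  a c = refl
  sumFin-*ʳ {suc n} a c = trans (ℕₚ.*-distribʳ-+ c (a zero) _) (cong (a zero ℕ.* c ℕ.+_) (sumFin-*ʳ (λ i → a (suc i)) c))

  -- For `i` in `M` the derivative keeps the monomial `M` without `i`, with the same nonzero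
  -- coefficient. Its degree is therefore at least `size M` minus one, and its weight
  -- correspondingly small.
  inside-bound : ∀ {n} (M : Vertex n) (g : Fn n) → coef M g ≢ 0ℤ →
                 sumFin (inside M g) ℕ.* 2 ℕ.^ size M ℕ.≤ size M ℕ.* 2 ℕ.^ suc n
  inside-bound {n} M g c≢0 = ℕₚ.≤-trans (ℕₚ.≤-reflexive (sumFin-*ʳ (inside M g) (2 ℕ.^ size M)))
    (ℕₚ.≤-trans (sumFin-mono bound) (ℕₚ.≤-reflexive (sumFin-size M (2 ℕ.^ suc n))))
    where
    bound : ∀ i → inside M g i ℕ.* 2 ℕ.^ size M ℕ.≤ (if lookup M i then 2 ℕ.^ suc n else 0)
    bound i with lookup M i in e
    ... | false = z≤n
    ... | true  = begin
      weight (D i g) ℕ.* 2 ℕ.^ size M            ≡⟨ cong (λ s → weight (D i g) ℕ.* 2 ℕ.^ s) (size-remove M i e) ⟩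
      weight (D i g) ℕ.* (2 ℕ.* 2 ℕ.^ size M′)   ≡⟨ lem (weight (D i g)) (2 ℕ.^ size M′) ⟩
      2 ℕ.* (weight (D i g) ℕ.* 2 ℕ.^ size M′)   ≤⟨ ℕₚ.*-monoʳ-≤ 2 (weight-upper λ q → c≢0 (trans (coef-D M i e) (coef-vanishes M′ q ℕₚ.≤-refl))) ⟩
      2 ℕ.^ suc n                                ∎
      where
      open ℕₚ.≤-Reasoning
      M′ = M [ i ]≔ false
      lem : ∀ a b → a ℕ.* (2 ℕ.* b) ≡ 2 ℕ.* (a ℕ.* b)
      lem = ℕ-Ring.solve-∀

  set-comm : ∀ {n} (x : Vertex n) i j a b → i ≢ j → (x [ i ]≔ a) [ j ]≔ b ≡ (x [ j ]≔ b) [ i ]≔ a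
  set-comm (c ∷ x) zero    zero    a b ne = ⊥-elim (ne refl)
  set-comm (c ∷ x) zero    (suc j) a b ne = refl
  set-comm (c ∷ x) (suc i) zero    a b ne = refl
  set-comm (c ∷ x) (suc i) (suc j) a b ne = cong (c ∷_) (set-comm x i j a b λ e → ne (cong suc e))

  -- A variable `j` outside `M` differs from `i`, so `D j` commutes with fixing `i`, and
  -- `weight-fix` applies to each summand. One of the two values of `i` thus preserves the outside
  -- weight.
  outside-fix : ∀ {n} (M : Vertex n) (g : Fn n) i → lookup M i ≡ true →
    2 ℕ.* sumFin (outside M g) ℕ.≤ sumFin (outside M (fix i false g)) ℕ.+ sumFin (outside M (fix i true g))
  outside-fix M g i e = begin
    2 ℕ.* sumFin (outside M g)                          ≡⟨ cong (sumFin (outside M g) ℕ.+_) (ℕₚ.+-identityʳ _) ⟩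
    sumFin (outside M g) ℕ.+ sumFin (outside M g)       ≡⟨ sumFin-+ (outside M g) (outside M g) ⟨
    sumFin (λ j → outside M g j ℕ.+ outside M g j)      ≤⟨ sumFin-mono each ⟩
    sumFin (λ j → outside M (fix i false g) j ℕ.+ outside M (fix i true g) j)
      ≡⟨ sumFin-+ (outside M (fix i false g)) (outside M (fix i true g)) ⟩
    sumFin (outside M (fix i false g)) ℕ.+ sumFin (outside M (fix i true g)) ∎
    where
    open ℕₚ.≤-Reasoning
    each : ∀ j → outside M g j ℕ.+ outside M g j ℕ.≤ outside M (fix i false g) j ℕ.+ outside M (fix i true g) j
    each j with lookup M j in e′
    ... | true  = z≤n
    ... | false = begin
      weight (D j g) ℕ.+ weight (D j g)       ≡⟨ cong (weight (D j g) ℕ.+_) (ℕₚ.+-identityʳ _) ⟨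
      2 ℕ.* weight (D j g)                    ≤⟨ weight-fix i (D j g) ⟩
      weight (fix i false (D j g)) ℕ.+ weight (fix i true (D j g))
        ≤⟨ ℕₚ.+-mono-≤ (weight-mono (commute false)) (weight-mono (commute true)) ⟩
      weight (D j (fix i false g)) ℕ.+ weight (D j (fix i true g)) ∎
      where
      i≢j : i ≢ j
      i≢j refl with trans (sym e) e′
      ... | ()
      commute : ∀ b x → fix i b (D j g) x ≡ D j (fix i b g) x
      commute b x = cong₂ (λ y z → g y - g z) (set-comm x i j b true i≢j) (set-comm x i j b false i≢j)

  2a≤b+c : ∀ a b c → 2 ℕ.* a ℕ.≤ b ℕ.+ c → a ℕ.≤ b ⊎ a ℕ.≤ c
  2a≤b+c a b c l with a ℕ.≤? b | a ℕ.≤? c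
  ... | yes p | _     = inj₁ p
  ... | _     | yes q = inj₂ q
  ... | no ¬p | no ¬q = ⊥-elim (ℕₚ.<⇒≱ (ℕₚ.+-mono-< (ℕₚ.≰⇒> ¬p) (ℕₚ.≰⇒> ¬q))
                               (subst (ℕ._≤ b ℕ.+ c) (cong (a ℕ.+_) (ℕₚ.+-identityʳ a)) l))

  restriction : ∀ {n} (M : Vertex n) (g : Fn n) →
    Σ (Vertex n) λ α → sumFin (outside M g) ℕ.≤ totalWeight (λ x → g (mux M α x))
  restriction M g =
    let α , l = choose M (λ σ → sumFin (outside M (λ x → g (σ x)))) ext step
    in α , ℕₚ.≤-trans l (outside≤total M (λ x → g (mux M α x)))
    where
    ext : ∀ {σ τ : Vertex _ → Vertex _} → (∀ x → σ x ≡ τ x) →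
          sumFin (outside M (λ x → g (σ x))) ℕ.≤ sumFin (outside M (λ x → g (τ x)))
    ext {σ} {τ} e = sumFin-mono each
      where
      each : ∀ i → outside M (λ x → g (σ x)) i ℕ.≤ outside M (λ x → g (τ x)) i
      each i with lookup M i
      ... | true  = z≤n
      ... | false = weight-mono (λ x → cong₂ (λ y z → g y - g z) (e (x [ i ]≔ true)) (e (x [ i ]≔ false)))
    step : ∀ i → lookup M i ≡ true → ∀ σ → Σ Bool λ b →
           sumFin (outside M (λ x → g (σ x))) ℕ.≤ sumFin (outside M (λ x → g (σ (x [ i ]≔ b))))
    step i m σ with 2a≤b+c _ _ _ (outside-fix M (λ x → g (σ x)) i m)
    ... | inj₁ l = false , l
    ... | inj₂ l = true , l

  module _ {n : ℕ} (f : Vertex n → Bool) (M : Vertex n) (p : Deg< (suc (size M)) (bit f))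
           (c≢0 : coef M (bit f) ≢ 0ℤ) where

    weight-drop : Σ (Vertex n) λ α → 2 ℕ.^ size M ℕ.* totalWeight (bit f)
                  ℕ.≤ size M ℕ.* 2 ℕ.^ suc n ℕ.+ 2 ℕ.^ size M ℕ.* totalWeight (bit (λ x → f (mux M α x)))
    weight-drop =
      let α , l = restriction M (bit f) in α , (begin
        2 ℕ.^ size M ℕ.* totalWeight (bit f)
          ≡⟨ cong (2 ℕ.^ size M ℕ.*_) (inside+outside M (bit f)) ⟩
        2 ℕ.^ size M ℕ.* (sumFin (inside M (bit f)) ℕ.+ sumFin (outside M (bit f)))
          ≡⟨ lem (2 ℕ.^ size M) (sumFin (inside M (bit f))) (sumFin (outside M (bit f))) ⟩
        sumFin (inside M (bit f)) ℕ.* 2 ℕ.^ size M ℕ.+ 2 ℕ.^ size M ℕ.* sumFin (outside M (bit f))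
          ≤⟨ ℕₚ.+-mono-≤ (inside-bound M (bit f) c≢0) (ℕₚ.*-monoʳ-≤ (2 ℕ.^ size M) l) ⟩
        size M ℕ.* 2 ℕ.^ suc n ℕ.+ 2 ℕ.^ size M ℕ.* totalWeight (bit (λ x → f (mux M α x))) ∎)
      where
      open ℕₚ.≤-Reasoning
      lem : ∀ a b c → a ℕ.* (b ℕ.+ c) ≡ b ℕ.* a ℕ.+ a ℕ.* c
      lem = ℕ-Ring.solve-∀


-- Recursion over the degree and the bound on relevant variables

module RelevantVariables where

  open import Defs using (Vertex)
  open Polynomials
  open SteepPolynomials using (no-steep)
  open MultilinearDegree
  open Weights
  open BlockSensitivity
  open import Data.Bool using (Bool; false)
  open import Data.Nat
  open import Data.Nat.Properties
  open import Data.Nat.Tactic.RingSolver using (solve-∀)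
  import Data.Integer as ℤ
  import Data.Vec as Vec
  open import Data.Fin using (Fin; zero; suc)
  open import Data.List using (List; []; _∷_)
  open import Data.Product using (Σ; _×_; _,_; proj₁; proj₂)
  open import Data.Sum using (inj₁; inj₂; [_,_]′)
  open import Data.Empty using (⊥-elim)
  open import Data.Unit using (⊤; tt)
  open import Relation.Binary.PropositionalEquality
  open import Relation.Nullary using (Dec; yes; ¬_)
  open import Relation.Nullary.Decidable using (toWitness; True; _×-dec_)

  -- With W = totalWeight / 2 ^ (n + 1) this is W ≤ d 2 ^ (- d) b + 2 ^ (- d) κ,
  -- whenever the degree is at most e and there are at most b disjoint sensitive blocks.
  record Linear (e d κ : ℕ) : Set where
    constructor linear
    field
      bound : ∀ {n} (f : Vertex n → Bool) b → Deg< (suc e) (bit f) → AtMostBlocks f b →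
              2 ^ d * totalWeight (bit f) ≤ 2 ^ suc n * (d * b + κ)

  open Linear

  -- While the degree is `suc d`, fixing a top monomial costs `suc d` in scaled weight, which the
  -- slope of the linear bound pays by the loss of one block. The number of blocks limits the
  -- rounds.
  linear-raise : ∀ d {κ} → Linear d (suc d) κ → Linear (suc d) (suc d) κ
  linear-raise d {κ} low = linear go
    where
    go : ∀ {n} (f : Vertex n → Bool) b → Deg< (2 + d) (bit f) → AtMostBlocks f b →
         2 ^ suc d * totalWeight (bit f) ≤ 2 ^ suc n * (suc d * b + κ)
    go {n} f b p bs with top-monomial p
    ... | inj₁ q              = bound low f b q bs
    ... | inj₂ (M , e , c≢0) = round b bs
      where
      p′ : Deg< (suc (size M)) (bit f)
      p′ = subst (λ s → Deg< (suc s) (bit f)) (sym e) p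
      drop : Σ (Vertex n) λ α → 2 ^ suc d * totalWeight (bit f)
             ≤ suc d * 2 ^ suc n + 2 ^ suc d * totalWeight (bit (λ x → f (mux M α x)))
      drop = subst (λ s → Σ (Vertex n) λ α → 2 ^ s * totalWeight (bit f)
               ≤ s * 2 ^ suc n + 2 ^ s * totalWeight (bit (λ x → f (mux M α x)))) e (weight-drop f M p′ c≢0)
      α = proj₁ drop
      f′ : Vertex n → Bool
      f′ x = f (mux M α x)
      one-more : ∀ r → Blocks r f′ → Blocks (suc r) f
      one-more = blocks-suc f M p′ c≢0 (subst (1 ≤_) (sym e) (s≤s z≤n)) α
      round : ∀ b → AtMostBlocks f b → 2 ^ suc d * totalWeight (bit f) ≤ 2 ^ suc n * (suc d * b + κ)
      -- The top monomial itself supplies one block, so `f` cannot be without blocks.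
      round zero    bs = ⊥-elim (1+n≰n (bs 1 (one-more 0 (Vec.replicate n (const false) , tt))))
      round (suc b) bs = begin
        2 ^ suc d * totalWeight (bit f)                              ≤⟨ proj₂ drop ⟩
        suc d * 2 ^ suc n + 2 ^ suc d * totalWeight (bit f′)
          ≤⟨ +-monoʳ-≤ (suc d * 2 ^ suc n)
               (go f′ b (Deg<-mux M α p) (λ r B → s≤s⁻¹ (bs (suc r) (one-more r B)))) ⟩
        suc d * 2 ^ suc n + 2 ^ suc n * (suc d * b + κ)              ≡⟨ lem (suc d) (2 ^ suc n) b κ ⟩
        2 ^ suc n * (suc d * suc b + κ)                              ∎
        where
        open ≤-Reasoning
        lem : ∀ d N b κ → d * N + N * (d * b + κ) ≡ N * (d * (1 + b) + κ)
        lem = solve-∀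

  module _ {d κ : ℕ} (lin : Linear (suc d) (suc d) κ) where

    linear-below : ∀ {n} (f : Vertex n → Bool) b c {κ′} → Deg< (2 + d) (bit f) → AtMostBlocks f b →
      b ≤ c → d * c + 2 * κ ≤ κ′ → 2 ^ (2 + d) * totalWeight (bit f) ≤ 2 ^ suc n * ((2 + d) * b + κ′)
    linear-below {n} f b c {κ′} p bs b≤c h = begin
      2 * 2 ^ suc d * totalWeight (bit f)         ≡⟨ *-assoc 2 (2 ^ suc d) _ ⟩
      2 * (2 ^ suc d * totalWeight (bit f))       ≤⟨ *-monoʳ-≤ 2 (bound lin f b p bs) ⟩
      2 * (2 ^ suc n * (suc d * b + κ))           ≡⟨ lem (2 ^ suc n) d b κ ⟩
      2 ^ suc n * ((2 + d) * b + (d * b + 2 * κ)) ≤⟨ *-monoʳ-≤ (2 ^ suc n) (+-monoʳ-≤ ((2 + d) * b)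
                                                       (≤-trans (+-monoˡ-≤ (2 * κ) (*-monoʳ-≤ d b≤c)) h)) ⟩
      2 ^ suc n * ((2 + d) * b + κ′)              ∎
      where
      open ≤-Reasoning
      lem : ∀ N d b κ → 2 * (N * ((1 + d) * b + κ)) ≡ N * ((2 + d) * b + (d * b + 2 * κ))
      lem = solve-∀

    -- The finer scale doubles the slope `suc d`. Only the slope `2 + d` is kept; the excess `d * b`
    -- is charged to the constant at the largest possible number `r` of blocks.
    linear-step : ∀ r → SteepFree (suc d) (suc r) → Linear (2 + d) (2 + d) (2 * κ + d * r)
    linear-step r free = linear-raise (suc d) (linear low)
      where
      low : ∀ {n} (f : Vertex n → Bool) b → Deg< (2 + d) (bit f) → AtMostBlocks f b →
            2 ^ (2 + d) * totalWeight (bit f) ≤ 2 ^ suc n * ((2 + d) * b + (2 * κ + d * r))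
      low {n} f b p bs = [ few , many ]′ (≤-total b r)
        where
        κ≤ : d * r + 2 * κ ≤ 2 * κ + d * r
        κ≤ = ≤-reflexive (+-comm (d * r) (2 * κ))
        few : b ≤ r → _
        few b≤r = linear-below f b r p bs b≤r κ≤
        many : r ≤ b → _
        many r≤b = ≤-trans (linear-below f r r p (blocks-bound free f p) ≤-refl κ≤)
          (*-monoʳ-≤ (2 ^ suc n) (+-monoˡ-≤ (2 * κ + d * r) (*-monoʳ-≤ (2 + d) r≤b)))

    -- With few blocks the previous linear bound is used, with many blocks the bound W ≤ deg / 2.
    linear-step-influence : ∀ c κ′ → d * c + 2 * κ ≤ κ′ → suc d * 2 ^ suc d ≤ (2 + d) * suc c + κ′ →
                            Linear (2 + d) (2 + d) κ′
    linear-step-influence c κ′ few many = linear-raise (suc d) (linear low)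
      where
      low : ∀ {n} (f : Vertex n → Bool) b → Deg< (2 + d) (bit f) → AtMostBlocks f b →
            2 ^ (2 + d) * totalWeight (bit f) ≤ 2 ^ suc n * ((2 + d) * b + κ′)
      low {n} f b p bs = [ many-blocks , few-blocks ]′ (<-≤-connex c b)
        where
        open ≤-Reasoning
        lem : ∀ a d N → 2 * a * (d * N) ≡ 2 * N * (d * a)
        lem = solve-∀
        few-blocks : b ≤ c → 2 ^ (2 + d) * totalWeight (bit f) ≤ 2 ^ suc n * ((2 + d) * b + κ′)
        few-blocks b≤c = linear-below f b c p bs b≤c few
        many-blocks : c < b → 2 ^ (2 + d) * totalWeight (bit f) ≤ 2 ^ suc n * ((2 + d) * b + κ′)
        many-blocks c<b = begin
          2 * 2 ^ suc d * totalWeight (bit f)     ≤⟨ *-monoʳ-≤ (2 * 2 ^ suc d) (influence-bound f p) ⟩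
          2 * 2 ^ suc d * (suc d * 2 ^ n)         ≡⟨ lem (2 ^ suc d) (suc d) (2 ^ n) ⟩
          2 ^ suc n * (suc d * 2 ^ suc d)         ≤⟨ *-monoʳ-≤ (2 ^ suc n) (≤-trans many (+-monoˡ-≤ κ′ (*-monoʳ-≤ (2 + d) c<b))) ⟩
          2 ^ suc n * ((2 + d) * b + κ′)          ∎

  linear₁ : Linear 1 1 0
  linear₁ = linear-raise 0 (linear λ f b p bs → ≤-trans (*-monoʳ-≤ 2 (influence-bound f p)) z≤n)

  check : ∀ {m n} {_ : True (m ≤? n)} → m ≤ n
  check {_} {_} {t} = toWitness t

  -- In each step `c` is a block count near which the two bounds balance, and the second numeral is
  -- the least constant, for any threshold, that satisfies both inequalities.
  linear₈ : Linear 8 8 704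
  linear₈ =
    linear-step-influence
      (linear-step-influence
        (linear-step-influence
          (linear-step-influence
            (linear-step-influence
              (linear-step-influence
                (linear-step-influence linear₁ 1 0 check check)
                1 2 check check)
              3 10 check check)
            5 35 check check)
          8 106 check check)
        14 282 check check)
      23 704 check check

  Relevant : ∀ {n} → (Vertex n → Bool) → Fin n → Set
  Relevant f i = ¬ (∀ x → D i (bit f) x ≡ ℤ.0ℤ)

  record BoundedVariables (k : ℕ) : Set where
    constructor bounded
    field
      variables : ∀ {n} (f : Vertex n → Bool) → Deg< (suc k) (bit f) → (∀ i → Relevant f i) →
                  1000 * n ≤ 4394 * 2 ^ k

  open BoundedVariables public

  sumFin-lower : ∀ {n} (a : Fin n → ℕ) C → (∀ i → C ≤ a i) → n * C ≤ sumFin a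
  sumFin-lower {zero}  a C l = z≤n
  sumFin-lower {suc n} a C l = +-mono-≤ (l zero) (sumFin-lower (λ i → a (suc i)) C (λ i → l (suc i)))

  totalWeight-lower : ∀ {n} k (f : Vertex n → Bool) → Deg< (suc k) (bit f) → (∀ i → Relevant f i) →
                      n * 2 ^ suc n ≤ 2 ^ k * totalWeight (bit f)
  totalWeight-lower {n} k f p rel = begin
    n * 2 ^ suc n                              ≤⟨ sumFin-lower _ (2 ^ suc n) (λ i → each i (Deg<-D i p)) ⟩
    sumFin (λ i → weight (D i (bit f)) * 2 ^ k) ≡⟨ sumFin-*ʳ (λ i → weight (D i (bit f))) (2 ^ k) ⟨
    totalWeight (bit f) * 2 ^ k                ≡⟨ *-comm (totalWeight (bit f)) (2 ^ k) ⟩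
    2 ^ k * totalWeight (bit f)                ∎
    where
    open ≤-Reasoning
    lem : ∀ a b → 2 * (a * b) ≡ a * (2 * b)
    lem = solve-∀
    each : ∀ {k} i → Deg< k (D i (bit f)) → 2 ^ suc n ≤ weight (D i (bit f)) * 2 ^ k
    each {zero}  i (null z) = ⊥-elim (rel i z)
    each {suc k} i q = ≤-trans (*-monoʳ-≤ 2 (weight-lower (rel i) q)) (≤-reflexive (lem (weight (D i (bit f))) (2 ^ k)))

  bounded-by : ∀ {n} k {B} (f : Vertex n → Bool) → Deg< (suc k) (bit f) → (∀ i → Relevant f i) →
               2 ^ k * totalWeight (bit f) ≤ 2 ^ suc n * B → n ≤ B
  bounded-by {n} k {B} f p rel l = *-cancelʳ-≤ n B (2 ^ suc n) ⦃ m^n≢0 2 (suc n) ⦄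
    (≤-trans (totalWeight-lower k f p rel) (≤-trans l (≤-reflexive (*-comm (2 ^ suc n) B))))

  -- Here W ≤ k / 2 alone is enough, which reaches up to `k = 8`.
  bounded-influence : ∀ k → 500 * k ≤ 4394 → BoundedVariables k
  bounded-influence k small = bounded λ {n} f p rel → *-cancelʳ-≤ (1000 * n) (4394 * 2 ^ k) (2 ^ n) ⦃ m^n≢0 2 n ⦄ (begin
    1000 * n * 2 ^ n                      ≡⟨ lem₁ n (2 ^ n) ⟩
    500 * (n * 2 ^ suc n)                 ≤⟨ *-monoʳ-≤ 500 (≤-trans (totalWeight-lower k f p rel) (*-monoʳ-≤ (2 ^ k) (influence-bound f p))) ⟩
    500 * (2 ^ k * (k * 2 ^ n))           ≡⟨ lem₂ (2 ^ k) k (2 ^ n) ⟩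
    500 * k * 2 ^ k * 2 ^ n               ≤⟨ *-monoˡ-≤ (2 ^ n) (*-monoˡ-≤ (2 ^ k) small) ⟩
    4394 * 2 ^ k * 2 ^ n                  ∎)
    where
    open ≤-Reasoning
    lem₁ : ∀ n N → 1000 * n * N ≡ 500 * (n * (2 * N))
    lem₁ = solve-∀
    lem₂ : ∀ a k N → 500 * (a * (k * N)) ≡ 500 * k * a * N
    lem₂ = solve-∀

  bounded-linear : ∀ k κ r → Linear k k κ → SteepFree k (suc r) → 1000 * (k * r + κ) ≤ 4394 * 2 ^ k → BoundedVariables k
  bounded-linear k κ r lin free l = bounded λ f p rel →
    ≤-trans (*-monoʳ-≤ 1000 (bounded-by k f p rel (bound lin f r p (blocks-bound free f p)))) l

  -- Each row refutes r + 1 disjoint sensitive blocks in degree d + 1, by the Lagrange functional of its nodes.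
  -- The nodes support an optimal dual solution of the linear program of maximising p 1 over the
  -- polynomials p of degree d + 1 with p 0 = 0 and values in [0, 1] at 2, …, r + 1.
  Rows : ℕ → ℕ → List (ℕ × List ℕ) → Set
  Rows d κ []                 = ⊤
  Rows d κ ((r , nodes) ∷ rs) =
    Certificate (2 + d) (suc r) (certify nodes) × 1000 * (suc d * r + κ) ≤ 4394 * 2 ^ suc d × Rows (suc d) (2 * κ + d * r) rs

  rows? : ∀ d κ rs → Dec (Rows d κ rs)
  rows? d κ []                 = yes tt
  rows? d κ ((r , nodes) ∷ rs) =
    certificate? (2 + d) (suc r) (certify nodes) ×-dec (_ ≤? _) ×-dec rows? (suc d) (2 * κ + d * r) rs

  lastκ : ℕ → ℕ → List (ℕ × List ℕ) → ℕ
  lastκ d κ []             = κ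
  lastκ d κ ((r , _) ∷ rs) = lastκ (suc d) (2 * κ + d * r) rs

  lastd : ℕ → List (ℕ × List ℕ) → ℕ
  lastd d []       = d
  lastd d (_ ∷ rs) = lastd (suc d) rs

  rows-linear : ∀ d κ rs → Rows d κ rs → Linear (suc d) (suc d) κ →
                Linear (suc (lastd d rs)) (suc (lastd d rs)) (lastκ d κ rs)
  rows-linear d κ []             _           lin = lin
  rows-linear d κ ((r , _) ∷ rs) (c , _ , R) lin = rows-linear (suc d) _ rs R (linear-step lin r (certificate-refutes c))

  rows-bounded : ∀ d κ rs → Rows d κ rs → Linear (suc d) (suc d) κ →
                 ∀ k → suc d ≤ k → k ≤ lastd d rs → BoundedVariables k
  rows-bounded d κ []             _           lin k l m = ⊥-elim (1+n≰n (≤-trans l m))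
  rows-bounded d κ ((r , _) ∷ rs) (c , a , R) lin k l m with m≤n⇒m<n∨m≡n l
  ... | inj₂ refl = bounded-linear (suc d) κ r lin (certificate-refutes c) a
  ... | inj₁ l′   = rows-bounded (suc d) _ rs R (linear-step lin r (certificate-refutes c)) k l′ m

  -- The rows belong to the degrees 8, ..., 20. Together with 0 and 1 there are two more nodes than
  -- the degree, the number for which the divided difference annihilates that degree.
  table : List (ℕ × List ℕ)
  table =
    (38  , 2 ∷ 6 ∷ 12 ∷ 19 ∷ 27 ∷ 33 ∷ 37 ∷ 39 ∷ []) ∷
    (47  , 2 ∷ 6 ∷ 12 ∷ 20 ∷ 28 ∷ 36 ∷ 42 ∷ 46 ∷ 48 ∷ []) ∷
    (58  , 2 ∷ 6 ∷ 12 ∷ 20 ∷ 30 ∷ 39 ∷ 47 ∷ 53 ∷ 57 ∷ 59 ∷ []) ∷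
    (71  , 2 ∷ 6 ∷ 12 ∷ 21 ∷ 31 ∷ 41 ∷ 51 ∷ 60 ∷ 66 ∷ 70 ∷ 72 ∷ []) ∷
    (84  , 2 ∷ 6 ∷ 13 ∷ 21 ∷ 32 ∷ 43 ∷ 53 ∷ 64 ∷ 72 ∷ 79 ∷ 83 ∷ 85 ∷ []) ∷
    (99  , 2 ∷ 6 ∷ 13 ∷ 22 ∷ 32 ∷ 44 ∷ 56 ∷ 68 ∷ 78 ∷ 87 ∷ 94 ∷ 98 ∷ 100 ∷ []) ∷
    (114 , 2 ∷ 6 ∷ 13 ∷ 22 ∷ 33 ∷ 45 ∷ 57 ∷ 70 ∷ 82 ∷ 93 ∷ 102 ∷ 109 ∷ 113 ∷ 115 ∷ []) ∷
    (131 , 2 ∷ 6 ∷ 13 ∷ 22 ∷ 33 ∷ 46 ∷ 59 ∷ 73 ∷ 86 ∷ 99 ∷ 110 ∷ 119 ∷ 126 ∷ 130 ∷ 132 ∷ []) ∷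
    (149 , 2 ∷ 6 ∷ 13 ∷ 22 ∷ 33 ∷ 46 ∷ 60 ∷ 75 ∷ 90 ∷ 104 ∷ 117 ∷ 128 ∷ 137 ∷ 144 ∷ 148 ∷ 150 ∷ []) ∷
    (170 , 2 ∷ 6 ∷ 13 ∷ 22 ∷ 34 ∷ 47 ∷ 62 ∷ 78 ∷ 93 ∷ 109 ∷ 124 ∷ 137 ∷ 149 ∷ 158 ∷ 165 ∷ 169 ∷ 171 ∷ []) ∷
    (192 , 2 ∷ 6 ∷ 13 ∷ 23 ∷ 35 ∷ 48 ∷ 64 ∷ 80 ∷ 97 ∷ 113 ∷ 129 ∷ 145 ∷ 158 ∷ 170 ∷ 180 ∷ 187 ∷ 191 ∷ 193 ∷ []) ∷
    (215 , 2 ∷ 6 ∷ 13 ∷ 23 ∷ 35 ∷ 49 ∷ 65 ∷ 82 ∷ 99 ∷ 117 ∷ 134 ∷ 151 ∷ 167 ∷ 181 ∷ 193 ∷ 203 ∷ 210 ∷ 214 ∷ 216 ∷ []) ∷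
    (239 , 2 ∷ 6 ∷ 13 ∷ 23 ∷ 35 ∷ 50 ∷ 66 ∷ 83 ∷ 101 ∷ 120 ∷ 139 ∷ 157 ∷ 174 ∷ 190 ∷ 205 ∷ 217 ∷ 227 ∷ 234 ∷ 238 ∷ 240 ∷ []) ∷ []

  abstract
    table-rows : Rows 7 704 table
    table-rows = toWitness {a? = rows? 7 704 table} tt

  steep-free : ∀ d → SteepFree (suc d) (suc (4 * (suc d * suc d)))
  steep-free d p (m , u0 , u1 , B) = no-steep (suc d) (s≤s z≤n) p (m , u0 , u1 , λ j l → B j (m≤n⇒m≤1+n l))

  abstract
    -- The solution of the recursion 2 (margin d) = 4 (d - 1) d² + margin (d + 1).
    margin : ℕ → ℕ
    margin d = 4 * (d * (d * d)) + 8 * (d * d) + 28 * d + 40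

    margin-def : ∀ d → margin d ≡ 4 * (d * (d * d)) + 8 * (d * d) + 28 * d + 40
    margin-def d = refl

  margin-step : ∀ κ d → 2 * κ + d * (4 * ((1 + d) * (1 + d))) + margin (2 + d) ≡ 2 * (κ + margin (1 + d))
  margin-step κ d = trans (cong (2 * κ + d * (4 * ((1 + d) * (1 + d))) +_) (margin-def (2 + d)))
    (trans (lem κ d) (cong (λ z → 2 * (κ + z)) (sym (margin-def (1 + d)))))
    where
    lem : ∀ κ d → 2 * κ + d * (4 * ((1 + d) * (1 + d)))
        + (4 * ((2 + d) * ((2 + d) * (2 + d))) + 8 * ((2 + d) * (2 + d)) + 28 * (2 + d) + 40)
        ≡ 2 * (κ + (4 * ((1 + d) * ((1 + d) * (1 + d))) + 8 * ((1 + d) * (1 + d)) + 28 * (1 + d) + 40))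
    lem = solve-∀

  margin-double : ∀ a b p → a ≡ 2 * b → 1000 * b ≤ 4394 * p → 1000 * a ≤ 4394 * (2 * p)
  margin-double a b p refl l = begin
    1000 * (2 * b)     ≡⟨ lem 1000 b ⟩
    2 * (1000 * b)     ≤⟨ *-monoʳ-≤ 2 l ⟩
    2 * (4394 * p)     ≡⟨ lem 4394 p ⟨
    4394 * (2 * p)     ∎
    where
    open ≤-Reasoning
    lem : ∀ c b → c * (2 * b) ≡ 2 * (c * b)
    lem = solve-∀

  margin-enough : ∀ d κ → d * (4 * (d * d)) + κ ≤ κ + margin d
  margin-enough d κ = ≤-trans (m≤m+n (d * (4 * (d * d)) + κ) (8 * (d * d) + 28 * d + 40)) (≤-reflexive (trans (sym (lem d κ)) (cong (κ +_) (sym (margin-def d)))))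
    where
    lem : ∀ d κ → κ + (4 * (d * (d * d)) + 8 * (d * d) + 28 * d + 40) ≡ d * (4 * (d * d)) + κ + (8 * (d * d) + 28 * d + 40)
    lem = solve-∀

  module Tail (d₀ κ₀ : ℕ) (base : Linear (suc d₀) (suc d₀) κ₀)
              (base-bound : 1000 * (κ₀ + (4 * (suc d₀ * (suc d₀ * suc d₀)) + 8 * (suc d₀ * suc d₀) + 28 * suc d₀ + 40))
                            ≤ 4394 * 2 ^ suc d₀) where

    tailκ : ℕ → ℕ
    tailκ zero    = κ₀
    tailκ (suc m) = 2 * tailκ m + (m + d₀) * (4 * (suc (m + d₀) * suc (m + d₀)))

    linear-tail : ∀ m → Linear (suc (m + d₀)) (suc (m + d₀)) (tailκ m)
    linear-tail zero    = base
    linear-tail (suc m) = linear-step (linear-tail m) _ (steep-free (m + d₀))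

    -- The constant plus `margin` exactly doubles in every step, so its quotient by the power of 2
    -- stays at its value in degree `suc d₀`: `margin` anticipates all that the rest of the series
    -- can add.
    tailκ-bound : ∀ m → 1000 * (tailκ m + margin (suc (m + d₀))) ≤ 4394 * 2 ^ suc (m + d₀)
    tailκ-bound zero    = subst (λ z → 1000 * (κ₀ + z) ≤ 4394 * 2 ^ suc d₀) (sym (margin-def (suc d₀))) base-bound
    tailκ-bound (suc m) = margin-double _ (tailκ m + margin (suc (m + d₀))) (2 ^ suc (m + d₀))
      (margin-step (tailκ m) (m + d₀)) (tailκ-bound m)

    bounded-tail : ∀ m → BoundedVariables (suc (m + d₀))
    bounded-tail m = bounded-linear (suc (m + d₀)) (tailκ m) _ (linear-tail m) (steep-free (m + d₀))
      (≤-trans (*-monoʳ-≤ 1000 (margin-enough (suc (m + d₀)) (tailκ m))) (tailκ-bound m))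

  bounded-variables : ∀ k → BoundedVariables k
  bounded-variables k = [ small , [ medium , large ]′ (≤-<-connex k 20) ]′ (≤-<-connex k 8)
    where
    small : k ≤ 8 → BoundedVariables k
    small k≤8 = bounded-influence k (≤-trans (*-monoʳ-≤ 500 k≤8) check)
    medium : k ≤ 20 → 8 < k → BoundedVariables k
    medium k≤20 8<k = rows-bounded 7 704 table table-rows linear₈ k (<⇒≤ 8<k) k≤20
    large : 20 < k → 8 < k → BoundedVariables k
    large 20<k _ = subst BoundedVariables k≡ (Tail.bounded-tail 20 (lastκ 7 704 table) linear₂₁ check (k ∸ 21))
      where
      linear₂₁ : Linear 21 21 (lastκ 7 704 table)
      linear₂₁ = rows-linear 7 704 table table-rows linear₈
      k≡ : suc (k ∸ 21 + 20) ≡ k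
      k≡ = trans (sym (+-suc (k ∸ 21) 20)) (m∸n+n≡m 20<k)


-- k-functions: their degree, irrelevant variables, and the extremal examples

module KFunctions where

  open import Defs
  open MultilinearDegree
  open Automorphisms
  open Weights
  open BlockSensitivity using (val-injective)
  open RelevantVariables
  open import Data.Bool using (Bool; true; false; not; _xor_; if_then_else_)
  import Data.Bool.Properties as Bₚ
  open import Data.Nat as ℕ using (ℕ; zero; suc; _+_)
  import Data.Nat.Properties as ℕₚ
  import Data.Integer as ℤ
  import Data.Integer.Properties as ℤₚ
  import Data.Integer.Tactic.RingSolver as ℤ-Ring
  open import Data.Fin using (Fin; zero; suc; punchIn; splitAt; _↑ˡ_; _↑ʳ_)
  open import Data.Fin.Properties using (any?; splitAt⁻¹-↑ˡ; splitAt⁻¹-↑ʳ)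
  open import Data.Vec using ([]; _∷_; lookup; tail; insertAt; _++_; take; drop; _[_]≔_)
  open import Data.Vec.Properties using (take++drop≡id)
  open import Data.List as List using (length; filter)
  open import Data.Product using (Σ; _,_; ∃)
  open import Data.Sum using (inj₁; inj₂)
  open import Data.Empty using (⊥-elim)
  open import Relation.Binary.PropositionalEquality
  open import Relation.Nullary using (Dec; yes; no; ¬_)
  open import Relation.Nullary.Decidable using (¬?)

  differ : Bool → Bool → ℕ
  differ a b = if a xor b then 1 else 0

  differ-same : ∀ a → differ a a ≡ 0
  differ-same false = refl
  differ-same true  = refl

  disagreements : ∀ {n} → BoolFn n → Vertex n → ℕ
  disagreements f v = sumFin (λ i → differ (f v) (f (flipAt i v)))

  length-filter : ∀ {n} {A : Set} c (F : A → Bool) {B : Set} (G : B → A) (h : Fin n → B) →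
    length (filter (λ w → ¬? (c Bₚ.≟ F w)) (List.map G (List.tabulate h))) ≡ sumFin (λ i → differ c (F (G (h i))))
  length-filter {zero}  c F G h = refl
  length-filter {suc n} c F G h with c | F (G (h zero))
  ... | false | false = length-filter false F G (λ i → h (suc i))
  ... | true  | true  = length-filter true F G (λ i → h (suc i))
  ... | false | true  = cong suc (length-filter false F G (λ i → h (suc i)))
  ... | true  | false = cong suc (length-filter true F G (λ i → h (suc i)))

  disagree≡ : ∀ {n} (f : BoolFn n) v → disagree f v ≡ disagreements f v
  disagree≡ f v = length-filter (f v) f (λ i → flipAt i v) (λ i → i)

  KFunction : ∀ {n} → ℕ → BoolFn n → Set
  KFunction k f = ∀ v → disagreements f v ≡ k

  toK : ∀ {n k} {f : BoolFn n} → IsKFunction k f → KFunction k f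
  toK {f = f} K v = trans (sym (disagree≡ f v)) (K v)

  fromK : ∀ {n k} {f : BoolFn n} → KFunction k f → IsKFunction k f
  fromK {f = f} K v = trans (disagree≡ f v) (K v)

  isKFunction? : ∀ {n} k (f : BoolFn n) → Dec (IsKFunction k f)
  isKFunction? k f = all? (λ v → disagree f v ℕ.≟ k)

  isKFunction-ext : ∀ {n k} {f g : BoolFn n} → (∀ x → f x ≡ g x) → IsKFunction k f → IsKFunction k g
  isKFunction-ext {f = f} {g} e K = fromK λ v →
    trans (sumFin-ext (λ i → sym (cong₂ differ (e v) (e (flipAt i v))))) (toK K v)

  isKFunction-tail : ∀ {n k} {f : BoolFn n} → IsKFunction k f → IsKFunction k (λ x → f (tail x))
  isKFunction-tail {f = f} K = fromK {f = λ x → f (tail x)} λ { (a ∷ x) → trans (cong (_+ disagreements f x) (differ-same (f x))) (toK K x) }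

  sumFin-punchIn : ∀ {n} (i : Fin (suc n)) (c : Fin (suc n) → ℕ) → sumFin c ≡ c i + sumFin (λ j → c (punchIn i j))
  sumFin-punchIn zero c = refl
  sumFin-punchIn {suc n} (suc i) c = trans (cong (c zero +_) (sumFin-punchIn i (λ j → c (suc j))))
    (trans (sym (ℕₚ.+-assoc (c zero) (c (suc i)) _)) (trans (cong (_+ sumFin (λ j → c (suc (punchIn i j)))) (ℕₚ.+-comm (c zero) (c (suc i)))) (ℕₚ.+-assoc (c (suc i)) (c zero) _)))

  isKFunction-insertAt : ∀ {n k} {f : BoolFn (suc n)} i → (∀ x → f (flipAt i x) ≡ f x) →
                         IsKFunction k f → IsKFunction k (λ y → f (insertAt y i false))
  isKFunction-insertAt {f = f} i irr K = fromK λ y → trans (sym (lem y)) (toK {f = f} K (insertAt y i false))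
    where
    lem : ∀ y → disagreements f (insertAt y i false) ≡ disagreements (λ y → f (insertAt y i false)) y
    lem y = trans (sumFin-punchIn i (λ j → differ (f (insertAt y i false)) (f (flipAt j (insertAt y i false)))))
      (cong₂ _+_ (trans (cong (differ (f (insertAt y i false))) (irr (insertAt y i false))) (differ-same (f (insertAt y i false))))
                 (sumFin-ext (λ j → cong (λ z → differ (f (insertAt y i false)) (f z)) (sym (insertAt-flip y i j false)))))

  signed : ∀ {n} → BoolFn n → Fn n
  signed f x = ℤ.1ℤ ℤ.+ ℤ.- ℤ.+ 2 ℤ.* bit f x

  -- A neighbour with the same sign contributes 0 to the Laplacian, and one with the opposite sign
  -- contributes twice the value at `x`.
  laplacian-signed : ∀ {n} (f : BoolFn n) x → laplacian (signed f) x ≡ ℤ.+ 2 ℤ.* ℤ.+ disagreements f x ℤ.* signed f x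
  laplacian-signed f []      = refl
  laplacian-signed f (a ∷ x) rewrite laplacian-signed (λ y → f (a ∷ y)) x =
    lem (f (a ∷ x)) (f (not a ∷ x)) (disagreements (λ y → f (a ∷ y)) x)
    where
    σ : Bool → ℤ.ℤ
    σ b = ℤ.1ℤ ℤ.+ ℤ.- ℤ.+ 2 ℤ.* val b
    lem₀ : ∀ s d → (s ℤ.- s) ℤ.+ ℤ.+ 2 ℤ.* d ℤ.* s ≡ ℤ.+ 2 ℤ.* (ℤ.0ℤ ℤ.+ d) ℤ.* s
    lem₀ = ℤ-Ring.solve-∀
    lem₁ : ∀ s d → (s ℤ.- ℤ.- s) ℤ.+ ℤ.+ 2 ℤ.* d ℤ.* s ≡ ℤ.+ 2 ℤ.* (ℤ.1ℤ ℤ.+ d) ℤ.* s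
    lem₁ = ℤ-Ring.solve-∀
    lem : ∀ p q d → (σ p ℤ.- σ q) ℤ.+ ℤ.+ 2 ℤ.* ℤ.+ d ℤ.* σ p ≡ ℤ.+ 2 ℤ.* ℤ.+ (differ p q + d) ℤ.* σ p
    lem false false d = lem₀ (σ false) (ℤ.+ d)
    lem true  true  d = lem₀ (σ true) (ℤ.+ d)
    lem false true  d = lem₁ (σ false) (ℤ.+ d)
    lem true  false d = lem₁ (σ true) (ℤ.+ d)

  -- A k-function is an eigenfunction of the Laplacian with eigenvalue 2 k.
  kFunction-degree : ∀ {n k} {f : BoolFn n} → IsKFunction k f → Deg< (suc k) (bit f)
  kFunction-degree {n} {k} {f} K = Deg<-cancel (ℤ.+ 2) (Deg<-ext (λ x → lem (bit f x))
    (Deg<-+ (Deg<-const k ℤ.1ℤ) (Deg<-scale (ℤ.- ℤ.1ℤ)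
      (eigen-degree n k (signed f) λ x →
        trans (laplacian-signed f x) (cong (λ d → ℤ.+ 2 ℤ.* ℤ.+ d ℤ.* signed f x) (toK K x))))))
    where
    lem : ∀ b → ℤ.1ℤ ℤ.+ ℤ.- ℤ.1ℤ ℤ.* (ℤ.1ℤ ℤ.+ ℤ.- ℤ.+ 2 ℤ.* b) ≡ ℤ.+ 2 ℤ.* b
    lem = ℤ-Ring.solve-∀

  flip≡set : ∀ {n} (x : Vertex n) i → flipAt i x ≡ x [ i ]≔ not (lookup x i)
  flip≡set (a ∷ x) zero    = refl
  flip≡set (a ∷ x) (suc i) = cong (a ∷_) (flip≡set x i)

  D-zero⇒irrelevant : ∀ {n} (f : BoolFn n) i → (∀ x → D i (bit f) x ≡ ℤ.0ℤ) → ∀ x → f (flipAt i x) ≡ f x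
  D-zero⇒irrelevant f i z x = begin
    f (flipAt i x)                    ≡⟨ cong f (flip≡set x i) ⟩
    f (x [ i ]≔ not (lookup x i))     ≡⟨ either (not (lookup x i)) (lookup x i) ⟩
    f (x [ i ]≔ lookup x i)           ≡⟨ cong f (set-same x i (lookup x i) refl) ⟩
    f x                               ∎
    where
    open ≡-Reasoning
    top≡ : f (x [ i ]≔ true) ≡ f (x [ i ]≔ false)
    top≡ = val-injective (ℤₚ.i-j≡0⇒i≡j _ _ (z x))
    either : ∀ a b → f (x [ i ]≔ a) ≡ f (x [ i ]≔ b)
    either false false = refl
    either false true  = sym top≡
    either true  false = top≡
    either true  true  = refl

  -- Irrelevance can be tested on the finite cube; a failed search would make every variable
  -- relevant, against the bound.
  irrelevant-exists : ∀ {n k} {f : BoolFn n} → IsKFunction k f → 4394 ℕ.* 2 ℕ.^ k ℕ.< 1000 ℕ.* n →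
                      Σ (Fin n) λ i → ∀ x → f (flipAt i x) ≡ f x
  irrelevant-exists {n} {k} {f} K big = decide (any? λ i → all? λ x → f (flipAt i x) Bₚ.≟ f x)
    where
    decide : Dec (∃ λ i → ∀ x → f (flipAt i x) ≡ f x) → ∃ λ i → ∀ x → f (flipAt i x) ≡ f x
    decide (yes e) = e
    decide (no ¬e) = ⊥-elim (ℕₚ.<⇒≱ big (variables (bounded-variables k) f (kFunction-degree K)
      (λ i z → ¬e (i , D-zero⇒irrelevant f i z))))

  sumFin-zero : ∀ {n} {c : Fin n → ℕ} → (∀ i → c i ≡ 0) → sumFin c ≡ 0
  sumFin-zero {zero}  z = refl
  sumFin-zero {suc n} z = cong₂ _+_ (z zero) (sumFin-zero (λ i → z (suc i)))

  disagreements-ext : ∀ {n} {f g : BoolFn n} → (∀ x → f x ≡ g x) → ∀ v → disagreements f v ≡ disagreements g v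
  disagreements-ext e v = sumFin-ext (λ i → cong₂ differ (e v) (e (flipAt i v)))

  disagreements-const : ∀ {n} c (v : Vertex n) → disagreements (λ _ → c) v ≡ 0
  disagreements-const {n} c v = sumFin-zero {n} (λ _ → differ-same c)

  differ-xor : ∀ a p q → differ (a xor p) (a xor q) ≡ differ p q
  differ-xor false p     q     = refl
  differ-xor true  false false = refl
  differ-xor true  false true  = refl
  differ-xor true  true  false = refl
  differ-xor true  true  true  = refl

  disagreements-xor : ∀ {n} a (f : BoolFn n) v → disagreements (λ x → a xor f x) v ≡ disagreements f v
  disagreements-xor a f v = sumFin-ext (λ i → differ-xor a (f v) (f (flipAt i v)))

  disagreements-++ : ∀ {m n} (f : BoolFn (m + n)) (z : Vertex m) (w : Vertex n) →
    disagreements f (z ++ w) ≡ disagreements (λ z → f (z ++ w)) z + disagreements (λ w → f (z ++ w)) w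
  disagreements-++ f []      w = refl
  disagreements-++ f (a ∷ z) w =
    trans (cong (differ (f (a ∷ z ++ w)) (f (not a ∷ z ++ w)) +_) (disagreements-++ (λ v → f (a ∷ v)) z w))
          (sym (ℕₚ.+-assoc (differ (f (a ∷ z ++ w)) (f (not a ∷ z ++ w))) _ _))

  -- In closed form `3 * 2 ^ k - 2`. The index is shifted: `extremal k` is a `suc k`-function,
  -- because 0-functions are constant and depend on no variable.
  extremalSize : ℕ → ℕ
  extremalSize zero    = 1
  extremalSize (suc k) = 2 + (extremalSize k + extremalSize k)

  -- f_{k+1} (x, y, z, w) = (x + y) / 2 · f_k z + (x - y) / 2 · f_k w; products of signs are exclusive ors.
  extremal : ∀ k → BoolFn (extremalSize k)
  extremal zero    (a ∷ [])    = a
  extremal (suc k) (a ∷ b ∷ v) =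
    a xor extremal k (if a xor b then drop (extremalSize k) v else take (extremalSize k) v)

  take-++ : ∀ {m n} (z : Vertex m) (w : Vertex n) → take m (z ++ w) ≡ z
  take-++ []      w = refl
  take-++ (a ∷ z) w = cong (a ∷_) (take-++ z w)

  drop-++ : ∀ {m n} (z : Vertex m) (w : Vertex n) → drop m (z ++ w) ≡ w
  drop-++ []      w = refl
  drop-++ (a ∷ z) w = drop-++ z w

  extremal-++ : ∀ k a b z w → extremal (suc k) (a ∷ b ∷ (z ++ w)) ≡ a xor extremal k (if a xor b then w else z)
  extremal-++ k a b z w with a xor b
  ... | true  = cong (λ v → a xor extremal k v) (drop-++ z w)
  ... | false = cong (λ v → a xor extremal k v) (take-++ z w)

  -- Flipping `a` and flipping `b` both exchange the roles of `p` and `q`, and the two results are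
  -- opposite signs. Exactly one of them differs from the original value.
  extremal-heads : ∀ a b p q →
    differ (a xor (if a xor b then q else p)) (not a xor (if not a xor b then q else p)) +
    differ (a xor (if a xor b then q else p)) (a xor (if a xor not b then q else p)) ≡ 1
  extremal-heads false false false false = refl
  extremal-heads false false false true  = refl
  extremal-heads false false true  false = refl
  extremal-heads false false true  true  = refl
  extremal-heads false true  false false = refl
  extremal-heads false true  false true  = refl
  extremal-heads false true  true  false = refl
  extremal-heads false true  true  true  = refl
  extremal-heads true  false false false = refl
  extremal-heads true  false false true  = refl
  extremal-heads true  false true  false = refl
  extremal-heads true  false true  true  = refl
  extremal-heads true  true  false false = refl
  extremal-heads true  true  false true  = refl
  extremal-heads true  true  true  false = refl
  extremal-heads true  true  true  true  = refl

  extremal-KFunction : ∀ k → KFunction (suc k) (extremal k)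
  extremal-KFunction zero (false ∷ []) = refl
  extremal-KFunction zero (true ∷ [])  = refl
  extremal-KFunction (suc k) (a ∷ b ∷ v) =
    subst (λ v → disagreements (extremal (suc k)) (a ∷ b ∷ v) ≡ suc (suc k)) (take++drop≡id (extremalSize k) v)
          (on-++ (take (extremalSize k) v) (drop (extremalSize k) v))
    where
    g = extremal k
    module _ (z w : Vertex (extremalSize k)) where
      value : ∀ a b → extremal (suc k) (a ∷ b ∷ (z ++ w)) ≡ a xor (if a xor b then g w else g z)
      value a b = trans (extremal-++ k a b z w) (cong (a xor_) (Bₚ.if-float g (a xor b)))
      -- Only the selected one of `z` and `w` contributes; the selector is named `c` so that it can
      -- be split into cases.
      tails : ∀ c → c ≡ a xor b → disagreements (λ v → extremal (suc k) (a ∷ b ∷ v)) (z ++ w) ≡ suc k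
      tails c e = trans (disagreements-++ (λ v → extremal (suc k) (a ∷ b ∷ v)) z w)
        (trans (cong₂ _+_ (disagreements-ext (λ z → trans (extremal-++ k a b z w) (cong (λ c → a xor g (if c then w else z)) (sym e))) z)
                          (disagreements-ext (λ w → trans (extremal-++ k a b z w) (cong (λ c → a xor g (if c then w else z)) (sym e))) w))
               (cases c))
        where
        cases : ∀ c → disagreements (λ z → a xor g (if c then w else z)) z
                    + disagreements (λ w → a xor g (if c then w else z)) w ≡ suc k
        cases true  = cong₂ _+_ (disagreements-const (a xor g w) z)
                                (trans (disagreements-xor a g w) (extremal-KFunction k w))
        cases false = trans (cong₂ _+_ (trans (disagreements-xor a g z) (extremal-KFunction k z))
                                       (disagreements-const (a xor g z) w)) (ℕₚ.+-identityʳ (suc k))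
      on-++ : disagreements (extremal (suc k)) (a ∷ b ∷ (z ++ w)) ≡ suc (suc k)
      on-++ = trans (sym (ℕₚ.+-assoc (differ (F a b) (F (not a) b)) (differ (F a b) (F a (not b))) _))
        (cong₂ _+_ (trans (cong₂ _+_ (cong₂ differ (value a b) (value (not a) b)) (cong₂ differ (value a b) (value a (not b))))
                          (extremal-heads a b (g z) (g w)))
                   (tails (a xor b) refl))
        where
        F : Bool → Bool → Bool
        F a b = extremal (suc k) (a ∷ b ∷ (z ++ w))

  flip-++ˡ : ∀ {m n} (i : Fin m) (z : Vertex m) (w : Vertex n) → flipAt (i ↑ˡ n) (z ++ w) ≡ flipAt i z ++ w
  flip-++ˡ zero    (a ∷ z) w = refl
  flip-++ˡ (suc i) (a ∷ z) w = cong (a ∷_) (flip-++ˡ i z w)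

  flip-++ʳ : ∀ {m n} (j : Fin n) (z : Vertex m) (w : Vertex n) → flipAt (m ↑ʳ j) (z ++ w) ≡ z ++ flipAt j w
  flip-++ʳ j []      w = refl
  flip-++ʳ j (a ∷ z) w = cong (a ∷_) (flip-++ʳ j z w)

  DependsOn : ∀ {n} → BoolFn n → Fin n → Set
  DependsOn f i = ∃ λ x → f (flipAt i x) ≢ f x

  firstCoordinate : ∀ k → Fin (extremalSize k)
  firstCoordinate zero    = zero
  firstCoordinate (suc k) = zero

  -- The first coordinate negates the value where `z = w`. The second is detected where `z` and `w`
  -- are neighbours with different values, those of `z` where the two heads agree, and those of `w`
  -- where they differ.
  extremal-depends : ∀ k i → DependsOn (extremal k) i
  extremal-depends zero zero = (false ∷ []) , λ ()
  extremal-depends (suc k) zero =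
    let z = origin {extremalSize k} in
    (false ∷ false ∷ (z ++ z)) , λ e → Bₚ.not-¬ refl
      (sym (trans (sym (extremal-++ k true false z z)) (trans e (extremal-++ k false false z z))))
  extremal-depends (suc k) (suc zero) =
    let z , ne = extremal-depends k (firstCoordinate k) in
    (false ∷ false ∷ (z ++ flipAt (firstCoordinate k) z)) , λ e → ne
      (trans (sym (extremal-++ k false true z (flipAt (firstCoordinate k) z)))
             (trans e (extremal-++ k false false z (flipAt (firstCoordinate k) z))))
  extremal-depends (suc k) (suc (suc i)) with splitAt (extremalSize k) i in eq
  ... | inj₁ j with extremal-depends k j
  ...   | z , ne = (false ∷ false ∷ (z ++ z)) , λ e → ne
    (trans (sym (extremal-++ k false false (flipAt j z) z))
      (trans (cong (λ v → extremal (suc k) (false ∷ false ∷ v))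
               (trans (sym (flip-++ˡ j z z)) (cong (λ l → flipAt l (z ++ z)) (splitAt⁻¹-↑ˡ eq))))
        (trans e (extremal-++ k false false z z))))
  extremal-depends (suc k) (suc (suc i)) | inj₂ j with extremal-depends k j
  ...   | w , ne = (false ∷ true ∷ (w ++ w)) , λ e → ne
    (trans (sym (extremal-++ k false true w (flipAt j w)))
      (trans (cong (λ v → extremal (suc k) (false ∷ true ∷ v))
               (trans (sym (flip-++ʳ j w w)) (cong (λ l → flipAt l (w ++ w)) (splitAt⁻¹-↑ʳ eq))))
        (trans e (extremal-++ k false true w w))))


-- Counting isomorphism classes and comparing consecutive dimensions

module Classification where

  open import Defs
  open Automorphisms
  open KFunctions
  open import Data.Bool using (true; false)
  open import Data.Nat
  open import Data.Nat.Properties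
  open import Data.Nat.DivMod using (_/_; _%_; m≡m%n+[m/n]*n; m%n<n)
  open import Data.Nat.Tactic.RingSolver using (solve-∀)
  open import Data.Fin using (Fin; zero; suc)
  open import Data.Fin.Properties using (any?; injective⇒≤)
  open import Data.Vec using ([]; _∷_; tail; insertAt)
  open import Data.List using (List; []; _∷_; cartesianProductWith)
  open import Data.List.Membership.Propositional using (_∈_)
  open import Data.List.Membership.Propositional.Properties using (∈-cartesianProductWith⁺)
  open import Data.List.Relation.Unary.Any using (here; there)
  open import Data.Product using (Σ; _×_; _,_; proj₁; proj₂; ∃)
  open import Data.Sum using ([_,_]′)
  open import Data.Empty using (⊥-elim)
  open import Relation.Binary.PropositionalEquality
  open import Relation.Nullary using (Dec; yes; no; ¬_)

  glue : ∀ {n} → BoolFn n → BoolFn n → BoolFn (suc n)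
  glue f g (false ∷ x) = f x
  glue f g (true ∷ x)  = g x

  allFns : ∀ n → List (BoolFn n)
  allFns zero    = (λ _ → false) ∷ (λ _ → true) ∷ []
  allFns (suc n) = cartesianProductWith glue (allFns n) (allFns n)

  -- Functions are found only up to pointwise equality, which suffices because being a k-function
  -- and isomorphism both respect it.
  allFns-complete : ∀ {n} (f : BoolFn n) → ∃ λ g → g ∈ allFns n × (∀ x → f x ≡ g x)
  allFns-complete {zero} f with f [] in e
  ... | false = _ , here refl , λ { [] → e }
  ... | true  = _ , there (here refl) , λ { [] → e }
  allFns-complete {suc n} f =
    let g₀ , m₀ , e₀ = allFns-complete (λ x → f (false ∷ x))
        g₁ , m₁ , e₁ = allFns-complete (λ x → f (true ∷ x))
    in glue g₀ g₁ , ∈-cartesianProductWith⁺ glue m₀ m₁ , λ { (false ∷ x) → e₀ x ; (true ∷ x) → e₁ x }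

  classify : ∀ {n} k (fs : List (BoolFn n)) → Σ ℕ λ m → Σ (Fin m → BoolFn n) λ rep →
    (∀ i → IsKFunction k (rep i)) × (∀ i j → Isomorphic (rep i) (rep j) → i ≡ j) ×
    (∀ f → f ∈ fs → IsKFunction k f → ∃ λ i → Isomorphic f (rep i))
  classify k [] = 0 , (λ ()) , (λ ()) , (λ ()) , λ _ ()
  classify {n} k (f ∷ fs) with classify k fs
  ... | m , rep , K , distinct , complete with isKFunction? k f | any? (λ i → isomorphic? f (rep i))
  ...   | no ¬K | _ = m , rep , K , distinct , λ
    { g (here refl) K′ → ⊥-elim (¬K K′) ; g (there g∈) K′ → complete g g∈ K′ }
  ...   | yes _ | yes old = m , rep , K , distinct , λ
    { g (here refl) _ → old ; g (there g∈) K′ → complete g g∈ K′ }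
  ...   | yes Kf | no new = suc m , rep′ , K′ , distinct′ , complete′
    where
    rep′ : Fin (suc m) → BoolFn n
    rep′ zero    = f
    rep′ (suc i) = rep i
    K′ : ∀ i → IsKFunction k (rep′ i)
    K′ zero    = Kf
    K′ (suc i) = K i
    distinct′ : ∀ i j → Isomorphic (rep′ i) (rep′ j) → i ≡ j
    distinct′ zero    zero    _   = refl
    distinct′ zero    (suc j) iso = ⊥-elim (new (j , iso))
    distinct′ (suc i) zero    iso = ⊥-elim (new (i , Isomorphic-sym (rep i) f iso))
    distinct′ (suc i) (suc j) iso = cong suc (distinct i j iso)
    complete′ : ∀ g → g ∈ f ∷ fs → IsKFunction k g → ∃ λ i → Isomorphic g (rep′ i)
    complete′ g (here refl) _ = zero , ≗⇒Isomorphic f f (λ _ → refl)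
    complete′ g (there g∈) Kg = let i , iso = complete g g∈ Kg in suc i , iso

  classes : ∀ n k → Σ ℕ (IsG n k)
  classes n k =
    let m , rep , K , distinct , complete = classify k (allFns n)
    in m , rep , K , distinct , λ f Kf →
       let g , g∈ , f≗g = allFns-complete f
           i , iso = complete g g∈ (isKFunction-ext f≗g Kf)
       in i , Isomorphic-trans f g (rep i) (≗⇒Isomorphic f g f≗g) iso

  module _ {n k m m′ : ℕ} (γ : IsG n k m) (γ′ : IsG (suc n) k m′) where

    private
      rep       = proj₁ γ
      K         = proj₁ (proj₂ γ)
      distinct  = proj₁ (proj₂ (proj₂ γ))
      complete  = proj₂ (proj₂ (proj₂ γ))
      rep′      = proj₁ γ′
      K′        = proj₁ (proj₂ γ′)
      distinct′ = proj₁ (proj₂ (proj₂ γ′))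
      complete′ = proj₂ (proj₂ (proj₂ γ′))

      lift : Fin m → BoolFn (suc n)
      lift i x = rep i (tail x)

      class : ∀ i → ∃ λ j → Isomorphic (lift i) (rep′ j)
      class i = complete′ (lift i) (isKFunction-tail (K i))

      same : ∀ f {c j} → Isomorphic f (rep′ c) → c ≡ proj₁ (class j) → Isomorphic f (lift j)
      same f {c} {j} iso refl = Isomorphic-trans f (rep′ c) (lift j) iso (Isomorphic-sym (lift j) (rep′ c) (proj₂ (class j)))

      class-injective : ∀ {i j} → proj₁ (class i) ≡ proj₁ (class j) → i ≡ j
      class-injective {i} {j} e = distinct i j (Isomorphic-tail⁻¹ (rep i) (rep j) (same (lift i) (proj₂ (class i)) e))

    G-increasing : m ≤ m′
    G-increasing = injective⇒≤ {f = λ i → proj₁ (class i)} class-injective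

    -- Any function isomorphic to a lift has an irrelevant coordinate, so the class of `f` is not
    -- hit by the injection behind `G-increasing`.
    G-strict : (f : BoolFn (suc n)) → IsKFunction k f → (∀ i → DependsOn f i) → m < m′
    G-strict f Kf dep = injective⇒≤ {f = class⁺} class⁺-injective
      where
      class⁺ : Fin (suc m) → Fin m′
      class⁺ zero    = proj₁ (complete′ f Kf)
      class⁺ (suc i) = proj₁ (class i)
      separate : ∀ i → proj₁ (complete′ f Kf) ≢ proj₁ (class i)
      separate i e =
        let j , irr = irrelevant-coordinate f (rep i) (same f (proj₂ (complete′ f Kf)) e)
            x , ne = dep j
        in ne (irr x)
      class⁺-injective : ∀ {i j} → class⁺ i ≡ class⁺ j → i ≡ j
      class⁺-injective {zero}  {zero}  e = refl
      class⁺-injective {zero}  {suc j} e = ⊥-elim (separate j e)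
      class⁺-injective {suc i} {zero}  e = ⊥-elim (separate i (sym e))
      class⁺-injective {suc i} {suc j} e = cong suc (class-injective e)

    -- Every k-function on the larger cube has an irrelevant variable and is isomorphic to a lift.
    -- Dropping that variable injects the classes into those of the smaller cube.
    G-constant : 4394 * 2 ^ k < 1000 * suc n → m′ ≤ m
    G-constant big = injective⇒≤ {f = λ j → proj₁ (class⁻ j)} class⁻-injective
      where
      reduced : ∀ j → Σ (BoolFn n) λ f → IsKFunction k f × Isomorphic (rep′ j) (λ x → f (tail x))
      reduced j =
        let i , irr = irrelevant-exists {f = rep′ j} (K′ j) big
        in (λ y → rep′ j (insertAt y i false)) , isKFunction-insertAt {f = rep′ j} i irr (K′ j) , drop-coordinate (rep′ j) i irr
      class⁻ : ∀ j → ∃ λ i → Isomorphic (proj₁ (reduced j)) (rep i)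
      class⁻ j = complete (proj₁ (reduced j)) (proj₁ (proj₂ (reduced j)))
      to-lift : ∀ j → Isomorphic (rep′ j) (lift (proj₁ (class⁻ j)))
      to-lift j = let f , _ , iso = reduced j ; i , iso′ = class⁻ j in
        Isomorphic-trans (rep′ j) (λ x → f (tail x)) (lift i) iso (Isomorphic-tail f (rep i) iso′)
      class⁻-injective : ∀ {i j} → proj₁ (class⁻ i) ≡ proj₁ (class⁻ j) → i ≡ j
      class⁻-injective {i} {j} e = distinct′ i j
        (Isomorphic-trans (rep′ i) (lift (proj₁ (class⁻ i))) (rep′ j) (to-lift i)
          (Isomorphic-sym (rep′ j) (lift (proj₁ (class⁻ i)))
            (subst (λ c → Isomorphic (rep′ j) (lift c)) (sym e) (to-lift j))))

  least : (P : ℕ → Set) → (∀ n → Dec (P n)) → ∀ d k → P (d + k) →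
          Σ ℕ λ N → k ≤ N × N ≤ d + k × P N × (∀ M → k ≤ M → M < N → ¬ P M)
  least P P? d k p with P? k
  least P P? d       k p | yes q = k , ≤-refl , m≤n+m k d , q , λ M k≤M M<k → ⊥-elim (<⇒≱ M<k k≤M)
  least P P? zero    k p | no ¬q = ⊥-elim (¬q p)
  least P P? (suc d) k p | no ¬q =
    let N , k<N , N≤ , q , min = least P P? d (suc k) (subst P (sym (+-suc d k)) p)
    in N , <⇒≤ k<N , subst (N ≤_) (+-suc d k) N≤ , q ,
       λ M k≤M M<N → [ (λ k<M → min M k<M M<N) , (λ { refl → ¬q }) ]′ (m≤n⇒m<n∨m≡n k≤M)

  module _ (G : ℕ → ℕ) (k B : ℕ) (k≤B : k ≤ B) (increasing : ∀ n → k ≤ n → G n ≤ G (suc n))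
           (constant : ∀ n → B ≤ n → G (suc n) ≤ G n) where

    private
      mono : ∀ d n → k ≤ n → G n ≤ G (d + n)
      mono zero    n l = ≤-refl
      mono (suc d) n l = ≤-trans (mono d n l) (increasing (d + n) (≤-trans l (m≤n+m n d)))

      mono-≤ : ∀ {m n} → k ≤ m → m ≤ n → G m ≤ G n
      mono-≤ {m} {n} l m≤n = subst (λ z → G m ≤ G z) (m∸n+n≡m m≤n) (mono (n ∸ m) m l)

      anti : ∀ d n → B ≤ n → G (d + n) ≤ G n
      anti zero    n l = ≤-refl
      anti (suc d) n l = ≤-trans (constant (d + n) (≤-trans l (m≤n+m n d))) (anti d n l)

      after-B : ∀ {n} → B ≤ n → G n ≡ G B
      after-B {n} B≤n = ≤-antisym (subst (λ z → G z ≤ G B) (m∸n+n≡m B≤n) (anti (n ∸ B) B ≤-refl)) (mono-≤ k≤B B≤n)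

    stabilisation : Σ ℕ λ N → k ≤ N × N ≤ B × (∀ n → N ≤ n → G n ≡ G N) ×
                    (∀ M → k ≤ M → M < N → ¬ (∀ n → M ≤ n → G n ≡ G M))
    stabilisation =
      -- `N` is the first index from `k` on with the final value `G B`; monotonicity squeezes the
      -- values between `N` and `B`.
      let N , k≤N , N≤ , GN , min = least (λ n → G n ≡ G B) (λ n → G n ≟ G B) (B ∸ k) k (cong G (m∸n+n≡m k≤B))
          N≤B = subst (N ≤_) (m∸n+n≡m k≤B) N≤
          after-N : ∀ n → N ≤ n → G n ≡ G N
          after-N n N≤n = [ (λ n≤B → ≤-antisym (≤-trans (mono-≤ (≤-trans k≤N N≤n) n≤B) (≤-reflexive (sym GN))) (mono-≤ k≤N N≤n))
                          , (λ B≤n → trans (after-B B≤n) (sym GN)) ]′ (≤-total n B)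
      in N , k≤N , N≤B , after-N ,
         λ M k≤M M<N const → min M k≤M M<N (sym (const B (≤-trans (<⇒≤ M<N) N≤B)))

  -- `B` is the largest integer below the rational bound: constancy from `B` on yields the upper
  -- bound on the threshold without loss from rounding.
  floor : ∀ X → Σ ℕ λ B → 1000 * B ≤ X × X < 1000 * suc B
  floor X = X / 1000 , lower , upper
    where
    open ≤-Reasoning
    lower : 1000 * (X / 1000) ≤ X
    lower = begin
      1000 * (X / 1000)               ≡⟨ *-comm 1000 (X / 1000) ⟩
      X / 1000 * 1000                 ≤⟨ m≤n+m _ (X % 1000) ⟩
      X % 1000 + X / 1000 * 1000      ≡⟨ m≡m%n+[m/n]*n X 1000 ⟨
      X                               ∎
    upper : X < 1000 * suc (X / 1000)
    upper = begin-strict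
      X                               ≡⟨ m≡m%n+[m/n]*n X 1000 ⟩
      X % 1000 + X / 1000 * 1000      <⟨ +-monoˡ-< (X / 1000 * 1000) (m%n<n X 1000) ⟩
      suc (X / 1000) * 1000           ≡⟨ *-comm (suc (X / 1000)) 1000 ⟩
      1000 * suc (X / 1000)           ∎

  n≤2^n : ∀ n → n ≤ 2 ^ n
  n≤2^n zero    = z≤n
  n≤2^n (suc n) = begin
    suc n              ≤⟨ +-mono-≤ (m^n>0 2 n) (n≤2^n n) ⟩
    2 ^ n + 2 ^ n      ≡⟨ cong (2 ^ n +_) (+-identityʳ (2 ^ n)) ⟨
    2 ^ suc n          ∎
    where open ≤-Reasoning

  extremalSize≡ : ∀ k → extremalSize k + 2 ≡ 3 * 2 ^ k
  extremalSize≡ zero    = refl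
  extremalSize≡ (suc k) = trans (lem (extremalSize k)) (trans (cong (2 *_) (extremalSize≡ k)) (lem′ (2 ^ k)))
    where
    lem : ∀ s → 2 + (s + s) + 2 ≡ 2 * (s + 2)
    lem = solve-∀
    lem′ : ∀ p → 2 * (3 * p) ≡ 3 * (2 * p)
    lem′ = solve-∀

  extremalSize-suc : ∀ k → ∃ λ l → extremalSize k ≡ suc l
  extremalSize-suc zero    = _ , refl
  extremalSize-suc (suc k) = _ , refl


-- Assembly of the sequence and its threshold

open import Defs
open import Data.Nat using (ℕ; suc; _+_; _*_; _^_; _≤_; _<_)
open import Data.Product using (Σ; _×_)
open import Relation.Binary.PropositionalEquality using (_≡_)
open import Relation.Nullary using (¬_)

open import Data.Nat using (zero; s≤s; s≤s⁻¹)
open import Data.Nat.Properties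
open import Data.Nat.Tactic.RingSolver using (solve-∀)
open import Data.Product using (_,_; proj₁; proj₂; ∃)
open import Relation.Binary.PropositionalEquality using (refl; sym; trans; cong)
open Automorphisms
open KFunctions
open Classification

-- The lower bound is stated doubled and the upper bound multiplied by 1000, so that neither
-- `2 ^ (k - 1)` at `k = 0` nor 4.394 leaves the natural numbers.
theorem2 : ∀ (k : ℕ) → Σ (ℕ → ℕ) λ G →
    (∀ n → k ≤ n → IsG n k (G n))
    × (∀ n → k ≤ n → G n ≤ G (suc n))
    × Σ ℕ λ N → k ≤ N
    × (∀ n → N ≤ n → G n ≡ G N)
    × (∀ M → k ≤ M → M < N → ¬ (∀ n → M ≤ n → G n ≡ G M))
    × 3 * 2 ^ k ≤ 2 * N + 4
    × 1000 * N ≤ 4394 * 2 ^ k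
theorem2 k =
  let N , k≤N , N≤B , constant , first = stabilisation G k B k≤B increasing eventually
  in G , (λ n _ → isG n) , increasing , N , k≤N , constant , first
   , lower-bound k N k≤N constant grows , ≤-trans (*-monoʳ-≤ 1000 N≤B) (proj₁ (proj₂ ⌊⌋))
  where
  G : ℕ → ℕ
  G n = proj₁ (classes n k)
  isG : ∀ n → IsG n k (G n)
  isG n = proj₂ (classes n k)
  ⌊⌋ : Σ ℕ λ B → 1000 * B ≤ 4394 * 2 ^ k × 4394 * 2 ^ k < 1000 * suc B
  ⌊⌋ = floor (4394 * 2 ^ k)
  B : ℕ
  B = proj₁ ⌊⌋
  increasing : ∀ n → k ≤ n → G n ≤ G (suc n)
  increasing n _ = G-increasing (isG n) (isG (suc n))
  k≤B : k ≤ B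
  k≤B = s≤s⁻¹ (*-cancelˡ-< 1000 k (suc B)
    (≤-<-trans (*-mono-≤ (m≤m+n 1000 3394) (n≤2^n k)) (proj₂ (proj₂ ⌊⌋))))
  eventually : ∀ n → B ≤ n → G (suc n) ≤ G n
  eventually n B≤n = G-constant (isG n) (isG (suc n))
    (<-≤-trans (proj₂ (proj₂ ⌊⌋)) (*-monoʳ-≤ 1000 (s≤s B≤n)))
  grows : ∀ n (f : BoolFn (suc n)) → IsKFunction k f → (∀ i → DependsOn f i) → G n < G (suc n)
  grows n = G-strict (isG n) (isG (suc n))
  lower-bound : ∀ k N → k ≤ N → (∀ n → N ≤ n → G n ≡ G N) →
    (∀ n (f : BoolFn (suc n)) → IsKFunction k f → (∀ i → DependsOn f i) → G n < G (suc n)) → 3 * 2 ^ k ≤ 2 * N + 4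
  -- For `k = 0` the bound on `N` is negative.
  lower-bound zero    N _ _ _ = ≤-trans (m≤m+n 3 1) (m≤n+m 4 (2 * N))
  lower-bound (suc k) N _ constant grows = begin
    3 * (2 * 2 ^ k)             ≡⟨ lem (2 ^ k) ⟩
    2 * (3 * 2 ^ k)             ≡⟨ cong (2 *_) (extremalSize≡ k) ⟨
    2 * (extremalSize k + 2)    ≡⟨ *-distribˡ-+ 2 (extremalSize k) 2 ⟩
    2 * extremalSize k + 4      ≤⟨ +-monoˡ-≤ 4 (*-monoʳ-≤ 2 (size≤N (extremalSize-suc k) (extremal k) (extremal-KFunction k) (extremal-depends k))) ⟩
    2 * N + 4                   ∎
    where
    open ≤-Reasoning
    lem : ∀ p → 3 * (2 * p) ≡ 2 * (3 * p)
    lem = solve-∀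
    size≤N : ∀ {s} → (∃ λ l → s ≡ suc l) → (f : BoolFn s) → KFunction (suc k) f → (∀ i → DependsOn f i) → s ≤ N
    -- If the threshold were at most `l`, the values at `l` and `suc l` would agree, but `f` creates
    -- a new class at `suc l`.
    size≤N (l , refl) f K dep = ≰⇒> λ N≤l → <-irrefl
      (trans (constant l N≤l) (sym (constant (suc l) (m≤n⇒m≤1+n N≤l)))) (grows l f (fromK {f = f} K) dep)
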